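{- Let $k\ge 3$ and $n>2k$ be integers, and let $$\beta=\begin{cases}-1 & \text{if } k \text{ is even and } 4\mid n,\\ 1 & \text{if } k \text{ is odd and } 4\mid n-2,\\ 0 & \text{otherwise.}\end{cases}$$ Then $$\nu_k(K_n)\ \ge\ \begin{cases} L_{k,n}(1)=\frac12(n-3)(n-2k) & \text{if } 2k<n\le 3k,\\[2pt] L_{k,n}(2)=(n-3)\left(n-\frac52k\right)-k\,\delta_1(n) & \text{if } 3k<n\le 4k,\\[2pt] L_{k,n}(3)=\frac32(n-3)(n-3k)-k\left(\delta_1(n)+\delta_2(n)\right) & \text{if } 4k<n\le \lfloor 4.5k\rfloor+\beta,\\[2pt] L_{k,n}(4)=2(n-3)\left(n-\frac{27}{8}k\right)-k\left(\delta_1(n)+\delta_2(n)+\delta_3(n)\right) & \text{if } \lfloor 4.5k\rfloor+\beta<n\le 5k,\\[2pt] L_{k,n}(5)=\frac52(n-3)\left(n-\frac{37}{10}k\right)-k\left(\delta_1(n)+\delta_2(n)+\delta_3(n)+\delta_4(n)\right) & \text{otherwise.} \end{cases}$$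
   Context: A $k$-page book consists of $k$ halfplanes (pages) with a common boundary line (the spine). A $k$-page book drawing of a graph $G$ is a drawing of $G$ in a $k$-page book in which all vertices lie on the spine and edges do not cross the spine (each edge lies in one page). The $k$-page book crossing number $\nu_k(G)$ is the minimum number of edge-crossings over all $k$-page book drawings of $G$. Equivalently (convex model), $\nu_k(K_n)$ is the minimum, over all colorings of the edges of the complete geometric graph on the $n$ vertices of a convex polygon with $k$ colors, of the number of monochromatic crossings, i.e. pairs of edges of the same color that cross in their interiors. $K_n$ is the complete graph on $n$ vertices. $D_n$ denotes the complete convex graph on $n$ vertices minus the sides of the polygon: its vertices are the vertices of a convex $n$-gon and its edges are all the diagonals (straight segments) of the polygon. For an integer $\ell\ge 0$, $e_\ell(n)$ is the maximum number of edges over all subgraphs of $D_n$ in which each edge is crossed at most $\ell$ times by other edges of the subgraph. For integers $k\ge1$, $n\ge 3$, $m\ge 0$, $$L_{k,n}(m):=\frac m2 n(n-3)-k\sum_{\ell=0}^{m-1}e_\ell(n).$$ The functions $\delta_i$ are: $\delta_1(n)=\tfrac12$ if $n$ is even and $0$ otherwise; $\delta_2(n)=1$ if $n\equiv 2\pmod 3$ and $0$ otherwise; $\delta_3(n)=-\tfrac14,\tfrac12,\tfrac54,0$ if $n\equiv 0,1,2,3\pmod 4$, respectively; $\delta_4(n)=\tfrac12,0,\tfrac32,1$ if $n\equiv 0,1,2,3\pmod 4$, respectively. -}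

module Defs where

open import Data.Bool.Base using (if_then_else_)
open import Data.Fin.Base as Fin using (Fin; toℕ)
import Data.Fin.Properties as Fin
open import Data.Integer.Base as ℤ using (ℤ; +_; -1ℤ; 0ℤ; 1ℤ)
open import Data.List.Base
  using (List; []; _∷_; _++_; map; length; filter; upTo; allFin;
         cartesianProduct; cartesianProductWith)
open import Data.List.Extrema.Nat using (min; max)
open import Data.List.Relation.Unary.All using (All; all?)
open import Data.Nat.Base as ℕ using (ℕ; suc; _≤_; ∣_-_∣)
open import Data.Nat.Divisibility using (_∣?_)
open import Data.Nat.DivMod using (_%_)
open import Data.Nat.ListAction using (sum)
import Data.Nat.Properties as ℕ
open import Data.Product.Base using (_×_; _,_)
open import Data.Rational.Base using (ℚ; _/_; _+_; _*_; _-_; 0ℚ; 1ℚ; ½)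
open import Data.Sum.Base using (_⊎_)
open import Relation.Binary.Core using (Rel)
open import Relation.Binary.Definitions using (Decidable)
open import Relation.Binary.PropositionalEquality using (_≡_)
open import Relation.Nullary.Decidable using (does; ¬?; _×-dec_; _⊎-dec_)
import Relation.Unary as Unary

-- The vertices of a convex n-gon are labelled 0, …, n-1 in cyclic order.
-- The edge with endpoints i < j is represented by the pair (i , j).

Edge : ℕ → Set
Edge n = Fin n × Fin n

edges : ∀ n → List (Edge n)
edges n = filter (λ (i , j) → i Fin.<? j) (cartesianProduct (allFin n) (allFin n))

Side : ∀ {n} → Edge n → Set
Side {n} (i , j) = suc (toℕ i) ≡ toℕ j ⊎ (toℕ i ≡ 0 × suc (toℕ j) ≡ n)

side? : ∀ {n} → Unary.Decidable (Side {n})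
side? {n} (i , j) =
  (suc (toℕ i) ℕ.≟ toℕ j) ⊎-dec ((toℕ i ℕ.≟ 0) ×-dec (suc (toℕ j) ℕ.≟ n))

diagonals : ∀ n → List (Edge n)
diagonals n = filter (λ d → ¬? (side? d)) (edges n)

-- Two segments between points in convex position cross in their interiors
-- exactly when their endpoints alternate around the polygon.

Crosses : ∀ {n} → Rel (Edge n) _
Crosses (a , c) (b , d) =
  (a Fin.< b × b Fin.< c × c Fin.< d) ⊎ (b Fin.< a × a Fin.< d × d Fin.< c)

crosses? : ∀ {n} → Decidable (Crosses {n})
crosses? (a , c) (b , d) =
  ((a Fin.<? b) ×-dec (b Fin.<? c) ×-dec (c Fin.<? d)) ⊎-dec
  ((b Fin.<? a) ×-dec (a Fin.<? d) ×-dec (d Fin.<? c))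

-- The number of pairs of positions i < j in a list whose entries are related.

countPairs : ∀ {a r} {A : Set a} {R : Rel A r} → Decidable R → List A → ℕ
countPairs R? []       = 0
countPairs R? (x ∷ xs) = length (filter (R? x) xs) ℕ.+ countPairs R? xs

-- A k-colouring of a list of edges pairs every edge with its colour.

ColouredEdge : ℕ → ℕ → Set
ColouredEdge k n = Edge n × Fin k

colourings : ∀ k {n} → List (Edge n) → List (List (ColouredEdge k n))
colourings k []       = [] ∷ []
colourings k (e ∷ es) =
  cartesianProductWith (λ c χ → (e , c) ∷ χ) (allFin k) (colourings k es)

MonoCrosses : ∀ {k n} → Rel (ColouredEdge k n) _
MonoCrosses (e , c) (f , d) = Crosses e f × c ≡ d

monoCrosses? : ∀ {k n} → Decidable (MonoCrosses {k} {n})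
monoCrosses? (e , c) (f , d) = crosses? e f ×-dec (c Fin.≟ d)

-- ν k n is the k-page book crossing number of Kₙ.  The first argument of min
-- is the total number of crossings, which no colouring exceeds; it therefore
-- affects the value only when there is no colouring at all (k = 0, n ≥ 2).

ν : ℕ → ℕ → ℕ
ν k n = min (countPairs crosses? (edges n))
            (map (countPairs monoCrosses?) (colourings k (edges n)))

sublists : ∀ {a} {A : Set a} → List A → List (List A)
sublists []       = [] ∷ []
sublists (x ∷ xs) = sublists xs ++ map (x ∷_) (sublists xs)

crossingsOn : ∀ {n} → List (Edge n) → Edge n → ℕ
crossingsOn H d = length (filter (crosses? d) H)

CrossedAtMost : ∀ {n} → ℕ → List (Edge n) → Set
CrossedAtMost ℓ H = All (λ d → crossingsOn H d ≤ ℓ) H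

crossedAtMost? : ∀ {n} ℓ → Unary.Decidable (CrossedAtMost {n} ℓ)
crossedAtMost? ℓ H = all? (λ d → crossingsOn H d ℕ.≤? ℓ) H

e : ℕ → ℕ → ℕ
e ℓ n = max 0 (map length (filter (crossedAtMost? ℓ) (sublists (diagonals n))))

fromℕ : ℕ → ℚ
fromℕ n = + n / 1

L : ℕ → ℕ → ℕ → ℚ
L k n m = (+ m / 2) * fromℕ n * (fromℕ n - fromℕ 3)
        - fromℕ k * fromℕ (sum (map (λ ℓ → e ℓ n) (upTo m)))

δ₁ δ₂ δ₃ δ₄ : ℕ → ℚ

δ₁ n with n % 2
... | 0 = ½
... | _ = 0ℚ

δ₂ n with n % 3
... | 2 = 1ℚ
... | _ = 0ℚ

δ₃ n with n % 4
... | 0 = -1ℤ / 4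
... | 1 = ½
... | 2 = + 5 / 4
... | _ = 0ℚ

δ₄ n with n % 4
... | 0 = ½
... | 1 = 0ℚ
... | 2 = + 3 / 2
... | _ = 1ℚ

-- ∣ n - 2 ∣ is the absolute difference, so 4 ∣ ∣ n - 2 ∣ means n ≡ 2 (mod 4).

β : ℕ → ℕ → ℤ
β k n =
  if does ((2 ∣? k) ×-dec (4 ∣? n)) then -1ℤ else
  if does (¬? (2 ∣? k) ×-dec (4 ∣? ∣ n - 2 ∣)) then 1ℤ else 0ℤ

-- ⌊4.5 k⌋ + β
threshold : ℕ → ℕ → ℤ
threshold k n = + ((9 ℕ.* k) ℕ./ 2) ℤ.+ β k n

{-# OPTIONS --safe #-}
module Submission where

-- While a colour class has more than e m n diagonals, one of them is crossed more
-- than m times; removing such diagonals one by one gives ν k n ≥ L k n m, so it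
-- remains to determine e ℓ n for ℓ ≤ 4.
--
-- Sets of that size arise by gluing small polygons along chords.  For the upper
-- bound consider a smallest set of chords that is too large.  Collapsing an interval
-- of t vertices shows that the interval is touched by more chords than its share.
-- Choose a chord that spans more than T = ℓ + 1 sides while all chords below it span
-- at most T.  At most ℓ chords leave the interval below it, and the short chords
-- inside grow too slowly in number if the interval is long.  The remaining interval
-- lengths are excluded by a finite search over the short chords and the numbers of
-- chords that leave the interval at each vertex.

-- A set of chords is counted together with the closing side `(0 , m-1)`, which nothing crosses.
-- Sizes then add up exactly when two polygons are glued along a chord, and they depend on the
-- number `m - 2` of inner vertices; `e ℓ n` is one less than the extremal size for `n - 2`.
-- Superadditivity of the extremal functions makes every interval of a counterexample overfull.
--
-- The obstacle is that little is known about chords leaving an interval. Only their number at each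
-- inner vertex enters, which suffices because such a chord crosses every inner chord passing over
-- that vertex. At least `g t` chords besides the long one touch the interval below it, and at most
-- `ℓ` of them leave. Short chords number at most 1, 3/2, 7/4, 2 per vertex for `ℓ` = 1, 2, 3, 4,
-- always 1/2 less than the slope 3/2, 2, 9/4, 5/2 of `g`, so `t` is at most 3, 7, 10, 15.
--
-- For `ℓ = 4` two structural facts join the inequalities: a leaving chord whose crossings are all
-- used up by the interval forces one more chord to touch it, and a chord cutting off four vertices
-- comes with certain shorter chords.

module Counting where
  open import Data.Bool.Base using (Bool; true; false; if_then_else_; not)
  open import Data.Bool.Properties using (T-≡)
  open import Data.Empty using (⊥; ⊥-elim)
  open import Data.Fin.Base as Fin using (Fin; toℕ; fromℕ<)
  import Data.Fin.Properties as Fin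
  open import Data.List.Base
    using (List; []; _∷_; _++_; map; filter; length; upTo; applyUpTo; allFin; cartesianProduct; cartesianProductWith)
  open import Data.List.Extrema.Nat using (max≤v⁺; v≤max⁺; xs≤max; v≤min⁺)
  import Data.List.Membership.DecPropositional as DecMembership
  open import Data.List.Membership.Propositional using (_∈_; find; lose)
  open import Data.List.Membership.Propositional.Properties
  open import Data.List.Properties
    using (length-map; length-++; length-tabulate; length-upTo; map-++; upTo-∷ʳ; filter-accept; filter-reject)
  open import Data.List.Relation.Binary.Pointwise using (Pointwise; []; _∷_)
  open import Data.List.Relation.Unary.All as All using (All; []; _∷_; all?)
  import Data.List.Relation.Unary.All.Properties as All
  open import Data.List.Relation.Unary.AllPairs using ([]; _∷_; allPairs?)
  open import Data.List.Relation.Unary.Any using (here; there; any?)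
  open import Data.List.Relation.Unary.Unique.Propositional using (Unique)
  import Data.List.Relation.Unary.Unique.Propositional.Properties as Unique
  open import Data.Nat.Base using (ℕ; zero; suc; _+_; _*_; _∸_; _⊔_; _≤_; _<_; _≤ᵇ_; _<ᵇ_; z≤n; s≤s; NonZero)
  open import Data.Nat.DivMod using (_/_; m*n/n≡m; m<n*o⇒m/o<n; /-monoˡ-≤)
  open import Data.Nat.Induction using (<-rec; <-wellFounded)
  open import Data.Nat.ListAction using (sum)
  open import Data.Nat.ListAction.Properties using (sum-++)
  open import Data.Nat.Properties
  open import Data.Product.Base using (∃; _×_; _,_; proj₁; proj₂)
  open import Data.Product.Properties using (,-injective; ≡-dec)
  open import Data.Sum.Base using (_⊎_; inj₁; inj₂)
  open import Data.Unit.Base using (⊤)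
  open import Defs
    using (Edge; edges; Side; side?; diagonals; Crosses; crosses?; countPairs; ColouredEdge; colourings; monoCrosses?; ν;
           sublists; crossingsOn; CrossedAtMost; crossedAtMost?; e)
  open import Function.Base using (_∘_; case_of_)
  open import Function.Bundles using (Equivalence)
  open import Induction.WellFounded using (Acc; acc)
  open import Relation.Binary.Definitions using (tri<; tri≈; tri>)
  open import Relation.Binary.PropositionalEquality
  open import Relation.Nullary.Decidable
    using (Dec; yes; no; does; True; toWitness; map′; ¬?; dec-true; dec-false; _×-dec_; _⊎-dec_)
  open import Relation.Nullary.Negation using (¬_; contradiction)
  open import Relation.Unary using (Decidable)

  -- Finite sums and indicators

  ∑ : ∀ {A : Set} → (A → ℕ) → List A → ℕ
  ∑ f []       = 0
  ∑ f (x ∷ xs) = f x + ∑ f xs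

  ∑-mono : ∀ {A : Set} {f g : A → ℕ} xs → (∀ {x} → x ∈ xs → f x ≤ g x) → ∑ f xs ≤ ∑ g xs
  ∑-mono []       _   = z≤n
  ∑-mono (x ∷ xs) f≤g = +-mono-≤ (f≤g (here refl)) (∑-mono xs (f≤g ∘ there))

  ∑-cong : ∀ {A : Set} {f g : A → ℕ} xs → (∀ {x} → x ∈ xs → f x ≡ g x) → ∑ f xs ≡ ∑ g xs
  ∑-cong []       _   = refl
  ∑-cong (x ∷ xs) f≡g = cong₂ _+_ (f≡g (here refl)) (∑-cong xs (f≡g ∘ there))

  ∑-+ : ∀ {A : Set} (f g : A → ℕ) xs → ∑ (λ x → f x + g x) xs ≡ ∑ f xs + ∑ g xs
  ∑-+ f g []       = refl
  ∑-+ f g (x ∷ xs) = begin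
    f x + g x + ∑ (λ x → f x + g x) xs ≡⟨ cong (f x + g x +_) (∑-+ f g xs) ⟩
    f x + g x + (∑ f xs + ∑ g xs)      ≡⟨ +-assoc (f x) (g x) _ ⟩
    f x + (g x + (∑ f xs + ∑ g xs))    ≡⟨ cong (f x +_) (+-assoc (g x) (∑ f xs) _) ⟨
    f x + (g x + ∑ f xs + ∑ g xs)      ≡⟨ cong (λ z → f x + (z + ∑ g xs)) (+-comm (g x) (∑ f xs)) ⟩
    f x + (∑ f xs + g x + ∑ g xs)      ≡⟨ cong (f x +_) (+-assoc (∑ f xs) (g x) _) ⟩
    f x + (∑ f xs + (g x + ∑ g xs))    ≡⟨ +-assoc (f x) (∑ f xs) _ ⟨
    f x + ∑ f xs + (g x + ∑ g xs)      ∎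
    where open ≡-Reasoning

  ∑-const : ∀ {A : Set} c (xs : List A) → ∑ (λ _ → c) xs ≡ length xs * c
  ∑-const c []       = refl
  ∑-const c (x ∷ xs) = cong (c +_) (∑-const c xs)

  ∑-0 : ∀ {A : Set} {f : A → ℕ} xs → (∀ {x} → x ∈ xs → f x ≡ 0) → ∑ f xs ≡ 0
  ∑-0 []       _   = refl
  ∑-0 (x ∷ xs) f≡0 = cong₂ _+_ (f≡0 (here refl)) (∑-0 xs (f≡0 ∘ there))

  ∑-*ˡ : ∀ {A : Set} c (f : A → ℕ) xs → ∑ (λ x → c * f x) xs ≡ c * ∑ f xs
  ∑-*ˡ c f []       = sym (*-zeroʳ c)
  ∑-*ˡ c f (x ∷ xs) = trans (cong (c * f x +_) (∑-*ˡ c f xs)) (sym (*-distribˡ-+ c (f x) _))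

  ∑-++ : ∀ {A : Set} (f : A → ℕ) xs ys → ∑ f (xs ++ ys) ≡ ∑ f xs + ∑ f ys
  ∑-++ f []       ys = refl
  ∑-++ f (x ∷ xs) ys = trans (cong (f x +_) (∑-++ f xs ys)) (sym (+-assoc (f x) _ _))

  ∑-swap : ∀ {A B : Set} (f : A → B → ℕ) xs ys → ∑ (λ x → ∑ (f x) ys) xs ≡ ∑ (λ y → ∑ (λ x → f x y) xs) ys
  ∑-swap f []       ys = sym (∑-0 ys (λ _ → refl))
  ∑-swap f (x ∷ xs) ys = trans (cong (∑ (f x) ys +_) (∑-swap f xs ys)) (sym (∑-+ (f x) _ ys))

  ∑-map : ∀ {A B : Set} (f : B → ℕ) (h : A → B) xs → ∑ f (map h xs) ≡ ∑ (f ∘ h) xs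
  ∑-map f h []       = refl
  ∑-map f h (x ∷ xs) = cong (f (h x) +_) (∑-map f h xs)

  ∈⇒≤∑ : ∀ {A : Set} (f : A → ℕ) {x xs} → x ∈ xs → f x ≤ ∑ f xs
  ∈⇒≤∑ f (here refl) = m≤m+n _ _
  ∈⇒≤∑ f (there x∈)  = ≤-trans (∈⇒≤∑ f x∈) (m≤n+m _ _)

  ∑-single : ∀ {A : Set} {f : A → ℕ} {i} xs → (∀ x → Dec (x ≡ i)) → Unique xs → (∀ {x} → x ≢ i → f x ≡ 0) → ∑ f xs ≤ f i
  ∑-single []       _   _        _ = z≤n
  ∑-single {f = f} (x ∷ xs) _≟i (x∉ ∷ u) h with x ≟i
  ... | yes refl = ≤-reflexive (trans (cong (f x +_) (∑-0 xs λ y∈ → h (≢-sym (All.lookup x∉ y∈)))) (+-identityʳ _))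
  ... | no  x≢i  = ≤-trans (≤-reflexive (cong (_+ ∑ f xs) (h x≢i))) (∑-single xs _≟i u h)

  ind : ∀ {P : Set} → Dec P → ℕ
  ind p? = if does p? then 1 else 0

  ind-1 : ∀ {P : Set} (p? : Dec P) → P → ind p? ≡ 1
  ind-1 p? p = cong (if_then 1 else 0) (dec-true p? p)

  ind-0 : ∀ {P : Set} (p? : Dec P) → ¬ P → ind p? ≡ 0
  ind-0 p? ¬p = cong (if_then 1 else 0) (dec-false p? ¬p)

  ind≤1 : ∀ {P : Set} (p? : Dec P) → ind p? ≤ 1
  ind≤1 (yes _) = s≤s z≤n
  ind≤1 (no  _) = z≤n

  ind-mono : ∀ {P Q : Set} (p? : Dec P) (q? : Dec Q) → (P → Q) → ind p? ≤ ind q?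
  ind-mono (yes p) q? f = ≤-reflexive (sym (ind-1 q? (f p)))
  ind-mono (no ¬p) q? f = z≤n

  ind≤ : ∀ {P : Set} (p? : Dec P) {n : ℕ} → (P → 1 ≤ n) → ind p? ≤ n
  ind≤ (yes p) f = f p
  ind≤ (no  _) f = z≤n

  ind-split : ∀ {P Q : Set} (p? : Dec P) (q? : Dec Q) → ind (p? ×-dec ¬? q?) + ind (p? ×-dec q?) ≤ ind p?
  ind-split (yes _) (yes _) = ≤-refl
  ind-split (yes _) (no  _) = ≤-refl
  ind-split (no  _) _       = ≤-refl

  ind-elim : ∀ {P : Set} (p? : Dec P) → 1 ≤ ind p? → P
  ind-elim (yes p) _ = p

  count : ∀ {A : Set} {P : A → Set} → Decidable P → List A → ℕ
  count P? = ∑ (λ x → ind (P? x))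

  length-filter≡count : ∀ {A : Set} {P : A → Set} (P? : Decidable P) → ∀ xs → length (filter P? xs) ≡ count P? xs
  length-filter≡count P? []       = refl
  length-filter≡count P? (x ∷ xs) with P? x
  ... | yes _ = cong suc (length-filter≡count P? xs)
  ... | no  _ = length-filter≡count P? xs

  count-1≤ : ∀ {A : Set} {P : A → Set} (P? : Decidable P) → ∀ xs → 1 ≤ count P? xs → ∃ λ x → x ∈ xs × P x
  count-1≤ P? (x ∷ xs) 1≤ with P? x
  ... | yes p = x , here refl , p
  ... | no  _ with y , y∈ , p ← count-1≤ P? xs 1≤ = y , there y∈ , p

  count-filter : ∀ {A : Set} {P Q : A → Set} (P? : Decidable P) (Q? : Decidable Q) → ∀ xs → count P? (filter Q? xs) ≤ count P? xs
  count-filter P? Q? []       = z≤n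
  count-filter P? Q? (x ∷ xs) with Q? x
  ... | yes _ = +-monoʳ-≤ (ind (P? x)) (count-filter P? Q? xs)
  ... | no  _ = ≤-trans (count-filter P? Q? xs) (m≤n+m _ _)

  unique-map : ∀ {A B : Set} {f : A → B} xs → (∀ {x y} → x ∈ xs → y ∈ xs → f x ≡ f y → x ≡ y) → Unique xs → Unique (map f xs)
  unique-map []       _   _        = []
  unique-map {f = f} (x ∷ xs) inj (x∉ ∷ u) =
    All.tabulate (λ {z} z∈ fx≡z → case ∈-map⁻ f z∈ of λ where
      (y , y∈ , refl) → All.lookup x∉ y∈ (inj (here refl) (there y∈) fx≡z))
    ∷ unique-map xs (λ x∈ y∈ → inj (there x∈) (there y∈)) u

  unique-⊆⇒length≤ : ∀ {A : Set} {xs : List A} ys → Unique xs → (∀ {x} → x ∈ xs → x ∈ ys) → length xs ≤ length ys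
  unique-⊆⇒length≤ {xs = []}     ys _        _ = z≤n
  unique-⊆⇒length≤ {xs = x ∷ xs} ys (x∉ ∷ u) ⊆ with as , bs , refl ← ∈-∃++ (⊆ (here refl)) = begin
    suc (length xs)              ≤⟨ s≤s (unique-⊆⇒length≤ (as ++ bs) u ⊆′) ⟩
    suc (length (as ++ bs))      ≡⟨ cong suc (length-++ as) ⟩
    suc (length as + length bs)  ≡⟨ +-suc (length as) (length bs) ⟨
    length as + suc (length bs)  ≡⟨ length-++ as ⟨
    length (as ++ x ∷ bs)        ∎
    where
    open ≤-Reasoning
    ⊆′ : ∀ {y} → y ∈ xs → y ∈ as ++ bs
    ⊆′ y∈ with ∈-++⁻ as (⊆ (there y∈))
    ... | inj₁ p         = ∈-++⁺ˡ p
    ... | inj₂ (here refl) = contradiction refl (All.lookup x∉ y∈)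
    ... | inj₂ (there p) = ∈-++⁺ʳ as p

  -- Chords

  Chord : Set
  Chord = ℕ × ℕ

  Cross : Chord → Chord → Set
  Cross (a , b) (x , y) = (a < x × x < b × b < y) ⊎ (x < a × a < y × y < b)

  cross? : ∀ e f → Dec (Cross e f)
  cross? (a , b) (x , y) =
    ((a <? x) ×-dec (x <? b) ×-dec (b <? y)) ⊎-dec ((x <? a) ×-dec (a <? y) ×-dec (y <? b))

  crossings : List Chord → Chord → ℕ
  crossings G e = count (cross? e) G

  -- A set of chords between the vertices 0, …, m-1, among them possibly the side
  -- (0 , m-1) but no other side, each crossed at most ℓ times.

  record Closed (ℓ m : ℕ) (G : List Chord) : Set where
    field
      spans  : ∀ {a b} → (a , b) ∈ G → 2 + a ≤ b × b < m
      unique : Unique G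
      capped : ∀ {e} → e ∈ G → crossings G e ≤ ℓ

  module _ (φ : ℕ → ℕ) where

    relabel : Chord → Chord
    relabel (a , b) = φ a , φ b

    module _ {V : ℕ → Set} (mono : ∀ {x y} → V x → V y → x < y → φ x < φ y) where

      reflect : ∀ {x y} → V x → V y → φ x < φ y → x < y
      reflect {x} {y} vx vy φ< with <-cmp x y
      ... | tri< x<y _ _ = x<y
      ... | tri≈ _ refl _ = contradiction φ< (<-irrefl refl)
      ... | tri> _ _ y<x = contradiction (mono vy vx y<x) (<-asym φ<)

      injective : ∀ {x y} → V x → V y → φ x ≡ φ y → x ≡ y
      injective {x} {y} vx vy φ≡ with <-cmp x y
      ... | tri< x<y _ _ = contradiction φ≡ (<⇒≢ (mono vx vy x<y))
      ... | tri≈ _ x≡y _ = x≡y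
      ... | tri> _ _ y<x = contradiction (sym φ≡) (<⇒≢ (mono vy vx y<x))

      reflect-cross : ∀ {a b x y} → V a → V b → V x → V y →
                      Cross (φ a , φ b) (φ x , φ y) → Cross (a , b) (x , y)
      reflect-cross va vb vx vy (inj₁ (p , q , r)) = inj₁ (reflect va vx p , reflect vx vb q , reflect vb vy r)
      reflect-cross va vb vx vy (inj₂ (p , q , r)) = inj₂ (reflect vx va p , reflect va vy q , reflect vy vb r)

      module _ {ℓ m m′ G} (cl : Closed ℓ m G) {P : Chord → Set} (P? : Decidable P)
               (ends : ∀ {a b} → (a , b) ∈ G → P (a , b) → V a × V b)
               (fits : ∀ {a b} → (a , b) ∈ G → P (a , b) → 2 + φ a ≤ φ b × φ b < m′) where
        open Closed cl

        -- A map that is increasing on the ends of the kept chords reflects crossings, so no chord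
        -- gains any. The predicate `V` delimits where `φ` has to be increasing. Deleting vertices,
        -- cutting out a window and gluing are all instances.
        closed-relabel : Closed ℓ m′ (map relabel (filter P? G))
        closed-relabel = record
          { spans  = λ e∈ → case ∈-map⁻ relabel e∈ of λ where
              ((a , b) , ab∈ , refl) → let ab∈G , p = ∈-filter⁻ P? ab∈ in fits ab∈G p
          ; unique = unique-map (filter P? G) inj (Unique.filter⁺ P? unique)
          ; capped = λ e∈ → case ∈-map⁻ relabel e∈ of λ where
              ((a , b) , ab∈ , refl) → cap ab∈
          }
          where
          inj : ∀ {e f} → e ∈ filter P? G → f ∈ filter P? G → relabel e ≡ relabel f → e ≡ f
          inj e∈ f∈ eq =
            let e∈G , pe = ∈-filter⁻ P? e∈
                f∈G , pf = ∈-filter⁻ P? f∈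
                va , vb = ends e∈G pe
                vx , vy = ends f∈G pf
                eqa , eqb = ,-injective eq
            in cong₂ _,_ (injective va vx eqa) (injective vb vy eqb)
          cap : ∀ {a b} → (a , b) ∈ filter P? G → crossings (map relabel (filter P? G)) (φ a , φ b) ≤ ℓ
          cap {a} {b} ab∈ = let ab∈G , p = ∈-filter⁻ P? ab∈; va , vb = ends ab∈G p in begin
            crossings (map relabel (filter P? G)) (φ a , φ b)
              ≡⟨ ∑-map _ relabel (filter P? G) ⟩
            ∑ (λ f → ind (cross? (φ a , φ b) (relabel f))) (filter P? G)
              ≤⟨ ∑-mono (filter P? G) (λ {f} f∈ → let f∈G , pf = ∈-filter⁻ P? f∈; vx , vy = ends f∈G pf in
                   ind-mono (cross? (φ a , φ b) (relabel f)) (cross? (a , b) f) (reflect-cross va vb vx vy)) ⟩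
            count (cross? (a , b)) (filter P? G)
              ≤⟨ count-filter (cross? (a , b)) P? G ⟩
            crossings G (a , b)
              ≤⟨ capped ab∈G ⟩
            ℓ ∎
            where open ≤-Reasoning

  -- The argument of `g` is the number of vertices strictly below the closing side, because this is
  -- the quantity that adds up under gluing.
  Bounded : ℕ → (ℕ → ℕ) → ℕ → Set
  Bounded ℓ g m = ∀ G → Closed ℓ m G → length G ≤ g (m ∸ 2)

  -- Collapsing an interval

  _≟ᶜ_ : (e f : Chord) → Dec (e ≡ f)
  _≟ᶜ_ = ≡-dec _≟_ _≟_

  Inside : ℕ → ℕ → ℕ → Set
  Inside a b x = a < x × x < b

  inside? : ∀ a b x → Dec (Inside a b x)
  inside? a b x = (a <? x) ×-dec (x <? b)

  -- These are the chords lost when the vertices strictly between `a` and `b` are deleted: those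
  -- that lose an end, and `(a , b)` itself, which turns into a side.
  Touch : ℕ → ℕ → Chord → Set
  Touch a b (x , y) = Inside a b x ⊎ Inside a b y ⊎ (x , y) ≡ (a , b)

  touch? : ∀ a b e → Dec (Touch a b e)
  touch? a b (x , y) = inside? a b x ⊎-dec inside? a b y ⊎-dec ((x , y) ≟ᶜ (a , b))

  Within : ℕ → ℕ → Chord → Set
  Within a b (x , y) = a ≤ x × y ≤ b

  within? : ∀ a b e → Dec (Within a b e)
  within? a b (x , y) = (a ≤? x) ×-dec (y ≤? b)

  outside : ∀ {a b} x → ¬ Inside a b x → x ≤ a ⊎ b ≤ x
  outside {a} {b} x ¬in with x ≤? a
  ... | yes x≤a = inj₁ x≤a
  ... | no  x≰a with x <? b
  ...   | yes x<b = contradiction (≰⇒> x≰a , x<b) ¬in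
  ...   | no  x≮b = inj₂ (≮⇒≥ x≮b)

  module Collapse (a s : ℕ) where
    b : ℕ
    b = suc (a + s)

    φ : ℕ → ℕ
    φ x with x ≤? a
    ... | yes _ = x
    ... | no  _ = x ∸ s

    φ-low : ∀ {x} → x ≤ a → φ x ≡ x
    φ-low {x} x≤a with x ≤? a
    ... | yes _   = refl
    ... | no  x≰a = contradiction x≤a x≰a

    a<b : a < b
    a<b = s≤s (m≤m+n a s)

    φ-high : ∀ {x} → b ≤ x → φ x ≡ x ∸ s
    φ-high {x} b≤x with x ≤? a
    ... | yes x≤a = contradiction (≤-<-trans x≤a a<b) (≤⇒≯ b≤x)
    ... | no  _   = refl

    s≤ : ∀ {x} → b ≤ x → s ≤ x
    s≤ b≤x = ≤-trans (≤-trans (m≤n+m s a) (n≤1+n _)) b≤x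

    high : ∀ {x} → b ≤ x → suc a ≤ x ∸ s
    high {x} b≤x = subst (_≤ x ∸ s) (m+n∸n≡m (suc a) s) (∸-monoˡ-≤ s b≤x)

    high-< : ∀ {x} → b < x → suc (suc a) ≤ x ∸ s
    high-< {x} b<x = subst (_≤ x ∸ s) (m+n∸n≡m (suc (suc a)) s) (∸-monoˡ-≤ s b<x)

    V : ℕ → Set
    V x = x ≤ a ⊎ b ≤ x

    φ-mono : ∀ {x y} → V x → V y → x < y → φ x < φ y
    φ-mono (inj₁ p) (inj₁ q) x<y = subst₂ _<_ (sym (φ-low p)) (sym (φ-low q)) x<y
    φ-mono (inj₁ p) (inj₂ q) x<y = subst₂ _<_ (sym (φ-low p)) (sym (φ-high q)) (≤-<-trans p (high q))
    φ-mono (inj₂ p) (inj₁ q) x<y = contradiction (<-≤-trans x<y q) (<⇒≯ (<-≤-trans a<b p))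
    φ-mono (inj₂ p) (inj₂ q) x<y = subst₂ _<_ (sym (φ-high p)) (sym (φ-high q)) (∸-monoˡ-< x<y (s≤ p))

    -- Only `a` and `b` become neighbours under the collapse, so `(a , b)` is the only surviving
    -- chord that could degenerate to a side.
    φ-span : ∀ {x y} → V x → V y → 2 + x ≤ y → (x , y) ≢ (a , b) → 2 + φ x ≤ φ y
    φ-span (inj₁ p) (inj₁ q) sp _ = subst₂ (λ u v → 2 + u ≤ v) (sym (φ-low p)) (sym (φ-low q)) sp
    φ-span {x} {y} (inj₁ p) (inj₂ q) sp ne = subst₂ (λ u v → 2 + u ≤ v) (sym (φ-low p)) (sym (φ-high q)) gap
      where
      gap : 2 + x ≤ y ∸ s
      gap with x ≟ a
      ... | no  x≢a = ≤-trans (s≤s (≤∧≢⇒< p x≢a)) (high q)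
      ... | yes refl = high-< (≤∧≢⇒< q λ { refl → ne refl })
    φ-span (inj₂ p) (inj₁ q) sp _ = contradiction (≤-trans (≤-trans (n≤1+n _) sp) q) (<⇒≱ (<-trans a<b (s≤s p)))
    φ-span {x} {y} (inj₂ p) (inj₂ q) sp _ = subst₂ (λ u v → 2 + u ≤ v) (sym (φ-high p)) (sym (φ-high q))
      (subst (_≤ y ∸ s) (+-∸-assoc 2 (s≤ p)) (∸-monoˡ-≤ s sp))

    φ-< : ∀ {x m} → V x → b < m → x < m → φ x < m ∸ s
    φ-< {x} {m} (inj₁ p) b<m x<m = subst (_< m ∸ s) (sym (φ-low p)) (≤-<-trans p (<-≤-trans (n<1+n a) (high (<⇒≤ b<m))))
    φ-< {x} {m} (inj₂ p) b<m x<m = subst (_< m ∸ s) (sym (φ-high p)) (∸-monoˡ-< x<m (s≤ p))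

  module Cuts {ℓ m : ℕ} {g : ℕ → ℕ} {G : List Chord} (cl : Closed ℓ m G)
              (IH : ∀ {m′} → m′ < m → Bounded ℓ g m′) where
    open Closed cl

    -- Deleting the s vertices strictly between the ends of a chord.
    untouched-bound : ∀ a s → 1 ≤ s → suc (a + s) < m →
                      count (λ e → ¬? (touch? a (suc (a + s)) e)) G ≤ g (m ∸ s ∸ 2)
    untouched-bound a s 1≤s b<m = begin
      count (λ e → ¬? (touch? a b e)) G                   ≡⟨ length-filter≡count _ G ⟨
      length (filter (λ e → ¬? (touch? a b e)) G)         ≡⟨ length-map (relabel φ) (filter (λ e → ¬? (touch? a b e)) G) ⟨
      length (map (relabel φ) (filter (λ e → ¬? (touch? a b e)) G))
        ≤⟨ IH (∸-monoʳ-< 1≤s (≤-trans (m≤n+m s (suc a)) (<⇒≤ b<m)))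
              _ (closed-relabel φ φ-mono cl _ ends fits) ⟩
      g (m ∸ s ∸ 2)                                       ∎
      where
      open ≤-Reasoning
      open Collapse a s
      ends : ∀ {x y} → (x , y) ∈ G → ¬ Touch a b (x , y) → V x × V y
      ends _ ¬t = outside _ (¬t ∘ inj₁) , outside _ (¬t ∘ inj₂ ∘ inj₁)
      fits : ∀ {x y} → (x , y) ∈ G → ¬ Touch a b (x , y) → 2 + φ x ≤ φ y × φ y < m ∸ s
      fits xy∈ ¬t = let vx , vy = ends xy∈ ¬t; sp , y<m = spans xy∈ in
        φ-span vx vy sp (¬t ∘ inj₂ ∘ inj₂) , φ-< vy b<m y<m

    within-bound : ∀ a t → suc (suc t) < m → count (within? a (a + suc t)) G ≤ g t
    within-bound a t m′<m = begin
      count (within? a b) G                        ≡⟨ length-filter≡count _ G ⟨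
      length (filter (within? a b) G)              ≡⟨ length-map (relabel (_∸ a)) (filter (within? a b) G) ⟨
      length (map (relabel (_∸ a)) (filter (within? a b) G))
        ≤⟨ IH m′<m _ (closed-relabel (_∸ a) {V = a ≤_} (λ p q x<y → ∸-monoˡ-< x<y p) cl _ ends fits) ⟩
      g t                                          ∎
      where
      open ≤-Reasoning
      b = a + suc t
      ends : ∀ {x y} → (x , y) ∈ G → Within a b (x , y) → a ≤ x × a ≤ y
      ends xy∈ (a≤x , _) = a≤x , ≤-trans a≤x (≤-trans (m≤n+m _ 2) (proj₁ (spans xy∈)))
      fits : ∀ {x y} → (x , y) ∈ G → Within a b (x , y) → 2 + (x ∸ a) ≤ y ∸ a × y ∸ a < suc (suc t)
      fits {x} {y} xy∈ (a≤x , y≤b) =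
        subst (_≤ y ∸ a) (+-∸-assoc 2 a≤x) (∸-monoˡ-≤ a (proj₁ (spans xy∈))) ,
        s≤s (≤-trans (∸-monoˡ-≤ a y≤b) (≤-reflexive (m+n∸m≡n a (suc t))))

    count-¬ : ∀ {P : Chord → Set} (P? : ∀ e → Dec (P e)) H → count P? H + count (λ e → ¬? (P? e)) H ≡ length H
    count-¬ P? []      = refl
    count-¬ P? (e ∷ H) with P? e
    ... | yes _ = cong suc (count-¬ P? H)
    ... | no  _ = trans (+-suc _ _) (cong suc (count-¬ P? H))

    count-≡≤1 : ∀ e → count (_≟ᶜ e) G ≤ 1
    count-≡≤1 e = ≤-trans (∑-single G (_≟ᶜ e) unique (λ {x} → ind-0 (x ≟ᶜ e))) (ind≤1 (e ≟ᶜ e))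

    module Excess (super : ∀ s r → g s + g r ≤ g (s + r)) (big : g (m ∸ 2) < length G) where

      -- The chords that survive the collapse number at most `g (m - 2 - s)` by induction, and `g s
      -- + g (m - 2 - s) ≤ g (m - 2) < length G`; the difference must have been lost.
      touch-excess : ∀ a s → 1 ≤ s → suc (a + s) < m → suc (g s) ≤ count (touch? a (suc (a + s))) G
      touch-excess a s 1≤s b<m = +-cancelʳ-≤ _ _ _ (begin
        suc (g s) + count (λ e → ¬? (touch? a b e)) G ≤⟨ +-monoʳ-≤ (suc (g s)) (untouched-bound a s 1≤s b<m) ⟩
        suc (g s + g (m ∸ s ∸ 2))                     ≤⟨ s≤s (super s _) ⟩
        suc (g (s + (m ∸ s ∸ 2)))                     ≡⟨ cong (suc ∘ g) eq ⟩
        suc (g (m ∸ 2))                               ≤⟨ big ⟩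
        length G                                      ≡⟨ count-¬ (touch? a b) G ⟨
        count (touch? a b) G + count (λ e → ¬? (touch? a b e)) G ∎)
        where
        open ≤-Reasoning
        b = suc (a + s)
        s≤ : s ≤ m ∸ 2
        s≤ = ≤-trans (≤-reflexive (sym (m+n∸m≡n 2 s))) (∸-monoˡ-≤ 2 (≤-trans (s≤s (s≤s (m≤n+m s a))) b<m))
        eq : s + (m ∸ s ∸ 2) ≡ m ∸ 2
        eq = trans (cong (s +_) (trans (∸-+-assoc m s 2) (trans (cong (m ∸_) (+-comm s 2)) (sym (∸-+-assoc m 2 s))))) (m+[n∸m]≡n s≤)

      -- If all chords crossing some chord f that leaves the chord (a , b) touch
      -- (a , b), then the remaining chords split at the outer end of f.
      module Saturated (gap : ∀ t x y → g t + 2 + g x + g y ≤ g (suc (t + x + y))) where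

        private
          split : ∀ {T W U E : Chord → Set} (T? : ∀ e → Dec (T e)) (W? : ∀ e → Dec (W e)) (U? : ∀ e → Dec (U e)) (E? : ∀ e → Dec (E e)) →
                  (∀ {e} → e ∈ G → T e ⊎ W e ⊎ U e ⊎ E e) →
                  length G ≤ count T? G + (count W? G + (count U? G + count E? G))
          split T? W? U? E? cover = begin
            length G                     ≡⟨ *-identityʳ _ ⟨
            length G * 1                 ≡⟨ ∑-const 1 G ⟨
            ∑ (λ _ → 1) G                ≤⟨ ∑-mono G (λ {e} e∈ → one e (cover e∈)) ⟩
            ∑ (λ e → ind (T? e) + (ind (W? e) + (ind (U? e) + ind (E? e)))) G
              ≡⟨ ∑-+ (λ e → ind (T? e)) _ G ⟩
            count T? G + ∑ (λ e → ind (W? e) + (ind (U? e) + ind (E? e))) G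
              ≡⟨ cong (count T? G +_) (∑-+ (λ e → ind (W? e)) _ G) ⟩
            count T? G + (count W? G + ∑ (λ e → ind (U? e) + ind (E? e)) G)
              ≡⟨ cong (λ z → count T? G + (count W? G + z)) (∑-+ (λ e → ind (U? e)) _ G) ⟩
            count T? G + (count W? G + (count U? G + count E? G)) ∎
            where
            open ≤-Reasoning
            one : ∀ e → _ → 1 ≤ ind (T? e) + (ind (W? e) + (ind (U? e) + ind (E? e)))
            one e (inj₁ t) = ≤-trans (≤-reflexive (sym (ind-1 (T? e) t))) (m≤m+n _ _)
            one e (inj₂ (inj₁ w)) = ≤-trans (≤-trans (≤-reflexive (sym (ind-1 (W? e) w))) (m≤m+n _ _)) (m≤n+m _ (ind (T? e)))
            one e (inj₂ (inj₂ (inj₁ u))) = ≤-trans (≤-trans (≤-trans (≤-reflexive (sym (ind-1 (U? e) u))) (m≤m+n _ _)) (m≤n+m _ (ind (W? e)))) (m≤n+m _ (ind (T? e)))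
            one e (inj₂ (inj₂ (inj₂ q))) = ≤-trans (≤-trans (≤-trans (≤-reflexive (sym (ind-1 (E? e) q))) (m≤n+m _ (ind (U? e)))) (m≤n+m _ (ind (W? e)))) (m≤n+m _ (ind (T? e)))

          arith : ∀ t x s N → s ≡ t + suc x → s + 2 ≤ m → g (m ∸ 2) < N + (g x + (g (m ∸ s ∸ 2) + 1)) → 2 + g t ≤ N
          arith t x s N refl s≤ lt = +-cancelʳ-≤ (g x + (g y + 1)) _ _ (begin
            2 + g t + (g x + (g y + 1))      ≡⟨ shuffle (g t) (g x) (g y) ⟩
            suc (g t + 2 + g x + g y)        ≤⟨ s≤s (gap t x y) ⟩
            suc (g (suc (t + x + y)))        ≡⟨ cong (suc ∘ g) eq ⟩
            suc (g (m ∸ 2))                  ≤⟨ lt ⟩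
            N + (g x + (g y + 1))            ∎)
            where
            open ≤-Reasoning
            y = m ∸ (t + suc x) ∸ 2
            shuffle : ∀ p q r → 2 + p + (q + (r + 1)) ≡ suc (p + 2 + q + r)
            shuffle p q r = begin-equality
              2 + p + (q + (r + 1))   ≡⟨ cong (λ z → z + (q + (r + 1))) (+-comm 2 p) ⟩
              p + 2 + (q + (r + 1))   ≡⟨ +-assoc (p + 2) q (r + 1) ⟨
              p + 2 + q + (r + 1)     ≡⟨ +-assoc (p + 2 + q) r 1 ⟨
              p + 2 + q + r + 1       ≡⟨ +-comm _ 1 ⟩
              suc (p + 2 + q + r)     ∎
            eq : suc (t + x + y) ≡ m ∸ 2
            eq = begin-equality
              suc (t + x) + y                  ≡⟨ cong (_+ y) (+-suc t x) ⟨
              t + suc x + (m ∸ (t + suc x) ∸ 2)  ≡⟨ cong (t + suc x +_) (trans (∸-+-assoc m (t + suc x) 2) (trans (cong (m ∸_) (+-comm (t + suc x) 2)) (sym (∸-+-assoc m 2 (t + suc x))))) ⟩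
              t + suc x + (m ∸ 2 ∸ (t + suc x))  ≡⟨ m+[n∸m]≡n (subst (_≤ m ∸ 2) (m+n∸n≡m (t + suc x) 2) (∸-monoˡ-≤ 2 s≤)) ⟩
              m ∸ 2                            ∎

        -- A chord that neither touches `(a , b)` nor crosses `(i , w)` lies between `b` and `w`, or
        -- survives the deletion of all vertices between `a` and `w`, or is `(a , w)`. With `x`
        -- vertices between `b` and `w`, and `y` vertices left inside after the deletion, this gives
        -- at most `g x + g y + 1` chords. Since `g t + 2 + g x + g y` is at most `g (m - 2)`, the
        -- touching chords supply the missing `2 + g t`.
        saturatedʳ : ∀ {a t i w} → 1 ≤ t → Inside a (suc (a + t)) i → suc (a + t) < w → w < m →
                     (∀ {f} → f ∈ G → Cross (i , w) f → Touch a (suc (a + t)) f) →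
                     2 + g t ≤ count (touch? a (suc (a + t))) G
        saturatedʳ {a} {t} {i} {w} 1≤t (a<i , i<b) b<w w<m cross⇒touch
          with x , w≡ ← m≤n⇒∃[o]m+o≡n b<w = arith t x (t + suc x) _ refl
            (≤-trans (≤-reflexive (+-comm (t + suc x) 2)) (≤-trans (s≤s (s≤s (m≤n+m _ a))) (≤-trans (≤-reflexive (cong suc w≡′)) w<m)))
            (≤-trans big (≤-trans (split (touch? a b) (within? b w) (λ e → ¬? (touch? a w e)) (_≟ᶜ (a , w)) cover)
              (+-monoʳ-≤ (count (touch? a b) G) (+-mono-≤ wb (+-mono-≤ ub (count-≡≤1 (a , w)))))))
          where
          b = suc (a + t)
          w≡′ : suc (a + (t + suc x)) ≡ w
          w≡′ = trans (cong suc (trans (sym (+-assoc a t (suc x))) (+-suc (a + t) x))) w≡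
          wb : count (within? b w) G ≤ g x
          wb = subst (λ z → count (within? b z) G ≤ g x) (trans (+-suc b x) w≡)
                 (within-bound b x (≤-<-trans (≤-trans (s≤s (s≤s (m≤n+m x (a + t)))) (≤-reflexive w≡)) w<m))
          ub : count (λ e → ¬? (touch? a w e)) G ≤ g (m ∸ (t + suc x) ∸ 2)
          ub = subst (λ z → count (λ e → ¬? (touch? a z e)) G ≤ g (m ∸ (t + suc x) ∸ 2)) w≡′
                 (untouched-bound a (t + suc x) (≤-trans 1≤t (m≤m+n t _)) (subst (_< m) (sym w≡′) w<m))
          cover : ∀ {e} → e ∈ G → Touch a b e ⊎ Within b w e ⊎ ¬ Touch a w e ⊎ e ≡ (a , w)
          cover {p , q} e∈ with touch? a b (p , q)
          ... | yes t = inj₁ t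
          ... | no ¬t with outside p (¬t ∘ inj₁) | outside q (¬t ∘ inj₂ ∘ inj₁)
          ... | inj₂ b≤p | inj₁ q≤a = contradiction (≤-trans b≤p (≤-trans (≤-trans (m≤n+m p 2) (proj₁ (spans e∈))) q≤a)) (<⇒≱ (s≤s (m≤m+n a t)))
          ... | inj₁ p≤a | inj₁ q≤a = inj₂ (inj₂ (inj₁ λ where
                  (inj₁ (a<p , _)) → <⇒≱ a<p p≤a
                  (inj₂ (inj₁ (a<q , _))) → <⇒≱ a<q q≤a
                  (inj₂ (inj₂ refl)) → <⇒≱ (<-trans (<-trans a<i i<b) b<w) q≤a))
          ... | inj₁ p≤a | inj₂ b≤q with <-cmp q w
          ...   | tri< q<w _ _ = contradiction (cross⇒touch e∈ (inj₂ (≤-<-trans p≤a a<i , <-≤-trans i<b b≤q , q<w))) ¬t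
          ...   | tri> _ _ w<q = inj₂ (inj₂ (inj₁ λ where
                    (inj₁ (a<p , _)) → <⇒≱ a<p p≤a
                    (inj₂ (inj₁ (_ , q<w))) → <-asym q<w w<q
                    (inj₂ (inj₂ refl)) → <-irrefl refl w<q))
          ...   | tri≈ _ refl _ with p ≟ a
          ...     | yes refl = inj₂ (inj₂ (inj₂ refl))
          ...     | no  p≢a  = inj₂ (inj₂ (inj₁ λ where
                    (inj₁ (a<p , _)) → <⇒≱ a<p p≤a
                    (inj₂ (inj₁ (_ , q<w))) → <-irrefl refl q<w
                    (inj₂ (inj₂ refl)) → p≢a refl))
          cover {p , q} e∈ | no ¬t | inj₂ b≤p | inj₂ b≤q with q ≤? w
          ... | yes q≤w = inj₂ (inj₁ (b≤p , q≤w))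
          ... | no  q≰w with p <? w
          ...   | yes p<w = contradiction (cross⇒touch e∈ (inj₁ (<-≤-trans i<b b≤p , p<w , ≰⇒> q≰w))) ¬t
          ...   | no  p≮w = inj₂ (inj₂ (inj₁ λ where
                    (inj₁ (_ , p<w)) → p≮w p<w
                    (inj₂ (inj₁ (_ , q<w))) → q≰w (<⇒≤ q<w)
                    (inj₂ (inj₂ refl)) → q≰w ≤-refl))

        -- The mirror image: the remaining chords split at `w` to the left of `a`, and the larger
        -- interval runs from `w` to `b`.
        saturatedˡ : ∀ {a t i w} → 1 ≤ t → Inside a (suc (a + t)) i → w < a → suc (a + t) < m →
                     (∀ {f} → f ∈ G → Cross (w , i) f → Touch a (suc (a + t)) f) →
                     2 + g t ≤ count (touch? a (suc (a + t))) G
        saturatedˡ {a} {t} {i} {w} 1≤t (a<i , i<b) w<a b<m cross⇒touch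
          with x , a≡ ← m≤n⇒∃[o]m+o≡n w<a = arith t x (t + suc x) _ refl
            (≤-trans (≤-reflexive (+-comm (t + suc x) 2)) (≤-trans (s≤s (s≤s (m≤n+m _ w))) (≤-trans (≤-reflexive (cong suc b≡)) b<m)))
            (≤-trans big (≤-trans (split (touch? a b) (within? w a) (λ e → ¬? (touch? w b e)) (_≟ᶜ (w , b)) cover)
              (+-monoʳ-≤ (count (touch? a b) G) (+-mono-≤ wb (+-mono-≤ ub (count-≡≤1 (w , b)))))))
          where
          b = suc (a + t)
          a≡′ : w + suc x ≡ a
          a≡′ = trans (+-suc w x) a≡
          b≡ : suc (w + (t + suc x)) ≡ b
          b≡ = cong suc (trans (cong (w +_) (+-comm t (suc x))) (trans (sym (+-assoc w (suc x) t)) (cong (_+ t) a≡′)))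
          wb : count (within? w a) G ≤ g x
          wb = subst (λ z → count (within? w z) G ≤ g x) a≡′
                 (within-bound w x (≤-<-trans (s≤s (≤-trans (m≤n+m (suc x) w) (≤-trans (≤-reflexive a≡′) (m≤m+n a t)))) b<m))
          ub : count (λ e → ¬? (touch? w b e)) G ≤ g (m ∸ (t + suc x) ∸ 2)
          ub = subst (λ z → count (λ e → ¬? (touch? w z e)) G ≤ g (m ∸ (t + suc x) ∸ 2)) b≡
                 (untouched-bound w (t + suc x) (≤-trans 1≤t (m≤m+n t _)) (subst (_< m) (sym b≡) b<m))
          cover : ∀ {e} → e ∈ G → Touch a b e ⊎ Within w a e ⊎ ¬ Touch w b e ⊎ e ≡ (w , b)
          cover {p , q} e∈ with touch? a b (p , q)
          ... | yes t = inj₁ t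
          ... | no ¬t with outside p (¬t ∘ inj₁) | outside q (¬t ∘ inj₂ ∘ inj₁)
          ... | inj₂ b≤p | inj₁ q≤a = contradiction (≤-trans b≤p (≤-trans (≤-trans (m≤n+m p 2) (proj₁ (spans e∈))) q≤a)) (<⇒≱ (s≤s (m≤m+n a t)))
          ... | inj₂ b≤p | inj₂ b≤q = inj₂ (inj₂ (inj₁ λ where
                  (inj₁ (_ , p<b)) → <⇒≱ p<b b≤p
                  (inj₂ (inj₁ (_ , q<b))) → <⇒≱ q<b b≤q
                  (inj₂ (inj₂ refl)) → <⇒≱ (<-trans w<a (<-trans a<i i<b)) b≤p))
          ... | inj₁ p≤a | inj₂ b≤q with <-cmp p w
          ...   | tri> _ _ w<p = contradiction (cross⇒touch e∈ (inj₁ (w<p , ≤-<-trans p≤a a<i , <-≤-trans i<b b≤q))) ¬t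
          ...   | tri< p<w _ _ = inj₂ (inj₂ (inj₁ λ where
                    (inj₁ (w<p , _)) → <-asym p<w w<p
                    (inj₂ (inj₁ (_ , q<b))) → <⇒≱ q<b b≤q
                    (inj₂ (inj₂ refl)) → <-irrefl refl p<w))
          ...   | tri≈ _ refl _ with q ≟ b
          ...     | yes refl = inj₂ (inj₂ (inj₂ refl))
          ...     | no  q≢b  = inj₂ (inj₂ (inj₁ λ where
                    (inj₁ (w<p , _)) → <-irrefl refl w<p
                    (inj₂ (inj₁ (_ , q<b))) → <⇒≱ q<b b≤q
                    (inj₂ (inj₂ refl)) → q≢b refl))
          cover {p , q} e∈ | no ¬t | inj₁ p≤a | inj₁ q≤a with w ≤? p
          ... | yes w≤p = inj₂ (inj₁ (w≤p , q≤a))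
          ... | no  w≰p with w <? q
          ...   | yes w<q = contradiction (cross⇒touch e∈ (inj₂ (≰⇒> w≰p , w<q , ≤-<-trans q≤a a<i))) ¬t
          ...   | no  w≮q = inj₂ (inj₂ (inj₁ λ where
                    (inj₁ (w<p , _)) → w≰p (<⇒≤ w<p)
                    (inj₂ (inj₁ (w<q , _))) → w≮q w<q
                    (inj₂ (inj₂ refl)) → w≰p ≤-refl))

  -- Refuting systems of linear inequalities by backtracking

  -- A cost table for each variable that matters, after the given number of
  -- variables that do not.
  data Row : Set where
    end : Row
    nxt : ℕ → List ℕ → Row → Row

  at : List ℕ → ℕ → ℕ
  at []       _       = 0
  at (x ∷ xs) zero    = x
  at (x ∷ xs) (suc n) = at xs n

  data Item : Set where
    item : ℕ → List ℕ → Row → Item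

  -- The items in the i-th list concern the i-th of the remaining variables: their
  -- remaining budget, their costs for that variable and for the later ones.
  State : Set
  State = List (List Item)

  insert : ℕ → Item → State → State
  insert zero    x []       = (x ∷ []) ∷ []
  insert zero    x (b ∷ bs) = (x ∷ b) ∷ bs
  insert (suc n) x []       = [] ∷ insert n x []
  insert (suc n) x (b ∷ bs) = b ∷ insert n x bs

  put : ℕ → Row → State → State
  put k end          s = s
  put k (nxt g xs r) s = insert g (item k xs r) s

  affordable : ℕ → List Item → Bool
  affordable v []                = true
  affordable v (item k xs r ∷ b) = if k <ᵇ at xs v then false else affordable v b

  advance : ℕ → List Item → State → State
  advance v []                s = s
  advance v (item k xs r ∷ b) s = advance v b (put (k ∸ at xs v) r s)

  mutual
    -- The value `true` means that no contradiction was found, so running out of variables or of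
    -- pending items counts as success. Refutation rests on `false` alone.
    search : List ℕ → State → Bool
    search []       s       = true
    search (d ∷ ds) []      = true
    search (d ∷ ds) (b ∷ s) = branch d b ds s

    branch : ℕ → List Item → List ℕ → State → Bool
    branch zero    b ds s = if affordable 0 b then search ds (advance 0 b s) else false
    branch (suc v) b ds s =
      if affordable (suc v) b
      then (if search ds (advance (suc v) b s) then true else branch v b ds s)
      else branch v b ds s

  rowCost : Row → List ℕ → ℕ
  rowCost end                _        = 0
  rowCost (nxt _ _ _)        []       = 0
  rowCost (nxt zero xs r)    (v ∷ vs) = at xs v + rowCost r vs
  rowCost (nxt (suc g) xs r) (v ∷ vs) = rowCost (nxt g xs r) vs

  Paid : List ℕ → ℕ → Item → Set
  Paid vs v (item k xs r) = at xs v + rowCost r vs ≤ k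

  Good : State → List ℕ → Set
  Good []      _        = ⊤
  Good (b ∷ s) []       = ⊤
  Good (b ∷ s) (v ∷ vs) = All (Paid vs v) b × Good s vs

  insert-good : ∀ g {k xs r} s vs → rowCost (nxt g xs r) vs ≤ k → Good s vs → Good (insert g (item k xs r) s) vs
  insert-good zero    []      []       p q       = _
  insert-good zero    []      (v ∷ vs) p q       = p ∷ [] , _
  insert-good zero    (b ∷ s) []       p q       = _
  insert-good zero    (b ∷ s) (v ∷ vs) p (q , r) = p ∷ q , r
  insert-good (suc g) []      []       p q       = _
  insert-good (suc g) []      (v ∷ vs) p q       = [] , insert-good g [] vs p _
  insert-good (suc g) (b ∷ s) []       p q       = _
  insert-good (suc g) (b ∷ s) (v ∷ vs) p (q , r) = q , insert-good g s vs p r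

  put-good : ∀ k r s vs → rowCost r vs ≤ k → Good s vs → Good (put k r s) vs
  put-good k end          s vs p q = q
  put-good k (nxt g xs r) s vs p q = insert-good g s vs p q

  advance-good : ∀ v b s vs → All (Paid vs v) b → Good s vs → Good (advance v b s) vs
  advance-good v []                s vs []       q = q
  advance-good v (item k xs r ∷ b) s vs (p ∷ ps) q = advance-good v b _ vs ps (put-good _ r s vs
    (subst (_≤ k ∸ at xs v) (m+n∸m≡n (at xs v) _) (∸-monoˡ-≤ (at xs v) p)) q)

  affordable-good : ∀ v b vs → All (Paid vs v) b → affordable v b ≡ true
  affordable-good v []                vs []       = refl
  affordable-good v (item k xs r ∷ b) vs (p ∷ ps) with k <ᵇ at xs v in eq
  ... | false = affordable-good v b vs ps
  ... | true  = contradiction (≤-trans (m≤m+n (at xs v) (rowCost r vs)) p) (<⇒≱ (<ᵇ⇒< k (at xs v) (Equivalence.from T-≡ eq)))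

  mutual
    -- Follow the given solution down the search tree: each of its values is affordable, and
    -- charging it leaves budgets that the remaining values still respect.
    search-sound : ∀ ds s vs → Pointwise _≤_ vs ds → Good s vs → search ds s ≡ true
    search-sound []       s       vs       _        _       = refl
    search-sound (d ∷ ds) []      vs       _        _       = refl
    search-sound (d ∷ ds) (b ∷ s) (v ∷ vs) (p ∷ ps) (q , r) = branch-sound d v p b ds s vs ps q r

    branch-sound : ∀ d v → v ≤ d → ∀ b ds s vs → Pointwise _≤_ vs ds → All (Paid vs v) b → Good s vs → branch d b ds s ≡ true
    branch-sound zero zero _ b ds s vs ps q r
      rewrite affordable-good 0 b vs q = search-sound ds _ vs ps (advance-good 0 b s vs q r)
    branch-sound (suc d) v v≤ b ds s vs ps q r with v ≟ suc d
    ... | yes refl rewrite affordable-good (suc d) b vs q | search-sound ds _ vs ps (advance-good (suc d) b s vs q r) = refl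
    ... | no v≢ with affordable (suc d) b | search ds (advance (suc d) b s)
    ...   | false | _     = branch-sound d v (≤-pred (≤∧≢⇒< v≤ v≢)) b ds s vs ps q r
    ...   | true  | true  = refl
    ...   | true  | false = branch-sound d v (≤-pred (≤∧≢⇒< v≤ v≢)) b ds s vs ps q r

  -- A cost is a function of the value instead of a coefficient. Terms such as `dom x ∸ v`, or a
  -- charge for any nonzero value, thus stay within natural numbers, and lower bounds become budgets
  -- for what is missing.
  record Constraint (X : Set) : Set where
    constructor constraint
    field
      cost : X → ℕ → ℕ
      need : ℕ
      budget : ℕ

  open Constraint public

  module Search {X : Set} (dom : X → ℕ) (order : List X) where

    Satisfied : (X → ℕ) → Constraint X → Set
    Satisfied val c = ∑ (λ x → cost c x (val x)) order + need c ≤ budget c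

    zeros : List ℕ → Bool
    zeros []           = true
    zeros (zero ∷ xs)  = zeros xs
    zeros (suc _ ∷ xs) = false

    skip : Row → Row
    skip end          = end
    skip (nxt n xs r) = nxt (suc n) xs r

    prepend : List ℕ → Row → Row
    prepend xs r = if zeros xs then skip r else nxt 0 xs r

    row : (X → ℕ → ℕ) → List X → Row
    row f []       = end
    row f (x ∷ xs) = prepend (applyUpTo (f x) (suc (dom x))) (row f xs)

    largest : List ℕ → ℕ
    largest []       = 0
    largest (x ∷ xs) = x ⊔ largest xs

    rowMax : Row → ℕ
    rowMax end          = 0
    rowMax (nxt _ xs r) = largest xs + rowMax r

    -- A row whose largest possible cost fits its budget can never cut a branch.
    add : ℕ → Row → State → State
    add k r s = if k <ᵇ rowMax r then put k r s else s

    start : List (Constraint X) → State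
    start []       = []
    start (c ∷ cs) = add (budget c ∸ need c) (row (cost c) order) (start cs)

    -- In `start` the difference `budget c ∸ need c` is truncated at zero, which would hide a need
    -- that exceeds the budget on its own.
    infeasible : List (Constraint X) → Bool
    infeasible []       = false
    infeasible (c ∷ cs) = if budget c <ᵇ need c then true else infeasible cs

    refute : List (Constraint X) → Bool
    refute cs = if infeasible cs then true else not (search (map dom order) (start cs))

    module _ {val : X → ℕ} where

      at-table : ∀ (f : ℕ → ℕ) {n v} → v < n → at (applyUpTo f n) v ≡ f v
      at-table f {suc n} {zero}  _         = refl
      at-table f {suc n} {suc v} (s≤s v<n) = at-table (f ∘ suc) v<n

      zeros-at : ∀ xs v → zeros xs ≡ true → at xs v ≡ 0
      zeros-at []          v       _ = refl
      zeros-at (zero ∷ xs) zero    _ = refl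
      zeros-at (zero ∷ xs) (suc v) e = zeros-at xs v e

      rowCost-skip : ∀ r v vs → rowCost (skip r) (v ∷ vs) ≡ rowCost r vs
      rowCost-skip end          v vs = refl
      rowCost-skip (nxt _ _ _)  v vs = refl

      rowCost-row : ∀ f xs → (∀ {x} → x ∈ xs → val x ≤ dom x) →
                    rowCost (row f xs) (map val xs) ≡ ∑ (λ x → f x (val x)) xs
      rowCost-row f []       _ = refl
      rowCost-row f (x ∷ xs) h with zeros (applyUpTo (f x) (suc (dom x))) in eq
      ... | true  = trans (rowCost-skip (row f xs) (val x) (map val xs)) (trans (rowCost-row f xs (h ∘ there))
        (cong (_+ ∑ (λ x → f x (val x)) xs) (sym (trans (sym (at-table (f x) (s≤s (h (here refl))))) (zeros-at (applyUpTo (f x) (suc (dom x))) (val x) eq)))))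
      ... | false = cong₂ _+_ (at-table (f x) (s≤s (h (here refl)))) (rowCost-row f xs (h ∘ there))

      module _ (h : ∀ {x} → x ∈ order → val x ≤ dom x) where

        start-good : ∀ cs → All (Satisfied val) cs → Good (start cs) (map val order)
        start-good []       []       = _
        start-good (c ∷ cs) (p ∷ ps) with (budget c ∸ need c) <ᵇ rowMax (row (cost c) order)
        ... | false = start-good cs ps
        ... | true  = put-good _ (row (cost c) order) (start cs) _
          (subst (_≤ budget c ∸ need c) (trans (m+n∸n≡m _ (need c)) (sym (rowCost-row (cost c) order h))) (∸-monoˡ-≤ (need c) p))
          (start-good cs ps)

        feasible : ∀ cs → All (Satisfied val) cs → infeasible cs ≡ false
        feasible []       []       = refl
        feasible (c ∷ cs) (p ∷ ps) with budget c <ᵇ need c in eq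
        ... | false = feasible cs ps
        ... | true  = contradiction (≤-trans (m≤n+m (need c) _) p) (<⇒≱ (<ᵇ⇒< (budget c) (need c) (Equivalence.from T-≡ eq)))

        fits : ∀ xs → (∀ {x} → x ∈ xs → val x ≤ dom x) → Pointwise _≤_ (map val xs) (map dom xs)
        fits []       _ = []
        fits (x ∷ xs) h = h (here refl) ∷ fits xs (h ∘ there)

        refute-sound : ∀ cs → refute cs ≡ true → ¬ All (Satisfied val) cs
        refute-sound cs eq sat rewrite feasible cs sat
          | search-sound (map dom order) (start cs) (map val order) (fits order h) (start-good cs sat) =
          contradiction eq λ ()

  -- Chords of an interval as variables

  data Var : Set where
    edge : Chord → Var
    leaf : ℕ → Var

  edge-injective : ∀ {e f} → edge e ≡ edge f → e ≡ f
  edge-injective refl = refl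

  leaf-injective : ∀ {i j} → leaf i ≡ leaf j → i ≡ j
  leaf-injective refl = refl

  _≟ᵛ_ : (x y : Var) → Dec (x ≡ y)
  edge e ≟ᵛ edge f = map′ (cong edge) edge-injective (e ≟ᶜ f)
  leaf i ≟ᵛ leaf j = map′ (cong leaf) leaf-injective (i ≟ j)
  edge _ ≟ᵛ leaf _ = no λ ()
  leaf _ ≟ᵛ edge _ = no λ ()

  Weight : Set
  Weight = Var → ℕ

  -- A chord leaving the interval at `i` crosses `(a , b)` exactly when `i` lies strictly between
  -- `a` and `b`, on whichever side its other end lies. Hence leaving chords may be pooled by their
  -- inner vertex.
  crossW : Chord → Weight
  crossW e       (edge f) = ind (cross? e f)
  crossW (a , b) (leaf i) = ind (inside? a b i)

  -- The chords passing over vertex `i` are those that every chord leaving at `i` has to cross.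
  straddleW : ℕ → Weight
  straddleW i (edge (a , b)) = ind (inside? a b i)
  straddleW i (leaf _)       = 0

  touchW : ℕ → ℕ → Weight
  touchW a b (edge e) = ind (touch? a b e)
  touchW a b (leaf i) = ind (inside? a b i)

  allW edgesW leavesW : Weight
  allW    _        = 1
  edgesW  (edge _) = 1
  edgesW  (leaf _) = 0
  leavesW (edge _) = 0
  leavesW (leaf _) = 1

  leftW : ℕ → Weight
  leftW v (edge (a , _)) = ind (a ≤? v)
  leftW v (leaf _)       = 0

  -- Chords inside an interval with t inner vertices, labelled 0, …, t+1, that span
  -- at most T sides; a leaf stands for the number of chords from a vertex of the
  -- interval to the outside.

  module Model (ℓ T t : ℕ) where

    -- The pair `(0 , suc t)` is the long chord above the interval. It is known to be present and
    -- therefore is no variable, which accounts for the shifts by one below.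
    Short : Chord → Set
    Short (i , j) = 2 + i ≤ j × j ≤ T + i × (i , j) ≢ (0 , suc t)

    short? : ∀ e → Dec (Short e)
    short? (i , j) = (2 + i ≤? j) ×-dec (j ≤? T + i) ×-dec ¬? ((i , j) ≟ᶜ (0 , suc t))

    chords : List Chord
    chords = filter short? (cartesianProduct (upTo (2 + t)) (upTo (2 + t)))

    inner : List ℕ
    inner = map suc (upTo t)

    -- Chords come in lexicographic order, so a condition on the chords starting at the first few
    -- vertices is settled early in the search. Leaves are chosen last.
    order : List Var
    order = map edge chords ++ map leaf inner

    chords-unique : Unique chords
    chords-unique = Unique.filter⁺ short? (Unique.cartesianProduct⁺ (Unique.upTo⁺ (2 + t)) (Unique.upTo⁺ (2 + t)))

    inner-unique : Unique inner
    inner-unique = Unique.map⁺ suc-injective (Unique.upTo⁺ t)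

    order-unique : Unique order
    order-unique = Unique.++⁺ (Unique.map⁺ edge-injective chords-unique) (Unique.map⁺ leaf-injective inner-unique)
      λ (p , q) → case ∈-map⁻ edge p of λ where (_ , _ , refl) → case ∈-map⁻ leaf q of λ where (_ , _ , ())

    ∈-chords : ∀ {i j} → j ≤ suc t → Short (i , j) → (i , j) ∈ chords
    ∈-chords {i} {j} j≤ sh@(2+i≤j , _) = ∈-filter⁺ short?
      (∈-cartesianProduct⁺ (∈-upTo⁺ (s≤s (≤-trans (≤-trans (m≤n+m i 2) 2+i≤j) j≤))) (∈-upTo⁺ (s≤s j≤))) sh

    ∈-inner : ∀ {i} → Inside 0 (suc t) i → i ∈ inner
    ∈-inner {suc i} (_ , s≤s i<t) = ∈-map⁺ suc (∈-upTo⁺ i<t)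

    dom : Var → ℕ
    dom (edge _) = 1
    dom (leaf _) = ℓ

    open Search dom order public

    weightE : Weight → ℕ
    weightE w = ∑ (w ∘ edge) chords

    total : (Var → ℕ) → Weight → ℕ
    total val w = ∑ (λ x → w x * val x) order

    data Spec : Set where
      cap        : Chord → Spec
      leafCap    : ℕ → Spec
      leaves     : Spec
      atLeast    : ℕ → Weight → Spec
      saturation : ℕ → ℕ → Spec
      implies    : Chord → Chord → Spec
      absent     : Chord → Spec

    bonus : Var → ℕ → Var → ℕ → ℕ
    bonus y c x zero    = 0
    bonus y c x (suc _) = if does (x ≟ᵛ y) then c else 0

    -- A condition "if y occurs, then the weight is at most k" becomes linear when
    -- the occurrence of y costs M - k, for an a-priori bound M of the weight.
    guarded : Var → ℕ → ℕ → Weight → Constraint Var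
    guarded y k M w = constraint (λ x v → w x * v + bonus y (M ∸ k) x v) 0 M

    interpret : Spec → Constraint Var
    -- The a-priori bound takes all crossing chords as present and adds `ℓ` for the leaves, whose
    -- total is at most `ℓ`.
    interpret (cap e)          = guarded (edge e) ℓ (weightE (crossW e) + ℓ) (crossW e)
    interpret (leafCap i)      = guarded (leaf i) (ℓ ∸ 1) (weightE (straddleW i)) (straddleW i)
    interpret leaves           = constraint (λ x v → leavesW x * v) 0 ℓ
    -- The weight still missing from the maximum is charged, so the requirement `k` reduces the
    -- available budget.
    interpret (atLeast k w)    = constraint (λ x v → w x * (dom x ∸ v)) k (∑ (λ x → w x * dom x) order)
    -- Let `S` be the straddling weight at an occupied leaf, so `S ≤ ℓ - 1`. The total is at least
    -- `k`, and at least `k + 1` if `S = ℓ - 1`. Both are contained in the linear condition that the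
    -- total is at least `k + S - (ℓ - 2)`, guarded by the occurrence of the leaf.
    interpret (saturation k i) =
      constraint (λ x v → (dom x ∸ v) + (straddleW i x * v + bonus (leaf i) (M ∸ (ℓ ∸ 2)) x v)) k (∑ dom order + M)
      where M = weightE (straddleW i)
    interpret (implies e f)    = constraint (λ x v → ind (x ≟ᵛ edge e) * v + ind (x ≟ᵛ edge f) * (1 ∸ v)) 0 1
    interpret (absent e)       = constraint (λ x v → ind (x ≟ᵛ edge e) * v) 0 0

    module Soundness (val : Var → ℕ) (edge≤1 : ∀ e → val (edge e) ≤ 1) (leaves≤ℓ : total val leavesW ≤ ℓ) where

      ⟦_⟧ : Spec → Set
      ⟦ cap e ⟧          = 1 ≤ val (edge e) → total val (crossW e) ≤ ℓ
      ⟦ leafCap i ⟧      = 1 ≤ val (leaf i) → suc (total val (straddleW i)) ≤ ℓ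
      ⟦ leaves ⟧         = total val leavesW ≤ ℓ
      ⟦ atLeast k w ⟧    = k ≤ total val w
      ⟦ saturation k i ⟧ = 2 ≤ ℓ × k ≤ total val allW ×
        (1 ≤ val (leaf i) → suc (total val (straddleW i)) ≤ ℓ) ×
        (1 ≤ val (leaf i) → ℓ ≤ suc (total val (straddleW i)) → suc k ≤ total val allW)
      ⟦ implies e f ⟧    = val (edge e) ≤ val (edge f)
      ⟦ absent e ⟧       = val (edge e) ≡ 0

      val≤dom : ∀ {x} → x ∈ order → val x ≤ dom x
      val≤dom {edge e} _ = edge≤1 e
      val≤dom {leaf i} i∈ = ≤-trans (≤-trans (≤-reflexive (sym (+-identityʳ _))) (∈⇒≤∑ (λ x → leavesW x * val x) i∈)) leaves≤ℓ

      total-order : ∀ (w : Weight) → total val w ≡ ∑ (λ e → w (edge e) * val (edge e)) chords + ∑ (λ i → w (leaf i) * val (leaf i)) inner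
      total-order w = trans (∑-++ _ (map edge chords) (map leaf inner)) (cong₂ _+_ (∑-map _ edge chords) (∑-map _ leaf inner))

      edges≤ : ∀ (w : Weight) → ∑ (λ e → w (edge e) * val (edge e)) chords ≤ weightE w
      edges≤ w = ∑-mono chords λ {e} _ → ≤-trans (*-monoʳ-≤ (w (edge e)) (edge≤1 e)) (≤-reflexive (*-identityʳ _))

      leaf-weight≤ : ∀ (w : Weight) → (∀ i → w (leaf i) ≤ 1) → ∑ (λ i → w (leaf i) * val (leaf i)) inner ≤ ℓ
      leaf-weight≤ w w≤1 = ≤-trans (∑-mono inner λ {i} _ → *-monoˡ-≤ (val (leaf i)) (w≤1 i))
        (≤-trans (≤-trans (m≤n+m _ _) (≤-reflexive (sym (total-order leavesW)))) leaves≤ℓ)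

      bonus-absent : ∀ y c → val y ≡ 0 → ∑ (λ x → bonus y c x (val x)) order ≡ 0
      bonus-absent y c e = ∑-0 order λ {x} _ → go x
        where
        go : ∀ x → bonus y c x (val x) ≡ 0
        go x with val x in eq
        ... | zero  = refl
        ... | suc _ with x ≟ᵛ y
        ...   | yes refl = contradiction (trans (sym eq) e) λ ()
        ...   | no  _    = refl

      bonus≤ : ∀ y c → ∑ (λ x → bonus y c x (val x)) order ≤ c
      bonus≤ y c = ≤-trans (∑-single order (_≟ᵛ y) order-unique off) (on (val y))
        where
        off : ∀ {x} → x ≢ y → bonus y c x (val x) ≡ 0
        off {x} x≢y with val x
        ... | zero  = refl
        ... | suc _ with x ≟ᵛ y
        ...   | yes refl = contradiction refl x≢y
        ...   | no  _    = refl
        on : ∀ v → bonus y c y v ≤ c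
        on zero    = z≤n
        on (suc _) with y ≟ᵛ y
        ... | yes _ = ≤-refl
        ... | no  _ = z≤n

      guarded-sound : ∀ y k M w → total val w ≤ M → (1 ≤ val y → total val w ≤ k) → Satisfied val (guarded y k M w)
      guarded-sound y k M w w≤M h = ≤-trans (≤-reflexive (trans (+-identityʳ _) (∑-+ (λ x → w x * val x) _ order))) (go (val y) refl)
        where
        go : ∀ n → val y ≡ n → total val w + ∑ (λ x → bonus y (M ∸ k) x (val x)) order ≤ M
        go zero e = ≤-trans (≤-reflexive (trans (cong (total val w +_) (bonus-absent y (M ∸ k) e)) (+-identityʳ _))) w≤M
        go (suc n) e with k ≤? M
        ... | yes k≤M = ≤-trans (+-mono-≤ (h (subst (1 ≤_) (sym e) (s≤s z≤n))) (bonus≤ y (M ∸ k))) (≤-reflexive (m+[n∸m]≡n k≤M))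
        -- For `k > M` the surcharge `M ∸ k` is zero and the a-priori bound alone is enough.
        ... | no  k≰M = ≤-trans (+-monoʳ-≤ _ (≤-trans (bonus≤ y (M ∸ k)) (≤-reflexive (m≤n⇒m∸n≡0 (<⇒≤ (≰⇒> k≰M)))))) (≤-trans (≤-reflexive (+-identityʳ _)) w≤M)

      complement : ∀ (w : Weight) → ∑ (λ x → w x * (dom x ∸ val x)) order + total val w ≡ ∑ (λ x → w x * dom x) order
      complement w = trans (sym (∑-+ _ _ order)) (∑-cong order λ {x} x∈ →
        trans (sym (*-distribˡ-+ (w x) (dom x ∸ val x) (val x))) (cong (w x *_) (m∸n+n≡m (val≤dom x∈))))

      straddle≤ : ∀ i → total val (straddleW i) ≤ weightE (straddleW i)
      straddle≤ i = ≤-trans (≤-reflexive (trans (total-order (straddleW i))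
        (trans (cong (∑ (λ e → straddleW i (edge e) * val (edge e)) chords +_) (∑-0 inner λ _ → refl)) (+-identityʳ _)))) (edges≤ (straddleW i))

      interpret-sound : ∀ s → ⟦ s ⟧ → Satisfied val (interpret s)
      interpret-sound (cap e@(a , b)) h = guarded-sound (edge e) ℓ _ (crossW e)
        (≤-trans (≤-reflexive (total-order (crossW e))) (+-mono-≤ (edges≤ (crossW e)) (leaf-weight≤ (crossW e) (λ i → ind≤1 (inside? a b i))))) h
      interpret-sound (leafCap i) h = guarded-sound (leaf i) (ℓ ∸ 1) _ (straddleW i) (straddle≤ i) λ 1≤ → ∸-monoˡ-≤ 1 (h 1≤)
      interpret-sound leaves h = ≤-trans (≤-reflexive (+-identityʳ _)) h
      interpret-sound (atLeast k w) h = ≤-trans (+-monoʳ-≤ _ h) (≤-reflexive (complement w))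
      interpret-sound (saturation k i) (2≤ℓ , k≤ , h , h′) = begin
        ∑ (λ x → (dom x ∸ val x) + (straddleW i x * val x + bonus (leaf i) c x (val x))) order + k
          ≡⟨ cong (_+ k) (trans (∑-+ _ _ order) (cong (P +_) (∑-+ (λ x → straddleW i x * val x) _ order))) ⟩
        P + (S + B) + k      ≡⟨ +-assoc P (S + B) k ⟩
        P + (S + B + k)      ≡⟨ cong (P +_) (+-comm (S + B) k) ⟩
        P + (k + (S + B))    ≤⟨ go (val (leaf i)) refl ⟩
        P + (A + M)          ≡⟨ +-assoc P A M ⟨
        P + A + M            ≡⟨ cong (_+ M) D ⟩
        ∑ dom order + M      ∎
        where
        open ≤-Reasoning
        M = weightE (straddleW i)
        c = M ∸ (ℓ ∸ 2)
        P = ∑ (λ x → dom x ∸ val x) order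
        S = total val (straddleW i)
        B = ∑ (λ x → bonus (leaf i) c x (val x)) order
        A = total val allW
        D : P + A ≡ ∑ dom order
        D = trans (cong (_+ A) (∑-cong order λ _ → sym (*-identityˡ _)))
              (trans (complement allW) (∑-cong order λ _ → *-identityˡ _))
        go : ∀ n → val (leaf i) ≡ n → P + (k + (S + B)) ≤ P + (A + M)
        go zero e = +-monoʳ-≤ P (+-mono-≤ k≤ (≤-trans (≤-reflexive (trans (cong (S +_) (bonus-absent (leaf i) c e)) (+-identityʳ _))) (straddle≤ i)))
        go (suc n) e with ℓ ≤? suc S
        ... | no ℓ≰ = +-monoʳ-≤ P (+-mono-≤ k≤ S+B≤M)
          where
          S≤ : S ≤ ℓ ∸ 2
          S≤ = ∸-monoˡ-≤ 2 (≰⇒> ℓ≰)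
          S+B≤M : S + B ≤ M
          S+B≤M with ℓ ∸ 2 ≤? M
          ... | yes p = ≤-trans (+-mono-≤ S≤ (bonus≤ (leaf i) c)) (≤-reflexive (m+[n∸m]≡n p))
          ... | no ¬p = ≤-trans (+-mono-≤ (straddle≤ i) (≤-trans (bonus≤ (leaf i) c) (≤-reflexive (m≤n⇒m∸n≡0 (<⇒≤ (≰⇒> ¬p)))))) (≤-reflexive (+-identityʳ M))
        ... | yes ℓ≤ = +-monoʳ-≤ P (begin
          k + (S + B)        ≤⟨ +-monoʳ-≤ k (+-mono-≤ S≤ (bonus≤ (leaf i) c)) ⟩
          k + (suc (ℓ ∸ 2) + c) ≡⟨ cong (λ z → k + suc z) (m+[n∸m]≡n ℓ∸2≤M) ⟩
          k + suc M          ≡⟨ +-suc k M ⟩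
          suc k + M          ≤⟨ +-monoˡ-≤ M (h′ 1≤ ℓ≤) ⟩
          A + M              ∎)
          where
          1≤ : 1 ≤ val (leaf i)
          1≤ = subst (1 ≤_) (sym e) (s≤s z≤n)
          S≤ : S ≤ suc (ℓ ∸ 2)
          S≤ = ≤-trans (∸-monoˡ-≤ 1 (h 1≤)) (≤-reflexive (eq 2≤ℓ))
            where
            eq : ∀ {l} → 2 ≤ l → l ∸ 1 ≡ suc (l ∸ 2)
            eq (s≤s (s≤s _)) = refl
          ℓ∸2≤M : ℓ ∸ 2 ≤ M
          ℓ∸2≤M = ≤-trans (∸-monoˡ-≤ 2 ℓ≤) (≤-trans (m∸n≤m S 1) (straddle≤ i))
      interpret-sound (implies e f) h = begin
        ∑ (λ x → ind (x ≟ᵛ edge e) * val x + ind (x ≟ᵛ edge f) * (1 ∸ val x)) order + 0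
          ≡⟨ trans (+-identityʳ _) (∑-+ _ _ order) ⟩
        ∑ (λ x → ind (x ≟ᵛ edge e) * val x) order + ∑ (λ x → ind (x ≟ᵛ edge f) * (1 ∸ val x)) order
          ≤⟨ +-mono-≤ (one e val) (one f (λ x → 1 ∸ val x)) ⟩
        val (edge e) + (1 ∸ val (edge f)) ≤⟨ +-monoˡ-≤ _ h ⟩
        val (edge f) + (1 ∸ val (edge f)) ≡⟨ m+[n∸m]≡n (edge≤1 f) ⟩
        1 ∎
        where
        open ≤-Reasoning
        one : ∀ e (u : Var → ℕ) → ∑ (λ x → ind (x ≟ᵛ edge e) * u x) order ≤ u (edge e)
        one e u = ≤-trans (∑-single order (_≟ᵛ edge e) order-unique (λ {x} x≢ → cong (_* u x) (ind-0 (x ≟ᵛ edge e) x≢)))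
          (≤-trans (*-monoˡ-≤ (u (edge e)) (ind≤1 (edge e ≟ᵛ edge e))) (≤-reflexive (*-identityˡ _)))
      interpret-sound (absent e) h = ≤-reflexive (trans (+-identityʳ _) (∑-0 order λ {x} _ → go x))
        where
        go : ∀ x → ind (x ≟ᵛ edge e) * val x ≡ 0
        go x with x ≟ᵛ edge e
        ... | yes refl = trans (+-identityʳ _) h
        ... | no  _    = refl

      refuted : ∀ ss → refute (map interpret ss) ≡ true → ¬ All ⟦_⟧ ss
      refuted ss eq hs = refute-sound {val} val≤dom (map interpret ss) eq (All.map⁺ (All.map (λ {s} → interpret-sound s) hs))

  -- Evaluating the variables on a set of chords

  ∑-one : ∀ {A : Set} {w : A → ℕ} {M : A → Set} (M? : ∀ x → Dec (M x)) {c} xs → Unique xs →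
          (∀ {x} → x ∈ xs → M x → w x ≤ c) → (∀ {x y} → x ∈ xs → y ∈ xs → M x → M y → x ≡ y) →
          ∑ (λ x → w x * ind (M? x)) xs ≤ c
  ∑-one M? []       _        _ _ = z≤n
  ∑-one {w = w} M? (x ∷ xs) (x∉ ∷ u) h unique with M? x
  ... | no  _  = ≤-trans (≤-reflexive (cong (_+ ∑ (λ x → w x * ind (M? x)) xs) (*-zeroʳ (w x))))
                   (∑-one M? xs u (h ∘ there) λ p q → unique (there p) (there q))
  ... | yes mx = ≤-trans (≤-reflexive (trans (cong₂ _+_ (*-identityʳ (w x)) (∑-0 xs λ {y} y∈ →
                   trans (cong (w y *_) (ind-0 (M? y) λ my → All.lookup x∉ y∈ (unique (here refl) (there y∈) mx my))) (*-zeroʳ (w y))))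
                   (+-identityʳ (w x)))) (h (here refl) mx)

  module Values (A ℓ T t : ℕ) {Leaf : ℕ → Chord → Set} (leaf? : ∀ i f → Dec (Leaf i f)) (G : List Chord)
                (G-unique : Unique G) where
    open Model ℓ T t

    shift : Chord → Chord
    shift (i , j) = A + i , A + j

    shift-injective : ∀ {e f} → shift e ≡ shift f → e ≡ f
    shift-injective {i , j} {x , y} eq = cong₂ _,_ (+-cancelˡ-≡ A i x (cong proj₁ eq)) (+-cancelˡ-≡ A j y (cong proj₂ eq))

    Match : Var → Chord → Set
    Match (edge e) f = f ≡ shift e
    Match (leaf i) f = Leaf i f

    match? : ∀ x f → Dec (Match x f)
    match? (edge e) f = f ≟ᶜ shift e
    match? (leaf i) f = leaf? i f

    val : Var → ℕ
    val x = count (match? x) G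

    local : Weight → Chord → ℕ
    local w f = ∑ (λ x → w x * ind (match? x f)) order

    edge≤1 : ∀ e → val (edge e) ≤ 1
    edge≤1 e = ≤-trans (∑-single G (_≟ᶜ shift e) G-unique (λ {x} → ind-0 (x ≟ᶜ shift e))) (ind≤1 (shift e ≟ᶜ shift e))

    edge-∈ : ∀ e → 1 ≤ val (edge e) → shift e ∈ G
    edge-∈ e 1≤ = case count-1≤ (match? (edge e)) G 1≤ of λ where (_ , f∈ , refl) → f∈

    -- Double counting of the pairs of a variable and a chord matching it. Inequalities between
    -- totals can then be checked one chord at a time.
    total-local : ∀ w → total val w ≡ ∑ (local w) G
    total-local w = trans (∑-cong order λ {x} _ → sym (∑-*ˡ (w x) _ G)) (∑-swap (λ x f → w x * ind (match? x f)) order G)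

    Separate : Set
    Separate = ∀ {x y f} → x ∈ order → y ∈ order → Match x f → Match y f → x ≡ y

    local≤ : Separate → ∀ {w f c} → (∀ x → x ∈ order → Match x f → w x ≤ c) → local w f ≤ c
    local≤ sep {w} {f} h = ∑-one {w = w} (λ x → match? x f) order order-unique (λ {x} → h x) sep

    ≤local : ∀ {w f x} → x ∈ order → Match x f → w x ≤ local w f
    ≤local {w} {f} {x} x∈ m = ≤-trans (≤-reflexive (sym (trans (cong (w x *_) (ind-1 (match? x f) m)) (*-identityʳ (w x)))))
      (∈⇒≤∑ (λ x → w x * ind (match? x f)) x∈)

    edge-∈-order : ∀ {e} → e ∈ chords → edge e ∈ order
    edge-∈-order e∈ = ∈-++⁺ˡ (∈-map⁺ edge e∈)

    leaf-∈-order : ∀ {i} → i ∈ inner → leaf i ∈ order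
    leaf-∈-order i∈ = ∈-++⁺ʳ (map edge chords) (∈-map⁺ leaf i∈)

    order-edge : ∀ {e} → edge e ∈ order → e ∈ chords
    order-edge e∈ with ∈-++⁻ (map edge chords) e∈
    ... | inj₁ p = case ∈-map⁻ edge p of λ where (_ , q , refl) → q
    ... | inj₂ p = case ∈-map⁻ leaf p of λ where (_ , _ , ())

    order-leaf : ∀ {i} → leaf i ∈ order → Inside 0 (suc t) i
    order-leaf i∈ with ∈-++⁻ (map edge chords) i∈
    ... | inj₁ p = case ∈-map⁻ edge p of λ where (_ , _ , ())
    ... | inj₂ p = case ∈-map⁻ leaf p of λ where
      (_ , q , refl) → case ∈-map⁻ suc q of λ where (_ , r , refl) → s≤s z≤n , s≤s (∈-upTo⁻ r)

    chord-bounds : ∀ {i j} → (i , j) ∈ chords → 2 + i ≤ j × j ≤ suc t × (i , j) ≢ (0 , suc t)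
    chord-bounds e∈ with p , sp , _ , ne ← ∈-filter⁻ short? e∈ =
      sp , ≤-pred (∈-upTo⁻ (proj₂ (∈-cartesianProduct⁻ (upTo (2 + t)) (upTo (2 + t)) p))) , ne

    shift-cross : ∀ {e f} → Cross e f → Cross (shift e) (shift f)
    shift-cross (inj₁ (p , q , r)) = inj₁ (+-monoʳ-< A p , +-monoʳ-< A q , +-monoʳ-< A r)
    shift-cross (inj₂ (p , q , r)) = inj₂ (+-monoʳ-< A p , +-monoʳ-< A q , +-monoʳ-< A r)

  Spanning : ℕ → List Chord → Set
  Spanning T G = ∀ {a b} → (a , b) ∈ G → b ≤ T + a

  module Outside (A t : ℕ) where

    B : ℕ
    B = suc (A + t)

    Leaf : ℕ → Chord → Set
    Leaf i (x , y) = (x ≡ A + i × B < y) ⊎ (y ≡ A + i × x < A)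

    leaf? : ∀ i f → Dec (Leaf i f)
    leaf? i (x , y) = ((x ≟ A + i) ×-dec (B <? y)) ⊎-dec ((y ≟ A + i) ×-dec (x <? A))

  module Specs (g H : ℕ → ℕ) (ℓ T t : ℕ) where
    open Model ℓ T t public

    -- The whole interval `(0 , t)` is left out because the long chord touches it without being a
    -- variable. Its inequality is weaker by one and appears in `region` as `atLeast (g t) allW`.
    Proper : ℕ × ℕ → Set
    Proper (a , s) = 1 ≤ s × a + s ≤ t × (a , s) ≢ (0 , t)

    proper? : ∀ i → Dec (Proper i)
    proper? (a , s) = (1 ≤? s) ×-dec (a + s ≤? t) ×-dec ¬? (≡-dec _≟_ _≟_ (a , s) (0 , t))

    interval : ℕ × ℕ → Spec
    interval (a , s) = atLeast (suc (g s)) (touchW a (suc (a + s)))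

    -- At least `g t ∸ ℓ` chords lie inside the interval, and at most `H (suc t ∸ v)` of them start
    -- after `v`, since they live on the last `suc t ∸ v` vertices. The condition can fail as soon
    -- as the chords from the vertices up to `v` are chosen and so prunes the search early.
    prefix : ℕ → Spec
    prefix v = atLeast (g t ∸ ℓ ∸ H (suc t ∸ v)) (leftW v)

    region : List (ℕ × ℕ) → Bool → List Spec
    region is saturate =
      map cap chords ++ map leafCap inner ++ leaves ∷ atLeast (g t) allW ∷ atLeast (g t ∸ ℓ) edgesW ∷
      map prefix (upTo (suc t)) ++ map interval (filter proper? is) ++ map (saturation (g t)) (if saturate then inner else [])

    refutesRegion : List Spec → List (ℕ × ℕ) → Bool → Bool
    refutesRegion extra is saturate = refute (map interpret (extra ++ region is saturate))

    refutesRegion⇒refute : ∀ extra is saturate → refutesRegion extra is saturate ≡ true →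
                           refute (map interpret (extra ++ region is saturate)) ≡ true
    refutesRegion⇒refute _ _ _ eq = eq

    chainPrefix : ℕ → Spec
    chainPrefix v = atLeast (suc (H (2 + t)) ∸ H (suc t ∸ v)) (leftW v)

    chain : List Spec
    chain = map cap chords ++ atLeast (suc (H (2 + t))) edgesW ∷ map chainPrefix (upTo (suc t))

    refutesChain : Bool
    refutesChain = refute (map interpret chain)

  -- The model has `S + T` vertices, enough for every chord of at most `T` sides that starts at one
  -- of the first `S` vertices. For `S ≥ 2` its excluded pair `(0 , suc t)` spans more than `T`
  -- sides and is no such chord.
  module Steep (N D : ℕ) .{{_ : NonZero D}} (ℓ T S : ℕ) where
    open Model ℓ T (S + T ∸ 2) public

    steepPrefix : ℕ → Spec
    steepPrefix v = atLeast (suc ((N * suc v) / D)) (leftW v)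

    steep : List Spec
    steep = map cap chords ++ map steepPrefix (upTo S)

    refutesSteep : Bool
    refutesSteep = refute (map interpret steep)

  -- Sets of short chords

  -- The predicate `h` on sizes is arbitrary so that tabulated bounds and linear bounds can both be
  -- transported to a window.
  window-bound : ∀ {ℓ m G} (cl : Closed ℓ m G) {P : Chord → Set} (P? : Decidable P) a p T {h : ℕ → Set} →
    (∀ G′ → Closed ℓ p G′ → Spanning T G′ → h (length G′)) →
    (∀ {x y} → (x , y) ∈ G → P (x , y) → a ≤ x × y < a + p × y ≤ T + x) → h (count P? G)
  window-bound {ℓ} {m} {G} cl P? a p T {h} bound fit =
    subst h (trans (length-map (relabel (_∸ a)) (filter P? G)) (length-filter≡count P? G))
      (bound _ (closed-relabel (_∸ a) {V = a ≤_} (λ p q x<y → ∸-monoˡ-< x<y p) cl P? ends fits) spanning)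
    where
    open Closed cl
    ends : ∀ {x y} → (x , y) ∈ G → _ → a ≤ x × a ≤ y
    ends e∈ pe = let a≤x , _ = fit e∈ pe in a≤x , ≤-trans a≤x (≤-trans (m≤n+m _ 2) (proj₁ (spans e∈)))
    fits : ∀ {x y} → (x , y) ∈ G → _ → 2 + (x ∸ a) ≤ y ∸ a × y ∸ a < p
    fits {x} {y} e∈ pe = let a≤x , y< , _ = fit e∈ pe in
      subst (_≤ y ∸ a) (+-∸-assoc 2 a≤x) (∸-monoˡ-≤ a (proj₁ (spans e∈))) ,
      subst (y ∸ a <_) (m+n∸m≡n a p) (∸-monoˡ-< y< (proj₂ (ends e∈ pe)))
    spanning : Spanning T (map (relabel (_∸ a)) (filter P? G))
    spanning e∈ with ∈-map⁻ (relabel (_∸ a)) e∈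
    ... | (x , y) , xy∈ , refl with e∈G , pe ← ∈-filter⁻ P? xy∈ with a≤x , _ , y≤ ← fit e∈G pe =
      subst (y ∸ a ≤_) (+-∸-assoc T a≤x) (∸-monoˡ-≤ a y≤)

  pairs : ℕ → List Chord
  pairs p = filter (λ (i , j) → 2 + i ≤? j) (cartesianProduct (upTo p) (upTo p))

  closed⇒length≤pairs : ∀ {ℓ p G} → Closed ℓ p G → length G ≤ length (pairs p)
  closed⇒length≤pairs {p = p} cl = unique-⊆⇒length≤ (pairs p) (Closed.unique cl) λ {(x , y)} e∈ →
    let sp , y<p = Closed.spans cl e∈ in
    ∈-filter⁺ (λ (i , j) → 2 + i ≤? j) (∈-cartesianProduct⁺ (∈-upTo⁺ (≤-<-trans (≤-trans (m≤n+m x 2) sp) y<p)) (∈-upTo⁺ y<p)) sp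

  -- A set of short chords is considered on all its vertices, so there is no outside and every leaf
  -- variable takes the value 0.
  no-leaf? : (i : ℕ) (f : Chord) → Dec ⊥
  no-leaf? _ _ = no λ ()

  module ChainValues {ℓ p : ℕ} (T t : ℕ) {G : List Chord} (cl : Closed ℓ p G) (sp : Spanning T G) where
    open Closed cl
    open Model ℓ T t
    open Values 0 ℓ T t no-leaf? G unique

    separate : Separate
    separate {edge e} {edge f} _ _ refl eq = cong edge (shift-injective eq)

    leaves≡0 : total val leavesW ≤ ℓ
    leaves≡0 = ≤-trans (≤-reflexive (trans (total-local leavesW) (∑-0 G λ {f} _ → n≤0⇒n≡0 (local≤ separate {leavesW} {f} λ where
      (edge _) _ _ → z≤n)))) z≤n

    open Soundness val edge≤1 leaves≡0 public

    cap-holds : ∀ {e} → e ∈ chords → ⟦ cap e ⟧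
    cap-holds {e@(a , b)} e∈ 1≤ = ≤-trans (≤-reflexive (total-local (crossW e))) (≤-trans
      (∑-mono G λ {f} _ → local≤ separate {crossW e} λ where
        (edge f) _ refl → ≤-refl)
      (capped (edge-∈ e 1≤)))

    covered : ∀ {P : Chord → Set} (P? : Decidable P) w → (∀ e → P e → 1 ≤ w (edge e)) →
              (∀ {x y} → (x , y) ∈ G → P (x , y) → y ≤ suc t × (x , y) ≢ (0 , suc t)) → count P? G ≤ total val w
    covered P? w P⇒1 fit = ≤-trans (∑-mono G λ {(x , y)} e∈ → ind≤ (P? (x , y)) λ p → let y≤ , ne = fit e∈ p in
        ≤-trans (P⇒1 (x , y) p) (≤local {w} (edge-∈-order (∈-chords y≤ (proj₁ (spans e∈) , sp e∈ , ne))) refl))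
      (≤-reflexive (sym (total-local w)))


  count-split : ∀ {P Q : Chord → Set} (P? : Decidable P) (Q? : Decidable Q) G → (∀ {e} → e ∈ G → ¬ P e → Q e) →
                length G ≤ count P? G + count Q? G
  count-split P? Q? G h = begin
    length G                                 ≡⟨ *-identityʳ _ ⟨
    length G * 1                             ≡⟨ ∑-const 1 G ⟨
    ∑ (λ _ → 1) G                            ≤⟨ ∑-mono G (λ {e} e∈ → one e e∈ (P? e)) ⟩
    ∑ (λ e → ind (P? e) + ind (Q? e)) G      ≡⟨ ∑-+ (λ e → ind (P? e)) _ G ⟩
    count P? G + count Q? G                  ∎
    where
    open ≤-Reasoning
    one : ∀ e → e ∈ G → Dec _ → 1 ≤ ind (P? e) + ind (Q? e)
    one e _  (yes p) = ≤-trans (≤-reflexive (sym (ind-1 (P? e) p))) (m≤m+n _ _)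
    one e e∈ (no ¬p) = ≤-trans (≤-reflexive (sym (ind-1 (Q? e) (h e∈ ¬p)))) (m≤n+m _ (ind (P? e)))

  left? : ∀ v (e : Chord) → Dec (proj₁ e ≤ v)
  left? v e = proj₁ e ≤? v

  right? : ∀ v (e : Chord) → Dec (suc v ≤ proj₁ e)
  right? v e = suc v ≤? proj₁ e

  ChainBounded : ℕ → ℕ → (ℕ → ℕ) → ℕ → Set
  ChainBounded ℓ T H p = ∀ G → Closed ℓ p G → Spanning T G → length G ≤ H p

  module _ {ℓ T : ℕ} {H : ℕ → ℕ} where

    -- By `T ≤ t` the closing side is too long to occur, so each chord is a variable. In a
    -- counterexample the chords starting after `v` obey the bound for fewer vertices, which forces
    -- a lower bound on those starting at or before `v`. The search shows that these demands
    -- conflict with the caps.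
    exact-chain : ∀ t → T ≤ t → Specs.refutesChain (λ _ → 0) H ℓ T t ≡ true →
                  (∀ {q} → q < 2 + t → ChainBounded ℓ T H q) → ChainBounded ℓ T H (2 + t)
    exact-chain t T≤t refuted! rec G cl sp with length G ≤? H (2 + t)
    ... | yes p = p
    ... | no ¬p = contradiction holds (refuted chain refuted!)
      where
      open Specs (λ _ → 0) H ℓ T t
      open ChainValues T t cl sp
      open Values 0 ℓ T t no-leaf? G (Closed.unique cl)
      inside-chain : ∀ {x y} → (x , y) ∈ G → y ≤ suc t × (x , y) ≢ (0 , suc t)
      inside-chain {x} e∈ = ≤-pred (proj₂ (Closed.spans cl e∈)) , λ where
        refl → contradiction (≤-trans (sp e∈) (≤-trans (≤-reflexive (+-identityʳ T)) T≤t)) (<⇒≱ (n<1+n t))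
      many : ∀ v → suc (H (2 + t)) ∸ H (suc t ∸ v) ≤ total val (leftW v)
      many v = m≤n+o⇒m∸n≤o _ (H (suc t ∸ v)) (≤-trans (≰⇒> ¬p) (≤-trans (count-split (left? v) (right? v) G (λ _ → ≰⇒>))
        (≤-trans (≤-reflexive (+-comm (count (left? v) G) _)) (+-mono-≤
          (window-bound cl (right? v) (suc v) (suc t ∸ v) T {_≤ H (suc t ∸ v)} (rec (s≤s (m∸n≤m (suc t) v))) λ e∈ v<x →
            v<x , <-≤-trans (proj₂ (Closed.spans cl e∈)) (s≤s (m≤n+m∸n (suc t) v)) , sp e∈)
          (covered (left? v) (leftW v) (λ e p → ≤-reflexive (sym (ind-1 (proj₁ e ≤? v) p))) λ e∈ _ → inside-chain e∈)))))
      holds : All ⟦_⟧ chain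
      holds = All.++⁺ (All.map⁺ (All.tabulate λ e∈ → cap-holds e∈))
        (≤-trans (≰⇒> ¬p) (≤-trans (count-split {P = λ _ → 1 ≤ 1} (λ _ → 1 ≤? 1) (λ _ → 1 ≤? 0) G (λ _ ¬q → contradiction ≤-refl ¬q))
          (≤-trans (≤-reflexive (trans (cong (count (λ _ → 1 ≤? 1) G +_) (∑-0 G λ _ → refl)) (+-identityʳ _)))
            (covered (λ _ → 1 ≤? 1) edgesW (λ _ _ → ≤-refl) λ e∈ _ → inside-chain e∈)))
        ∷ All.map⁺ (All.tabulate λ {v} _ → many v))

    module Linear (N D κ S : ℕ) .{{_ : NonZero D}} where

      LinearBound : ℕ → Set
      LinearBound p = ∀ G → Closed ℓ p G → Spanning T G → D * length G + κ ≤ N * p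

      -- In a smallest violation the chords starting after `v` satisfy the linear bound on
      -- `p - (v + 1)` vertices, so the first `v + 1` vertices must start more than `N (v + 1) / D`
      -- chords. Asking this for all `v < S` is already contradictory, whatever `p` is. The
      -- condition `S + 2 ≤ p` leaves at least two vertices for the induction.
      steep-chain : ∀ p → S + 2 ≤ p → 2 ≤ S → Steep.refutesSteep N D ℓ T S ≡ true →
                    (∀ {q} → 2 ≤ q → q < p → LinearBound q) → LinearBound p
      steep-chain p S+2≤p 2≤S refuted! rec G cl sp with D * length G + κ ≤? N * p
      ... | yes q = q
      ... | no ¬q = contradiction holds (refuted steep refuted!)
        where
        open Steep N D ℓ T S
        t = S + T ∸ 2
        suc-t : suc t ≡ S + T ∸ 1
        suc-t = eq (≤-trans 2≤S (m≤m+n S T))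
          where
          eq : ∀ {n} → 2 ≤ n → suc (n ∸ 2) ≡ n ∸ 1
          eq (s≤s (s≤s _)) = refl
        open ChainValues T t cl sp
        open Values 0 ℓ T t no-leaf? G (Closed.unique cl)
        fit : ∀ {v x y} → v < S → (x , y) ∈ G → x ≤ v → y ≤ suc t × (x , y) ≢ (0 , suc t)
        fit {v} {x} {y} v<S e∈ x≤v =
          ≤-trans (sp e∈) (≤-trans (+-monoʳ-≤ T x≤v) (≤-trans (≤-reflexive (+-comm T v)) (≤-trans (∸-monoˡ-≤ 1 (+-monoˡ-≤ T v<S)) (≤-reflexive (sym suc-t))))) ,
          λ where refl → contradiction (≤-trans (sp e∈) (≤-reflexive (+-identityʳ T)))
                           (<⇒≱ (≤-trans (∸-monoˡ-≤ 1 (+-monoˡ-≤ T 2≤S)) (≤-reflexive (sym suc-t))))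
        steep-prefix : ∀ {v} → v < S → suc ((N * suc v) / D) ≤ total val (leftW v)
        steep-prefix {v} v<S = m<n*o⇒m/o<n (<-≤-trans (+-cancelʳ-< (N * (p ∸ suc v)) _ _ (begin-strict
          N * suc v + N * (p ∸ suc v)     ≡⟨ *-distribˡ-+ N (suc v) (p ∸ suc v) ⟨
          N * (suc v + (p ∸ suc v))       ≡⟨ cong (N *_) (m+[n∸m]≡n v<p) ⟩
          N * p                           <⟨ ≰⇒> ¬q ⟩
          D * length G + κ                ≤⟨ +-monoˡ-≤ κ (*-monoʳ-≤ D (count-split (left? v) (right? v) G (λ _ → ≰⇒>))) ⟩
          D * (L + R) + κ                 ≡⟨ cong (_+ κ) (*-distribˡ-+ D L R) ⟩
          D * L + D * R + κ               ≡⟨ +-assoc (D * L) _ κ ⟩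
          D * L + (D * R + κ)             ≤⟨ +-monoʳ-≤ (D * L) rest ⟩
          D * L + N * (p ∸ suc v)         ∎))
          (≤-trans (*-monoʳ-≤ D (covered (left? v) (leftW v) (λ e q → ≤-reflexive (sym (ind-1 (proj₁ e ≤? v) q))) (fit v<S))) (≤-reflexive (*-comm D _))))
          where
          open ≤-Reasoning
          L = count (left? v) G
          R = count (right? v) G
          v<p : suc v ≤ p
          v<p = ≤-trans v<S (≤-trans (m≤m+n S 2) S+2≤p)
          rest : D * R + κ ≤ N * (p ∸ suc v)
          rest = window-bound cl (right? v) (suc v) (p ∸ suc v) T {λ r → D * r + κ ≤ N * (p ∸ suc v)}
            (rec (≤-trans (≤-reflexive (sym (m+n∸m≡n S 2))) (≤-trans (∸-monoˡ-≤ S S+2≤p) (∸-monoʳ-≤ p v<S))) (∸-monoʳ-< (s≤s z≤n) v<p))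
            λ e∈ v<x → v<x , subst (_ <_) (sym (m+[n∸m]≡n v<p)) (proj₂ (Closed.spans cl e∈)) , sp e∈
        holds : All ⟦_⟧ steep
        holds = All.++⁺ (All.map⁺ (All.tabulate λ e∈ → cap-holds e∈)) (All.map⁺ (All.tabulate λ v∈ → steep-prefix (∈-upTo⁻ v∈)))

  -- A smallest counterexample

  -- The interval below a chord (A , B) of a set G of chords with more than
  -- g (m - 2) elements, when no other chord below it spans more than T sides.

  module Interval {ℓ m : ℕ} {g : ℕ → ℕ} {G : List Chord} (cl : Closed ℓ m G)
    (IH : ∀ {m′} → m′ < m → Bounded ℓ g m′)
    (super : ∀ s r → g s + g r ≤ g (s + r)) (big : g (m ∸ 2) < length G)
    (A t T : ℕ) (1≤t : 1 ≤ t) (d∈ : (A , suc (A + t)) ∈ G)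
    (short : ∀ {x y} → (x , y) ∈ G → A ≤ x → y ≤ suc (A + t) → (x , y) ≢ (A , suc (A + t)) → y ≤ T + x)
    where

    open Closed cl
    open Cuts {g = g} cl IH
    open Excess super big
    open Outside A t
    open Model ℓ T t
    open Values A ℓ T t leaf? G unique

    d : Chord
    d = A , B

    B≡ : A + suc t ≡ B
    B≡ = +-suc A t

    B<m : B < m
    B<m = proj₂ (spans d∈)

    inner⇒ : ∀ {i} → i ≤ suc t → A + i ≤ B
    inner⇒ i≤ = ≤-trans (+-monoʳ-≤ A i≤) (≤-reflexive B≡)

    inside⇒ : ∀ {i} → Inside 0 (suc t) i → Inside A B (A + i)
    inside⇒ {i} (p , q) = <-≤-trans (≤-reflexive (sym (+-comm A 1))) (+-monoʳ-≤ A p) , <-≤-trans (+-monoʳ-< A q) (≤-reflexive B≡)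

    leaf-cross-d : ∀ {i f} → Inside 0 (suc t) i → Leaf i f → Cross d f
    leaf-cross-d in-i (inj₁ (refl , B<y)) = inj₁ (proj₁ (inside⇒ in-i) , proj₂ (inside⇒ in-i) , B<y)
    leaf-cross-d in-i (inj₂ (refl , x<A)) = inj₂ (x<A , inside⇒ in-i)

    cross-sym : ∀ {e f} → Cross e f → Cross f e
    cross-sym (inj₁ (p , q , r)) = inj₂ (p , q , r)
    cross-sym (inj₂ (p , q , r)) = inj₁ (p , q , r)

    no-leaf : ∀ {e i} → e ∈ chords → ¬ Leaf i (shift e)
    no-leaf e∈ (inj₁ (_ , B<))  = <⇒≱ B< (inner⇒ (proj₁ (proj₂ (chord-bounds e∈))))
    no-leaf e∈ (inj₂ (_ , <A))  = <⇒≱ <A (m≤m+n A _)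

    separate : Separate
    separate {edge e} {edge f} _ _ refl eq = cong edge (shift-injective eq)
    separate {edge e} {leaf i} e∈ _ refl l = contradiction l (no-leaf (order-edge e∈))
    separate {leaf i} {edge e} _ e∈ l refl = contradiction l (no-leaf (order-edge e∈))
    separate {leaf i} {leaf j} _ _ (inj₁ (p , _)) (inj₁ (q , _)) = cong leaf (+-cancelˡ-≡ A i j (trans (sym p) q))
    separate {leaf i} {leaf j} _ _ (inj₂ (p , _)) (inj₂ (q , _)) = cong leaf (+-cancelˡ-≡ A i j (trans (sym p) q))
    separate {leaf i} {leaf j} _ _ (inj₁ (p , _)) (inj₂ (_ , q)) = contradiction (subst (_< A) p q) (≤⇒≯ (m≤m+n A i))
    separate {leaf i} {leaf j} _ _ (inj₂ (_ , q)) (inj₁ (p , _)) = contradiction (subst (_< A) p q) (≤⇒≯ (m≤m+n A j))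

    total≤count : ∀ w {Q : Chord → Set} (Q? : ∀ f → Dec (Q f)) → (∀ x → w x ≤ 1) →
                  (∀ x {f} → f ∈ G → x ∈ order → 1 ≤ w x → Match x f → Q f) → total val w ≤ count Q? G
    total≤count w Q? w≤1 h = ≤-trans (≤-reflexive (total-local w)) (∑-mono G λ {f} f∈ → local≤ separate {w} λ x x∈ mx → bound f∈ x∈ mx)
      where
      bound : ∀ {x f} → f ∈ G → x ∈ order → Match x f → w x ≤ ind (Q? f)
      bound {x} {f} f∈ x∈ mx with w x | w≤1 x | h x {f} f∈ x∈
      ... | zero        | _ | _  = z≤n
      ... | suc zero    | _ | h′ = ≤-reflexive (sym (ind-1 (Q? f) (h′ (s≤s z≤n) mx)))
      ... | suc (suc _) | s≤s () | _

    -- A chord with an end strictly inside either has both ends in the interval, and then is short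
    -- by minimality of the long chord, or leaves it from exactly one inner vertex.
    classify : ∀ {x y} → (x , y) ∈ G → Inside A B x ⊎ Inside A B y →
               (∃ λ i → ∃ λ j → (i , j) ∈ chords × (x , y) ≡ (A + i , A + j)) ⊎
               (∃ λ i → Inside 0 (suc t) i × Leaf i (x , y) × ((x ≡ A + i) ⊎ (y ≡ A + i)))
    classify {x} {y} f∈ ins with A ≤? x | y ≤? B
    ... | yes A≤x | yes y≤B = inj₁ (x ∸ A , y ∸ A , mem , cong₂ _,_ (sym (m+[n∸m]≡n A≤x)) (sym (m+[n∸m]≡n A≤y)))
      where
      sp = proj₁ (spans f∈)
      A≤y : A ≤ y
      A≤y = ≤-trans A≤x (≤-trans (m≤n+m x 2) sp)
      ne : (x , y) ≢ d
      ne refl = case ins of λ where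
        (inj₁ (p , _)) → <-irrefl refl p
        (inj₂ (_ , p)) → <-irrefl refl p
      mem : (x ∸ A , y ∸ A) ∈ chords
      mem = ∈-chords (subst (y ∸ A ≤_) (trans (cong (_∸ A) (sym B≡)) (m+n∸m≡n A (suc t))) (∸-monoˡ-≤ A y≤B))
        ( subst (_≤ y ∸ A) (+-∸-assoc 2 A≤x) (∸-monoˡ-≤ A sp)
        , subst (y ∸ A ≤_) (+-∸-assoc T A≤x) (∸-monoˡ-≤ A (short f∈ A≤x y≤B ne))
        , λ eq → ne (cong₂ _,_ (trans (sym (m+[n∸m]≡n A≤x)) (trans (cong (A +_) (cong proj₁ eq)) (+-identityʳ A)))
                               (trans (sym (m+[n∸m]≡n A≤y)) (trans (cong (A +_) (cong proj₂ eq)) B≡))))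
    ... | no A≰x | _ = inj₂ (y ∸ A , in-y , inj₂ (y≡ , ≰⇒> A≰x) , inj₂ y≡)
      where
      iny : Inside A B y
      iny = case ins of λ where
        (inj₁ (p , _)) → contradiction (<⇒≤ p) A≰x
        (inj₂ p)       → p
      y≡ : y ≡ A + (y ∸ A)
      y≡ = sym (m+[n∸m]≡n (<⇒≤ (proj₁ iny)))
      in-y : Inside 0 (suc t) (y ∸ A)
      in-y = m<n⇒0<n∸m (proj₁ iny) , +-cancelˡ-< A (y ∸ A) (suc t) (subst₂ _<_ y≡ (sym B≡) (proj₂ iny))
    ... | yes _ | no y≰B = inj₂ (x ∸ A , in-x , inj₁ (x≡ , ≰⇒> y≰B) , inj₁ x≡)
      where
      inx : Inside A B x
      inx = case ins of λ where
        (inj₁ p)       → p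
        (inj₂ (_ , p)) → contradiction (<⇒≤ p) y≰B
      x≡ : x ≡ A + (x ∸ A)
      x≡ = sym (m+[n∸m]≡n (<⇒≤ (proj₁ inx)))
      in-x : Inside 0 (suc t) (x ∸ A)
      in-x = m<n⇒0<n∸m (proj₁ inx) , +-cancelˡ-< A (x ∸ A) (suc t) (subst₂ _<_ x≡ (sym B≡) (proj₂ inx))

    leaves≤ℓ : total val leavesW ≤ ℓ
    leaves≤ℓ = ≤-trans (total≤count leavesW (cross? d) (λ where (edge _) → z≤n; (leaf _) → ≤-refl) λ where
      (edge _) _ _ () _
      (leaf i) _ i∈ _ l → leaf-cross-d (order-leaf i∈) l) (capped d∈)

    open Soundness val edge≤1 leaves≤ℓ public

    cap-holds : ∀ {e} → e ∈ chords → ⟦ cap e ⟧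
    cap-holds {a , b} e∈ 1≤ = ≤-trans (total≤count (crossW (a , b)) (cross? (shift (a , b)))
      (λ where (edge f) → ind≤1 (cross? (a , b) f); (leaf i) → ind≤1 (inside? a b i)) λ where
        (edge f) _ _ 1≤w refl → shift-cross (ind-elim (cross? (a , b) f) 1≤w)
        (leaf i) _ _ 1≤w (inj₁ (refl , B<y)) → let p , q = ind-elim (inside? a b i) 1≤w in
          inj₁ (+-monoʳ-< A p , +-monoʳ-< A q , ≤-<-trans (inner⇒ (proj₁ (proj₂ (chord-bounds e∈)))) B<y)
        (leaf i) _ _ 1≤w (inj₂ (refl , x<A)) → let p , q = ind-elim (inside? a b i) 1≤w in
          inj₂ (<-≤-trans x<A (m≤m+n A a) , +-monoʳ-< A p , +-monoʳ-< A q))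
      (capped (edge-∈ (a , b) 1≤))

    -- The leaving chord `f` crosses `d` and every chord passing over its inner end, and all of
    -- these touch the interval. The extra 1 is `d`, which corresponds to no variable.
    straddle-d : ∀ {i f} → f ∈ G → Leaf i f → Inside 0 (suc t) i →
                 suc (total val (straddleW i)) ≤ count (λ h → cross? f h ×-dec touch? A B h) G
    straddle-d {i} {f} f∈ l in-i = begin
      1 + total val (straddleW i)                              ≤⟨ +-mono-≤ one (≤-reflexive (total-local (straddleW i))) ⟩
      count (_≟ᶜ d) G + ∑ (local (straddleW i)) G              ≡⟨ ∑-+ (λ h → ind (h ≟ᶜ d)) _ G ⟨
      ∑ (λ h → ind (h ≟ᶜ d) + local (straddleW i) h) G         ≤⟨ ∑-mono G (λ {h} _ → pointwise h) ⟩
      count (λ h → cross? f h ×-dec touch? A B h) G            ∎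
      where
      open ≤-Reasoning
      one : 1 ≤ count (_≟ᶜ d) G
      one = ≤-trans (≤-reflexive (sym (ind-1 (d ≟ᶜ d) refl))) (∈⇒≤∑ (λ h → ind (h ≟ᶜ d)) d∈)
      pointwise : ∀ h → ind (h ≟ᶜ d) + local (straddleW i) h ≤ ind (cross? f h ×-dec touch? A B h)
      pointwise h = go (h ≟ᶜ d)
        where
        go : Dec (h ≡ d) → ind (h ≟ᶜ d) + local (straddleW i) h ≤ ind (cross? f h ×-dec touch? A B h)
        go (yes refl) = ≤-trans (+-mono-≤ (ind≤1 (d ≟ᶜ d)) (local≤ separate {straddleW i} {c = 0} λ where
              (edge e) e∈ eq → contradiction (shift-injective {e} (trans (sym eq) (cong₂ _,_ (sym (+-identityʳ A)) (sym B≡)))) (proj₂ (proj₂ (chord-bounds (order-edge e∈))))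
              (leaf _) _ _ → z≤n))
            (≤-reflexive (sym (ind-1 (cross? f d ×-dec touch? A B d) (cross-sym (leaf-cross-d in-i l) , inj₂ (inj₂ refl)))))
        go (no h≢d) = ≤-trans (+-monoˡ-≤ _ (≤-reflexive (ind-0 (h ≟ᶜ d) h≢d))) (local≤ separate {straddleW i} λ where
              (edge (a , b)) e∈ refl → ind-mono (inside? a b i) (cross? f (shift (a , b)) ×-dec touch? A B (shift (a , b)))
                (λ (p , q) → cross-of l e∈ p q , touch-of (order-edge e∈))
              (leaf _) _ _ → z≤n)
          where
          cross-of : ∀ {a b f} → Leaf i f → edge (a , b) ∈ order → a < i → i < b → Cross f (shift (a , b))
          cross-of (inj₁ (refl , B<y)) e∈ p q = inj₂ (+-monoʳ-< A p , +-monoʳ-< A q , ≤-<-trans (inner⇒ (proj₁ (proj₂ (chord-bounds (order-edge e∈))))) B<y)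
          cross-of {a} (inj₂ (refl , x<A)) e∈ p q = inj₁ (<-≤-trans x<A (m≤m+n A a) , +-monoʳ-< A p , +-monoʳ-< A q)
          touch-of : ∀ {a b} → (a , b) ∈ chords → Touch A B (shift (a , b))
          touch-of {a} {b} e∈ with chord-bounds e∈ | a ≟ 0 | b ≟ suc t
          ... | sp , b≤ , ne | no a≢0 | _ = inj₁ (inside⇒ (n≢0⇒n>0 a≢0 , ≤-trans (≤-trans (n≤1+n _) sp) b≤))
          ... | sp , b≤ , ne | yes refl | yes refl = contradiction refl ne
          ... | sp , b≤ , ne | yes refl | no b≢ = inj₂ (inj₁ (inside⇒ (≤-trans (s≤s z≤n) sp , ≤∧≢⇒< b≤ b≢)))

    leafCap-holds : ∀ i → Inside 0 (suc t) i → ⟦ leafCap i ⟧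
    leafCap-holds i in-i 1≤ with f , f∈ , l ← count-1≤ (match? (leaf i)) G 1≤ =
      ≤-trans (straddle-d f∈ l in-i) (≤-trans (∑-mono G λ {h} _ → ind-mono (cross? f h ×-dec touch? A B h) (cross? f h) proj₁) (capped f∈))

    -- The excess inequality is read off in `G`. A chord touching a proper subinterval has an end
    -- strictly inside `(A , B)`, so it is represented by a variable of positive weight.
    interval-holds : ∀ a s → 1 ≤ s → a + s ≤ t → (a , s) ≢ (0 , t) → suc (g s) ≤ total val (touchW a (suc (a + s)))
    interval-holds a s 1≤s a+s≤t ne = begin
      suc (g s)                                   ≤⟨ touch-excess (A + a) s 1≤s (≤-<-trans b′≤B B<m) ⟩
      count (touch? (A + a) b′) G                 ≤⟨ ∑-mono G (λ {f} → pointwise f) ⟩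
      ∑ (local w) G                               ≡⟨ total-local w ⟨
      total val w                                 ∎
      where
      open ≤-Reasoning
      b = suc (a + s)
      b′ = suc (A + a + s)
      b′≡ : b′ ≡ A + b
      b′≡ = trans (cong suc (+-assoc A a s)) (sym (+-suc A (a + s)))
      b′≤B : b′ ≤ B
      b′≤B = s≤s (≤-trans (≤-reflexive (+-assoc A a s)) (+-monoʳ-≤ A a+s≤t))
      w = touchW a b
      unshift : ∀ {i} → Inside (A + a) b′ (A + i) → Inside a b i
      unshift {i} (p , q) = +-cancelˡ-< A a i p , +-cancelˡ-< A i b (subst (A + i <_) b′≡ q)
      widen : ∀ {x} → Inside (A + a) b′ x → Inside A B x
      widen (p , q) = ≤-<-trans (m≤m+n A a) p , <-≤-trans q b′≤B
      ends : ∀ {x y} → (x , y) ∈ G → Touch (A + a) b′ (x , y) → Inside A B x ⊎ Inside A B y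
      ends f∈ (inj₁ p)        = inj₁ (widen p)
      ends f∈ (inj₂ (inj₁ p)) = inj₂ (widen p)
      ends f∈ (inj₂ (inj₂ refl)) with a ≟ 0 | s ≟ t
      ... | no a≢0 | _ = inj₁ (≤-trans (≤-reflexive (sym (+-comm A 1))) (+-monoʳ-≤ A (n≢0⇒n>0 a≢0)) , <-≤-trans (s≤s (m≤m+n (A + a) s)) b′≤B)
      ... | yes refl | yes refl = contradiction refl ne
      ... | yes refl | no s≢t = inj₂ (≤-<-trans (≤-trans (m≤m+n A 0) (m≤m+n _ s)) (n<1+n _) , s≤s (≤-trans (≤-reflexive (cong (λ z → suc (z + s)) (+-identityʳ A))) (≤-trans (≤-reflexive (sym (+-suc A s))) (+-monoʳ-≤ A (≤∧≢⇒< a+s≤t s≢t)))))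
      pointwise : ∀ f → f ∈ G → ind (touch? (A + a) b′ f) ≤ local w f
      pointwise (x , y) f∈ = ind≤ (touch? (A + a) b′ (x , y)) (λ τ → positive τ (classify f∈ (ends f∈ τ)))
        where
        positive : Touch (A + a) b′ (x , y) → _ → 1 ≤ local w (x , y)
        positive τ (inj₁ (i , j , e∈ , refl)) = ≤-trans (≤-reflexive (sym (ind-1 (touch? a b (i , j)) (back τ)))) (≤local {w} (edge-∈-order e∈) refl)
          where
          back : Touch (A + a) b′ (A + i , A + j) → Touch a b (i , j)
          back (inj₁ p)        = inj₁ (unshift p)
          back (inj₂ (inj₁ p)) = inj₂ (inj₁ (unshift p))
          back (inj₂ (inj₂ eq)) = inj₂ (inj₂ (shift-injective (trans eq (cong (A + a ,_) b′≡))))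
        positive τ (inj₂ (i , in-i , l , at-i)) = ≤-trans (≤-reflexive (sym (ind-1 (inside? a b i) (back τ l)))) (≤local {w} (leaf-∈-order (∈-inner in-i)) l)
          where
          back : Touch (A + a) b′ (x , y) → Leaf i (x , y) → Inside a b i
          back (inj₁ p) (inj₁ (refl , _)) = unshift p
          back (inj₁ p) (inj₂ (_ , x<A)) = contradiction (proj₁ (widen p)) (<-asym x<A)
          back (inj₂ (inj₁ p)) (inj₁ (_ , B<y)) = contradiction (proj₂ (widen p)) (<-asym B<y)
          back (inj₂ (inj₁ p)) (inj₂ (refl , _)) = unshift p
          back (inj₂ (inj₂ refl)) (inj₁ (_ , B<y)) = contradiction b′≤B (<⇒≱ B<y)
          back (inj₂ (inj₂ refl)) (inj₂ (_ , x<A)) = contradiction (m≤m+n A a) (<⇒≱ x<A)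

    -- The long chord `d` is the only touching chord without a variable.
    touch≤total : count (touch? A B) G ≤ suc (total val allW)
    touch≤total = begin
      count (touch? A B) G                            ≤⟨ ∑-mono G (λ {f} → pointwise f) ⟩
      ∑ (λ f → ind (f ≟ᶜ d) + local allW f) G         ≡⟨ ∑-+ (λ f → ind (f ≟ᶜ d)) _ G ⟩
      count (_≟ᶜ d) G + ∑ (local allW) G              ≤⟨ +-mono-≤ (count-≡≤1 d) (≤-reflexive (sym (total-local allW))) ⟩
      suc (total val allW)                            ∎
      where
      open ≤-Reasoning
      pointwise : ∀ f → f ∈ G → ind (touch? A B f) ≤ ind (f ≟ᶜ d) + local allW f
      pointwise f f∈ = ind≤ (touch? A B f) λ where
          (inj₁ p)           → ≤-trans (positive (classify f∈ (inj₁ p))) (m≤n+m _ (ind (f ≟ᶜ d)))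
          (inj₂ (inj₁ p))    → ≤-trans (positive (classify f∈ (inj₂ p))) (m≤n+m _ (ind (f ≟ᶜ d)))
          (inj₂ (inj₂ refl)) → ≤-trans (≤-reflexive (sym (ind-1 (d ≟ᶜ d) refl))) (m≤m+n _ _)
        where
        positive : _ → 1 ≤ local allW f
        positive (inj₁ (i , j , e∈ , refl)) = ≤local {allW} (edge-∈-order e∈) refl
        positive (inj₂ (i , in-i , l , _))  = ≤local {allW} (leaf-∈-order (∈-inner in-i)) l

    total-holds : g t ≤ total val allW
    total-holds = ≤-pred (≤-trans (touch-excess A t 1≤t B<m) touch≤total)

    all≤ : total val allW ≤ total val edgesW + ℓ
    all≤ = begin
      total val allW                                ≡⟨ ∑-cong order (λ {x} _ → each x) ⟩
      ∑ (λ x → edgesW x * val x + leavesW x * val x) order ≡⟨ ∑-+ _ _ order ⟩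
      total val edgesW + total val leavesW          ≤⟨ +-monoʳ-≤ _ leaves≤ℓ ⟩
      total val edgesW + ℓ                          ∎
      where
      open ≤-Reasoning
      each : ∀ x → allW x * val x ≡ edgesW x * val x + leavesW x * val x
      each (edge _) = sym (+-identityʳ _)
      each (leaf _) = refl

    edges-hold : g t ∸ ℓ ≤ total val edgesW
    edges-hold = m≤n+o⇒m∸n≤o _ ℓ (≤-trans total-holds (≤-trans all≤ (≤-reflexive (+-comm _ ℓ))))

    implies-holds : ∀ e f → (1 ≤ val (edge e) → 1 ≤ val (edge f)) → ⟦ implies e f ⟧
    implies-holds e f h with val (edge e) in eq
    ... | zero        = z≤n
    ... | suc zero    = h (s≤s z≤n)
    ... | suc (suc n) = contradiction (subst (_≤ 1) eq (edge≤1 e)) λ where (s≤s ())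

    module _ (gap : ∀ t x y → g t + 2 + g x + g y ≤ g (suc (t + x + y))) (2≤ℓ : 2 ≤ ℓ) where
      open Saturated gap

      -- If `d` and the chords over `i` already make up `ℓ` crossings of a chord leaving at `i`,
      -- that chord has no crossing to spare. Everything crossing it touches the interval, and the
      -- splitting argument yields one touching chord more than the excess inequality does.
      saturation-holds : ∀ i → Inside 0 (suc t) i → ⟦ saturation (g t) i ⟧
      saturation-holds i in-i = 2≤ℓ , total-holds , leafCap-holds i in-i , λ 1≤ ℓ≤ →
        ≤-pred (≤-trans (full 1≤ ℓ≤) touch≤total)
        where
        full : 1 ≤ val (leaf i) → ℓ ≤ suc (total val (straddleW i)) → 2 + g t ≤ count (touch? A B) G
        full 1≤ ℓ≤ with count-1≤ (match? (leaf i)) G 1≤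
        ... | (x , y) , f∈ , l = by l
          where
          all-touch : ∀ {h} → h ∈ G → Cross (x , y) h → Touch A B h
          all-touch {h} h∈ c with touch? A B h
          ... | yes τ = τ
          ... | no ¬τ = contradiction (capped f∈) (<⇒≱ (begin-strict
            ℓ ≤⟨ ℓ≤ ⟩
            suc (total val (straddleW i)) ≤⟨ straddle-d f∈ l in-i ⟩
            count (λ h → cross? (x , y) h ×-dec touch? A B h) G <⟨ n<1+n _ ⟩
            1 + count (λ h → cross? (x , y) h ×-dec touch? A B h) G
              ≤⟨ +-monoˡ-≤ _ (≤-trans (≤-reflexive (sym (ind-1 (cross? (x , y) h ×-dec ¬? (touch? A B h)) (c , ¬τ)))) (∈⇒≤∑ (λ h → ind (cross? (x , y) h ×-dec ¬? (touch? A B h))) h∈)) ⟩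
            count (λ h → cross? (x , y) h ×-dec ¬? (touch? A B h)) G + count (λ h → cross? (x , y) h ×-dec touch? A B h) G
              ≡⟨ ∑-+ _ _ G ⟨
            ∑ (λ h → ind (cross? (x , y) h ×-dec ¬? (touch? A B h)) + ind (cross? (x , y) h ×-dec touch? A B h)) G
              ≤⟨ ∑-mono G (λ {h} _ → ind-split (cross? (x , y) h) (touch? A B h)) ⟩
            crossings G (x , y) ∎))
            where open ≤-Reasoning
          by : Leaf i (x , y) → 2 + g t ≤ count (touch? A B) G
          by (inj₁ (refl , B<y)) = saturatedʳ 1≤t (inside⇒ in-i) B<y (proj₂ (spans f∈)) all-touch
          by (inj₂ (refl , x<A)) = saturatedˡ 1≤t (inside⇒ in-i) x<A B<m all-touch

    implies-∈ : ∀ e f → (shift e ∈ G → shift f ∈ G) → ⟦ implies e f ⟧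
    implies-∈ e f h = implies-holds e f λ 1≤ → ≤-trans (≤-reflexive (sym (ind-1 (shift f ≟ᶜ shift f) refl)))
      (∈⇒≤∑ (λ c → ind (c ≟ᶜ shift f)) (h (edge-∈ e 1≤)))

    Later : ℕ → Chord → Set
    Later a (x , y) = a ≤ x × y ≤ B × (x , y) ≢ d

    later? : ∀ a e → Dec (Later a e)
    later? a (x , y) = (a ≤? x) ×-dec (y ≤? B) ×-dec ¬? ((x , y) ≟ᶜ d)

    laterW : ℕ → Weight
    laterW v (edge (a , _)) = ind (v ≤? a)
    laterW v (leaf _)       = 0

    later-total : ∀ v → total val (laterW v) ≤ count (later? (A + v)) G
    later-total v = total≤count (laterW v) (later? (A + v)) (λ where (edge (a , _)) → ind≤1 (v ≤? a); (leaf _) → z≤n) λ where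
      (edge (a , b)) _ e∈ 1≤ refl → let sp , b≤ , ne = chord-bounds (order-edge e∈) in
        +-monoʳ-≤ A (ind-elim (v ≤? a) 1≤) , inner⇒ b≤ ,
        λ eq → ne (shift-injective (trans eq (cong₂ _,_ (sym (+-identityʳ A)) (sym B≡))))
      (leaf _) _ _ () _

    later-window : ∀ {v} {h : ℕ → Set} → v ≤ suc t →
      (∀ G′ → Closed ℓ (2 + t ∸ v) G′ → Spanning T G′ → h (length G′)) → h (count (later? (A + v)) G)
    later-window {v} {h} v≤ bound = window-bound cl (later? (A + v)) (A + v) (2 + t ∸ v) T {h} bound λ e∈ (a≤ , y≤ , ne) →
      a≤ , ≤-trans (s≤s y≤) (≤-reflexive size) , short e∈ (≤-trans (m≤m+n A v) a≤) y≤ ne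
      where
      size : suc B ≡ A + v + (2 + t ∸ v)
      size = trans (sym (trans (+-suc A (suc t)) (cong suc B≡))) (sym (trans (+-assoc A v _) (cong (A +_) (m+[n∸m]≡n (≤-trans v≤ (n≤1+n _))))))

    edges-split : ∀ v → total val edgesW ≡ total val (leftW v) + total val (laterW (suc v))
    edges-split v = trans (∑-cong order λ {x} _ → each x) (∑-+ (λ x → leftW v x * val x) _ order)
      where
      each : ∀ x → edgesW x * val x ≡ leftW v x * val x + laterW (suc v) x * val x
      each (leaf _) = refl
      each (edge (a , b)) with a ≤? v
      ... | yes p = trans (sym (+-identityʳ _)) (cong₂ _+_ (cong (_* val (edge (a , b))) (sym (ind-1 (a ≤? v) p))) (cong (_* val (edge (a , b))) (sym (ind-0 (suc v ≤? a) (≤⇒≯ p)))))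
      ... | no ¬p = cong₂ _+_ (cong (_* val (edge (a , b))) (sym (ind-0 (a ≤? v) ¬p))) (cong (_* val (edge (a , b))) (sym (ind-1 (suc v ≤? a) (≰⇒> ¬p))))

    edges≤later : total val edgesW ≤ total val (laterW 0)
    edges≤later = ∑-mono order λ {x} _ → each x
      where
      each : ∀ x → edgesW x * val x ≤ laterW 0 x * val x
      each (edge _) = ≤-refl
      each (leaf _) = z≤n

    -- At least `g t` touching chords besides `d` and at most `ℓ` leaves force at least `g t - ℓ`
    -- short chords on `2 + t` vertices. Since `g` grows faster than the linear bound, this limits
    -- `t`.
    linear-bound : ∀ N D κ → (∀ G′ → Closed ℓ (2 + t) G′ → Spanning T G′ → D * length G′ + κ ≤ N * (2 + t)) →
                   D * g t + κ ≤ N * (2 + t) + D * ℓ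
    linear-bound N D κ bound = begin
      D * g t + κ                          ≤⟨ +-monoˡ-≤ κ (*-monoʳ-≤ D (≤-trans total-holds all≤)) ⟩
      D * (total val edgesW + ℓ) + κ       ≤⟨ +-monoˡ-≤ κ (*-monoʳ-≤ D (+-monoˡ-≤ ℓ (≤-trans edges≤later (later-total 0)))) ⟩
      D * (c + ℓ) + κ                      ≡⟨ cong (_+ κ) (*-distribˡ-+ D c ℓ) ⟩
      D * c + D * ℓ + κ                    ≡⟨ +-assoc (D * c) _ κ ⟩
      D * c + (D * ℓ + κ)                  ≡⟨ cong (D * c +_) (+-comm (D * ℓ) κ) ⟩
      D * c + (κ + D * ℓ)                  ≡⟨ +-assoc (D * c) κ _ ⟨
      D * c + κ + D * ℓ                    ≤⟨ +-monoˡ-≤ _ (later-window {0} {λ n → D * n + κ ≤ N * (2 + t)} z≤n bound) ⟩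
      N * (2 + t) + D * ℓ                  ∎
      where
      open ≤-Reasoning
      c = count (later? (A + 0)) G

    module _ {H : ℕ → ℕ} (chain≤ : ∀ p → ChainBounded ℓ T H p) where
      open Specs g H ℓ T t using (region; prefix; interval; proper?; refutesRegion; refutesRegion⇒refute)

      prefix-holds : ∀ v → v ≤ t → ⟦ prefix v ⟧
      prefix-holds v v≤ = m≤n+o⇒m∸n≤o _ (H (suc t ∸ v)) (begin
        g t ∸ ℓ                                          ≤⟨ edges-hold ⟩
        total val edgesW                                 ≡⟨ edges-split v ⟩
        total val (leftW v) + total val (laterW (suc v)) ≤⟨ +-monoʳ-≤ _ (≤-trans (later-total (suc v)) (later-window {suc v} {_≤ H (suc t ∸ v)} (s≤s v≤) (chain≤ _))) ⟩
        total val (leftW v) + H (suc t ∸ v)              ≡⟨ +-comm _ (H (suc t ∸ v)) ⟩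
        H (suc t ∸ v) + total val (leftW v)              ∎)
        where open ≤-Reasoning

      Saturable : Bool → Set
      Saturable saturate = saturate ≡ true → 2 ≤ ℓ × (∀ t x y → g t + 2 + g x + g y ≤ g (suc (t + x + y)))

      region-holds : ∀ is saturate → Saturable saturate → All ⟦_⟧ (region is saturate)
      region-holds is saturate h =
        All.++⁺ (All.map⁺ (All.tabulate λ e∈ → cap-holds e∈))
        (All.++⁺ (All.map⁺ (All.tabulate λ {i} i∈ → leafCap-holds i (inner-bounds i∈)))
        (leaves≤ℓ ∷ total-holds ∷ edges-hold ∷
        All.++⁺ (All.map⁺ (All.tabulate λ {v} v∈ → prefix-holds v (≤-pred (∈-upTo⁻ v∈))))
        (All.++⁺ (All.map⁺ (All.tabulate λ {(a , s)} i∈ → let p , q , r = proj₂ (∈-filter⁻ proper? {xs = is} i∈) in interval-holds a s p q r))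
        (All.map⁺ (saturations saturate h)))))
        where
        inner-bounds : ∀ {i} → i ∈ inner → Inside 0 (suc t) i
        inner-bounds i∈ = order-leaf (leaf-∈-order i∈)
        saturations : ∀ s → Saturable s → All (λ i → ⟦ saturation (g t) i ⟧) (if s then inner else [])
        saturations false _ = []
        saturations true  h = let 2≤ℓ , gap = h refl in All.tabulate λ {i} i∈ → saturation-holds gap 2≤ℓ i (inner-bounds i∈)

      region-refuted : ∀ extra is saturate → Saturable saturate → All ⟦_⟧ extra →
                       refutesRegion extra is saturate ≡ true → ⊥
      region-refuted extra is saturate h hs eq = refuted (extra ++ region is saturate)
        (refutesRegion⇒refute extra is saturate eq) (All.++⁺ hs (region-holds is saturate h))

      -- Adding the absence of `e` to the constraints and refuting them shows that `e` is present;
      -- single chords are deduced in this way.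
      forced : ∀ e is saturate → Saturable saturate → refutesRegion (absent e ∷ []) is saturate ≡ true → shift e ∈ G
      forced e is saturate h eq = go (val (edge e)) refl
        where
        go : ∀ n → val (edge e) ≡ n → shift e ∈ G
        go zero    v≡ = contradiction eq (region-refuted (absent e ∷ []) is saturate h (v≡ ∷ []))
        go (suc n) v≡ = edge-∈ e (subst (1 ≤_) (sym v≡) (s≤s z≤n))

  module _ {ℓ n : ℕ} {G : List Chord} (1≤n : 1 ≤ n) (cl : Closed ℓ (2 + n) G) (new : ¬ (0 , suc n) ∈ G) where
    open Closed cl

    private
      below : ∀ {e} → e ∈ (0 , suc n) ∷ G → proj₂ e ≤ suc n
      below (here refl) = ≤-refl
      below (there e∈)  = ≤-pred (proj₂ (spans e∈))

      uncrossed : ∀ {e} → e ∈ (0 , suc n) ∷ G → ¬ Cross e (0 , suc n)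
      uncrossed e∈ (inj₁ (() , _))
      uncrossed e∈ (inj₂ (_ , _ , n<b)) = <⇒≱ n<b (below e∈)

      uncrossed′ : ∀ {e} → e ∈ G → ¬ Cross (0 , suc n) e
      uncrossed′ e∈ (inj₁ (_ , _ , n<b)) = <⇒≱ n<b (below (there e∈))
      uncrossed′ e∈ (inj₂ (() , _))

    closed-side : Closed ℓ (2 + n) ((0 , suc n) ∷ G)
    closed-side = record
      { spans  = λ where (here refl) → s≤s 1≤n , ≤-refl
                         (there e∈)  → spans e∈
      ; unique = All.tabulate (λ e∈ eq → new (subst (_∈ G) (sym eq) e∈)) ∷ unique
      ; capped = λ where
          (here refl) → ≤-trans (≤-reflexive (cong₂ _+_ (ind-0 (cross? (0 , suc n) (0 , suc n)) (uncrossed (here refl)))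
                                  (∑-0 G λ {f} f∈ → ind-0 (cross? (0 , suc n) f) (uncrossed′ f∈)))) z≤n
          {e} (there e∈)  → ≤-trans (≤-reflexive (cong (_+ crossings G e) (ind-0 (cross? e (0 , suc n)) (uncrossed (there e∈))))) (capped e∈)
      }

  module Induct {ℓ : ℕ} {g : ℕ → ℕ} (T : ℕ) (1≤T : 1 ≤ T)
    (super : ∀ s r → g s + g r ≤ g (s + r))
    (base : ∀ m → m ∸ 2 < T → length (pairs m) ≤ g (m ∸ 2))
    (impossible : ∀ {m G} (cl : Closed ℓ m G) (IH : ∀ {m′} → m′ < m → Bounded ℓ g m′) (big : g (m ∸ 2) < length G)
       A t → T ≤ t → (d∈ : (A , suc (A + t)) ∈ G) →
       (∀ {x y} → (x , y) ∈ G → A ≤ x → y ≤ suc (A + t) → (x , y) ≢ (A , suc (A + t)) → y ≤ T + x) → ⊥)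
    where

    -- Adding the closing side preserves a counterexample and provides the long chord from which the
    -- descent starts.
    with-side : ∀ {n G} → 1 ≤ n → Closed ℓ (2 + n) G →
                ∃ λ G′ → Closed ℓ (2 + n) G′ × (0 , suc n) ∈ G′ × length G ≤ length G′
    with-side {n} {G} 1≤n cl with any? (λ e → (0 , suc n) ≟ᶜ e) G
    ... | yes p = G , cl , p , ≤-refl
    ... | no ¬p = (0 , suc n) ∷ G , closed-side 1≤n cl ¬p , here refl , n≤1+n _

    module _ {m G} (cl : Closed ℓ m G) (IH : ∀ {m′} → m′ < m → Bounded ℓ g m′) (big : g (m ∸ 2) < length G) where
      open Closed cl

      descend : ∀ A t → Acc _<_ t → T ≤ t → (A , suc (A + t)) ∈ G → ⊥
      descend A t (acc rs) T≤t d∈ with any? (λ e → within? A (suc (A + t)) e ×-dec ¬? (e ≟ᶜ (A , suc (A + t))) ×-dec ¬? (proj₂ e ≤? T + proj₁ e)) G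
      ... | no none = impossible cl IH big A t T≤t d∈ short
        where
        short : ∀ {x y} → (x , y) ∈ G → A ≤ x → y ≤ suc (A + t) → (x , y) ≢ (A , suc (A + t)) → y ≤ T + x
        short {x} {y} e∈ A≤x y≤ ne with y ≤? T + x
        ... | yes p = p
        ... | no ¬p = contradiction (lose e∈ ((A≤x , y≤) , ne , ¬p)) none
      ... | yes some with (x , y) , e∈ , (A≤x , y≤) , ne , ¬p ← find some with u , refl ← m≤n⇒∃[o]m+o≡n (≤-trans (s≤s (m≤n+m x T)) (≰⇒> ¬p)) =
        descend x u (rs u<t) (+-cancelˡ-≤ x T u (≤-trans (≤-reflexive (+-comm x T)) (≤-pred (≰⇒> ¬p)))) e∈
        where
        x+u≤ : x + u ≤ A + t
        x+u≤ = ≤-pred y≤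
        u<t : u < t
        u<t with m≤n⇒m<n∨m≡n A≤x
        ... | inj₁ A<x = +-cancelˡ-< A u t (<-≤-trans (+-monoˡ-< u A<x) x+u≤)
        ... | inj₂ refl = ≤∧≢⇒< (+-cancelˡ-≤ A u t x+u≤) λ where refl → ne refl

    bounded : ∀ m → Bounded ℓ g m
    bounded = <-rec (Bounded ℓ g) step
      where
      step : ∀ m → (∀ {m′} → m′ < m → Bounded ℓ g m′) → Bounded ℓ g m
      step m IH G cl with m ∸ 2 <? T
      ... | yes small = ≤-trans (closed⇒length≤pairs cl) (base m small)
      step (suc (suc n)) IH G cl | no large with length G ≤? g n
      ... | yes p = p
      ... | no ¬p = let G′ , cl′ , d∈ , G≤G′ = with-side (≤-trans 1≤T (≮⇒≥ large)) cl in
        ⊥-elim (descend cl′ IH (<-≤-trans (≰⇒> ¬p) G≤G′) 0 n (<-wellFounded n) (≮⇒≥ large) d∈)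
      step zero       IH G cl | no large = contradiction 1≤T large
      step (suc zero) IH G cl | no large = contradiction 1≤T large

  -- Extremal sizes

  -- On n ≥ 2 vertices the largest size of a closed set of chords crossed at most ℓ
  -- times is gapₗ (n - 2), except that gap₄ 1 and gap₄ 2 are too large by one, which
  -- makes gap₄ periodic and superadditive.

  gap₀ : ℕ → ℕ
  gap₀ t = t

  gap₁ : ℕ → ℕ
  gap₁ 0 = 0
  gap₁ 1 = 1
  gap₁ (suc (suc t)) = 3 + gap₁ t

  gap₂ : ℕ → ℕ
  gap₂ 0 = 0
  gap₂ 1 = 1
  gap₂ 2 = 3
  gap₂ (suc (suc (suc t))) = 6 + gap₂ t

  gap₃ : ℕ → ℕ
  gap₃ 0 = 0
  gap₃ 1 = 1
  gap₃ 2 = 3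
  gap₃ 3 = 6
  gap₃ (suc (suc (suc (suc t)))) = 9 + gap₃ t

  gap₄ : ℕ → ℕ
  gap₄ 0 = 0
  gap₄ 1 = 2
  gap₄ 2 = 4
  gap₄ 3 = 6
  gap₄ (suc (suc (suc (suc t)))) = 10 + gap₄ t

  super₀ : ∀ s r → gap₀ s + gap₀ r ≤ gap₀ (s + r)
  super₀ s r = ≤-refl

  super₁ : ∀ s r → gap₁ s + gap₁ r ≤ gap₁ (s + r)
  super₁ (suc (suc s)) r = +-monoʳ-≤ 3 (super₁ s r)
  super₁ 0 0 = ≤ᵇ⇒≤ _ _ _
  super₁ 0 1 = ≤ᵇ⇒≤ _ _ _
  super₁ 0 (suc (suc r)) = +-monoʳ-≤ 3 (super₁ 0 r)
  super₁ 1 0 = ≤ᵇ⇒≤ _ _ _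
  super₁ 1 1 = ≤ᵇ⇒≤ _ _ _
  super₁ 1 (suc (suc r)) = +-monoʳ-≤ 3 (super₁ 1 r)

  super₂ : ∀ s r → gap₂ s + gap₂ r ≤ gap₂ (s + r)
  super₂ (suc (suc (suc s))) r = +-monoʳ-≤ 6 (super₂ s r)
  super₂ 0 0 = ≤ᵇ⇒≤ _ _ _
  super₂ 0 1 = ≤ᵇ⇒≤ _ _ _
  super₂ 0 2 = ≤ᵇ⇒≤ _ _ _
  super₂ 0 (suc (suc (suc r))) = +-monoʳ-≤ 6 (super₂ 0 r)
  super₂ 1 0 = ≤ᵇ⇒≤ _ _ _
  super₂ 1 1 = ≤ᵇ⇒≤ _ _ _
  super₂ 1 2 = ≤ᵇ⇒≤ _ _ _
  super₂ 1 (suc (suc (suc r))) = +-monoʳ-≤ 6 (super₂ 1 r)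
  super₂ 2 0 = ≤ᵇ⇒≤ _ _ _
  super₂ 2 1 = ≤ᵇ⇒≤ _ _ _
  super₂ 2 2 = ≤ᵇ⇒≤ _ _ _
  super₂ 2 (suc (suc (suc r))) = +-monoʳ-≤ 6 (super₂ 2 r)

  super₃ : ∀ s r → gap₃ s + gap₃ r ≤ gap₃ (s + r)
  super₃ (suc (suc (suc (suc s)))) r = +-monoʳ-≤ 9 (super₃ s r)
  super₃ 0 0 = ≤ᵇ⇒≤ _ _ _
  super₃ 0 1 = ≤ᵇ⇒≤ _ _ _
  super₃ 0 2 = ≤ᵇ⇒≤ _ _ _
  super₃ 0 3 = ≤ᵇ⇒≤ _ _ _
  super₃ 0 (suc (suc (suc (suc r)))) = +-monoʳ-≤ 9 (super₃ 0 r)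
  super₃ 1 0 = ≤ᵇ⇒≤ _ _ _
  super₃ 1 1 = ≤ᵇ⇒≤ _ _ _
  super₃ 1 2 = ≤ᵇ⇒≤ _ _ _
  super₃ 1 3 = ≤ᵇ⇒≤ _ _ _
  super₃ 1 (suc (suc (suc (suc r)))) = +-monoʳ-≤ 9 (super₃ 1 r)
  super₃ 2 0 = ≤ᵇ⇒≤ _ _ _
  super₃ 2 1 = ≤ᵇ⇒≤ _ _ _
  super₃ 2 2 = ≤ᵇ⇒≤ _ _ _
  super₃ 2 3 = ≤ᵇ⇒≤ _ _ _
  super₃ 2 (suc (suc (suc (suc r)))) = +-monoʳ-≤ 9 (super₃ 2 r)
  super₃ 3 0 = ≤ᵇ⇒≤ _ _ _
  super₃ 3 1 = ≤ᵇ⇒≤ _ _ _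
  super₃ 3 2 = ≤ᵇ⇒≤ _ _ _
  super₃ 3 3 = ≤ᵇ⇒≤ _ _ _
  super₃ 3 (suc (suc (suc (suc r)))) = +-monoʳ-≤ 9 (super₃ 3 r)

  super₄ : ∀ s r → gap₄ s + gap₄ r ≤ gap₄ (s + r)
  super₄ (suc (suc (suc (suc s)))) r = +-monoʳ-≤ 10 (super₄ s r)
  super₄ 0 0 = ≤ᵇ⇒≤ _ _ _
  super₄ 0 1 = ≤ᵇ⇒≤ _ _ _
  super₄ 0 2 = ≤ᵇ⇒≤ _ _ _
  super₄ 0 3 = ≤ᵇ⇒≤ _ _ _
  super₄ 0 (suc (suc (suc (suc r)))) = +-monoʳ-≤ 10 (super₄ 0 r)
  super₄ 1 0 = ≤ᵇ⇒≤ _ _ _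
  super₄ 1 1 = ≤ᵇ⇒≤ _ _ _
  super₄ 1 2 = ≤ᵇ⇒≤ _ _ _
  super₄ 1 3 = ≤ᵇ⇒≤ _ _ _
  super₄ 1 (suc (suc (suc (suc r)))) = +-monoʳ-≤ 10 (super₄ 1 r)
  super₄ 2 0 = ≤ᵇ⇒≤ _ _ _
  super₄ 2 1 = ≤ᵇ⇒≤ _ _ _
  super₄ 2 2 = ≤ᵇ⇒≤ _ _ _
  super₄ 2 3 = ≤ᵇ⇒≤ _ _ _
  super₄ 2 (suc (suc (suc (suc r)))) = +-monoʳ-≤ 10 (super₄ 2 r)
  super₄ 3 0 = ≤ᵇ⇒≤ _ _ _
  super₄ 3 1 = ≤ᵇ⇒≤ _ _ _
  super₄ 3 2 = ≤ᵇ⇒≤ _ _ _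
  super₄ 3 3 = ≤ᵇ⇒≤ _ _ _
  super₄ 3 (suc (suc (suc (suc r)))) = +-monoʳ-≤ 10 (super₄ 3 r)

  up : ∀ {P : ℕ → Set} {a n} → All (λ i → P (a + i)) (upTo n) → ∀ t → a ≤ t → t < a + n → P t
  up {P} {a} {n} ps t a≤t t< with i , refl ← m≤n⇒∃[o]m+o≡n a≤t = All.lookup ps (∈-upTo⁺ (+-cancelˡ-< a i n t<))

  -- A set of chords on p vertices that span at most T sides has at most table p
  -- elements for p ≤ P₀, and D times its size is at most N p - κ for all p ≥ 2, which
  -- is shown by looking at the first S vertices.  By the linear bound no interval with
  -- more than last inner vertices has to be searched.
  module Scheme (ℓ T N D κ S P₀ last : ℕ) .{{_ : NonZero D}} (g table : ℕ → ℕ) where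

    H : ℕ → ℕ
    H p = if p ≤ᵇ P₀ then table p else (N * p ∸ κ) / D

    H-table : ∀ {p} → p ≤ P₀ → H p ≡ table p
    H-table {p} p≤ with p ≤ᵇ P₀ | ≤⇒≤ᵇ p≤
    ... | true | _ = refl

    H-linear : ∀ {p} → P₀ < p → H p ≡ (N * p ∸ κ) / D
    H-linear {p} <p with p ≤ᵇ P₀ | ≤ᵇ⇒≤ p P₀
    ... | false | _ = refl
    ... | true  | h = contradiction (h _) (<⇒≱ <p)

    Exceeds : ℕ → Set
    Exceeds t = N * (2 + t) + D * ℓ < D * g t + κ

    module Chains
      (T≤P₀  : suc T ≤ P₀) (S≤P₀ : S + 2 ≤ suc P₀) (2≤S : 2 ≤ S)
      (small : All (λ p → length (pairs p) ≤ table p) (upTo (2 + T)))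
      (exact : All (λ i → Specs.refutesChain (λ _ → 0) H ℓ T (T + i) ≡ true) (upTo (P₀ ∸ suc T)))
      (begin-linear : All (λ i → D * table (2 + i) + κ ≤ N * (2 + i)) (upTo (P₀ ∸ 1)))
      (steep! : Steep.refutesSteep N D ℓ T S ≡ true)
      where
      open Linear {ℓ} {T} {H} N D κ S

      short-chain : ∀ p → p ≤ P₀ → ChainBounded ℓ T H p
      short-chain = <-rec (λ p → p ≤ P₀ → ChainBounded ℓ T H p) step
        where
        step : ∀ p → (∀ {q} → q < p → q ≤ P₀ → ChainBounded ℓ T H q) → p ≤ P₀ → ChainBounded ℓ T H p
        step p rec p≤ with p <? 2 + T
        ... | yes p< = λ G cl _ → ≤-trans (closed⇒length≤pairs cl) (≤-trans (All.lookup small (∈-upTo⁺ p<)) (≤-reflexive (sym (H-table p≤))))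
        ... | no  p≮ with t , refl ← m≤n⇒∃[o]m+o≡n (≮⇒≥ p≮) =
          exact-chain (T + t) (m≤m+n T t) (All.lookup exact (∈-upTo⁺ (+-cancelˡ-< (suc T) t _ (subst (suc T + t <_) (sym (m+[n∸m]≡n T≤P₀)) p≤))))
            λ q< → rec q< (≤-trans (<⇒≤ q<) p≤)

      linear : ∀ p → 2 ≤ p → LinearBound p
      linear = <-rec (λ p → 2 ≤ p → LinearBound p) step
        where
        step : ∀ p → (∀ {q} → q < p → 2 ≤ q → LinearBound q) → 2 ≤ p → LinearBound p
        step p rec 2≤p with p ≤? P₀
        ... | yes p≤ = λ G cl sp → ≤-trans (+-monoˡ-≤ κ (*-monoʳ-≤ D (≤-trans (short-chain p p≤ G cl sp) (≤-reflexive (H-table p≤)))))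
                (up {λ p → D * table p + κ ≤ N * p} begin-linear p 2≤p (≤-trans (s≤s p≤) (≤-reflexive (cong suc (sym (m+[n∸m]≡n (≤-trans (s≤s z≤n) T≤P₀)))))))
        ... | no p≰ = steep-chain p (≤-trans S≤P₀ (≰⇒> p≰)) 2≤S steep! λ 2≤q q<p → rec q<p 2≤q

      chain≤ : ∀ p → ChainBounded ℓ T H p
      chain≤ p with p ≤? P₀
      ... | yes p≤ = short-chain p p≤
      ... | no p≰ = λ G cl sp → ≤-trans (≤-trans (≤-reflexive (sym (m*n/n≡m (length G) D))) (/-monoˡ-≤ D (m+n≤o⇒m≤o∸n _
              (≤-trans (≤-reflexive (cong (_+ κ) (*-comm (length G) D))) (linear p (≤-trans (s≤s (≤-trans (s≤s z≤n) T≤P₀)) (≰⇒> p≰)) G cl sp)))))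
              (≤-reflexive (sym (H-linear (≰⇒> p≰))))

      module Result (is : ℕ → List (ℕ × ℕ)) (saturate : ℕ → Bool) (extra : ∀ t → List (Model.Spec ℓ T t))
        (1≤T : 1 ≤ T) (T≤last : T ≤ suc last)
        (super : ∀ s r → g s + g r ≤ g (s + r))
        (saturable : ∀ t → saturate t ≡ true → 2 ≤ ℓ × (∀ t x y → g t + 2 + g x + g y ≤ g (suc (t + x + y))))
        (extra-holds : ∀ {m G} (cl : Closed ℓ m G) (IH : ∀ {m′} → m′ < m → Bounded ℓ g m′) (big : g (m ∸ 2) < length G)
           A t (1≤t : 1 ≤ t) (d∈ : (A , suc (A + t)) ∈ G)
           (short : ∀ {x y} → (x , y) ∈ G → A ≤ x → y ≤ suc (A + t) → (x , y) ≢ (A , suc (A + t)) → y ≤ T + x) →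
           All (Interval.⟦_⟧ {g = g} cl IH super big A t T 1≤t d∈ short) (extra t))
        (base : All (λ m → length (pairs m) ≤ g (m ∸ 2)) (upTo (2 + T)))
        (regions : ∀ t → T ≤ t → t ≤ last → Specs.refutesRegion g H ℓ T t (extra t) (is t) (saturate t) ≡ true)
        (period : ℕ) (per-period : ℕ) (1≤period : 1 ≤ period)
        (periodic : ∀ t → g (period + t) ≡ per-period + g t)
        (growth : N * period ≤ D * per-period)
        (first-period : All (λ i → Exceeds (suc last + i)) (upTo period))
        where

        -- One more period adds `N * period` on the left and at least as much on the right, so
        -- checking a single period beyond `last` is enough.
        exceeds : ∀ u → Exceeds (suc last + u)
        exceeds = <-rec (λ u → Exceeds (suc last + u)) step
          where
          step : ∀ u → (∀ {v} → v < u → Exceeds (suc last + v)) → Exceeds (suc last + u)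
          step u rec with u <? period
          ... | yes u< = All.lookup first-period (∈-upTo⁺ u<)
          ... | no u≮ with v , refl ← m≤n⇒∃[o]m+o≡n (≮⇒≥ u≮) = subst Exceeds eq (begin-strict
            N * (2 + (period + t)) + D * ℓ          ≡⟨ cong (λ z → N * z + D * ℓ) (trans (sym (+-assoc 2 period t)) (trans (cong (_+ t) (+-comm 2 period)) (+-assoc period 2 t))) ⟩
            N * (period + (2 + t)) + D * ℓ          ≡⟨ cong (_+ D * ℓ) (*-distribˡ-+ N period (2 + t)) ⟩
            N * period + N * (2 + t) + D * ℓ        ≡⟨ +-assoc (N * period) _ _ ⟩
            N * period + (N * (2 + t) + D * ℓ)      <⟨ +-mono-≤-< growth (rec (m<n+m v 1≤period)) ⟩
            D * per-period + (D * g t + κ)          ≡⟨ +-assoc (D * per-period) _ κ ⟨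
            D * per-period + D * g t + κ            ≡⟨ cong (_+ κ) (*-distribˡ-+ D per-period (g t)) ⟨
            D * (per-period + g t) + κ              ≡⟨ cong (λ z → D * z + κ) (periodic t) ⟨
            D * g (period + t) + κ                  ∎)
            where
            open ≤-Reasoning
            t = suc last + v
            eq : period + t ≡ suc last + (period + v)
            eq = trans (sym (+-assoc period (suc last) v)) (trans (cong (_+ v) (+-comm period (suc last))) (+-assoc (suc last) period v))

        impossible : ∀ {m G} (cl : Closed ℓ m G) (IH : ∀ {m′} → m′ < m → Bounded ℓ g m′) (big : g (m ∸ 2) < length G)
          A t → T ≤ t → (d∈ : (A , suc (A + t)) ∈ G) →
          (∀ {x y} → (x , y) ∈ G → A ≤ x → y ≤ suc (A + t) → (x , y) ≢ (A , suc (A + t)) → y ≤ T + x) → ⊥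
        impossible cl IH big A t T≤t d∈ short with t ≤? last
        ... | yes t≤ = Interval.region-refuted {g = g} cl IH super big A t T 1≤t d∈ short chain≤ (extra t) (is t) (saturate t)
                (saturable t) (extra-holds cl IH big A t 1≤t d∈ short) (regions t T≤t t≤)
          where
          1≤t = ≤-trans 1≤T T≤t
        ... | no t≰ with u , refl ← m≤n⇒∃[o]m+o≡n (≰⇒> t≰) =
          <⇒≱ (exceeds u) (Interval.linear-bound {g = g} cl IH super big A t T (≤-trans 1≤T T≤t) d∈ short N D κ (linear (2 + t) (s≤s (s≤s z≤n))))

        result : ∀ m → Bounded ℓ g m
        result = Induct.bounded {g = g} T 1≤T super (λ m m< → All.lookup base (∈-upTo⁺ (m≤small m m<))) impossible
          where
          m≤small : ∀ m → m ∸ 2 < T → m < 2 + T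
          m≤small zero          _  = s≤s z≤n
          m≤small (suc zero)    _  = s≤s (s≤s z≤n)
          m≤small (suc (suc m)) m< = s≤s (s≤s m<)

  pair-count : ℕ → ℕ
  pair-count p = length (pairs p)

  -- Up to `ℓ + 2` vertices all pairs at distance at least two are short and are simply counted. The
  -- listed values start at `ℓ + 3` vertices, where the length restriction and the caps take effect.
  table₁ table₂ table₃ table₄ : ℕ → ℕ
  table₁ 4 = 2
  table₁ p = pair-count p
  table₂ 5 = 5
  table₂ p = pair-count p
  table₃ 6 = 8
  table₃ p = pair-count p
  table₄ 7 = 11
  table₄ 8 = 12
  table₄ 9 = 14
  table₄ 10 = 17
  table₄ p = pair-count p

  everyInterval : ℕ → List (ℕ × ℕ)
  everyInterval t = cartesianProduct (upTo t) (upTo (suc t))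

  ≤-check : ∀ {f g : ℕ → ℕ} {xs} {_ : True (all? (λ i → f i ≤? g i) xs)} → All (λ i → f i ≤ g i) xs
  ≤-check {_} {_} {_} {p} = toWitness p

  -- With `T = 1` there are no short chords at all, so the linear bound excludes every nonempty
  -- interval and nothing has to be searched.
  bounded₀ : ∀ m → Bounded 0 gap₀ m
  bounded₀ = Result.result everyInterval (λ _ → false) (λ _ → []) (s≤s z≤n) (s≤s z≤n) super₀ (λ _ ())
    (λ _ _ _ _ _ _ _ _ → []) ≤-check (λ t 1≤t t≤0 → contradiction t≤0 (<⇒≱ 1≤t))
    1 1 (s≤s z≤n) (λ _ → refl) z≤n ≤-check
    where
    open Scheme 0 1 0 1 0 2 3 0 gap₀ (λ _ → 0)
    open Chains (s≤s (s≤s z≤n)) ≤-refl ≤-refl ≤-check (refl ∷ []) ≤-check refl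

  -- Here and in the next bounds `last` is the largest `t` for which `Exceeds t` fails, that is,
  -- which the linear bound does not exclude.
  bounded₁ : ∀ m → Bounded 1 gap₁ m
  bounded₁ = Result.result everyInterval (λ _ → false) (λ _ → []) (s≤s z≤n) (s≤s (s≤s z≤n)) super₁ (λ _ ())
    (λ _ _ _ _ _ _ _ _ → []) ≤-check (λ t 2≤t t≤3 → up {P} (refl ∷ refl ∷ []) t 2≤t (s≤s t≤3))
    2 3 (s≤s z≤n) (λ _ → refl) (≤ᵇ⇒≤ _ _ _) ≤-check
    where
    open Scheme 1 2 1 1 2 2 4 3 gap₁ table₁
    open Chains (≤ᵇ⇒≤ _ _ _) (≤ᵇ⇒≤ _ _ _) ≤-refl ≤-check (refl ∷ []) ≤-check refl
    P : ℕ → Set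
    P t = Specs.refutesRegion gap₁ H 1 2 t [] (everyInterval t) false ≡ true

  bounded₂ : ∀ m → Bounded 2 gap₂ m
  bounded₂ = Result.result everyInterval (λ _ → false) (λ _ → []) (s≤s z≤n) (≤ᵇ⇒≤ _ _ _) super₂ (λ _ ())
    (λ _ _ _ _ _ _ _ _ → []) ≤-check (λ t 3≤t t≤7 → up {P} (refl ∷ refl ∷ refl ∷ refl ∷ refl ∷ []) t 3≤t (s≤s t≤7))
    3 6 (s≤s z≤n) (λ _ → refl) (≤ᵇ⇒≤ _ _ _) ≤-check
    where
    open Scheme 2 3 3 2 5 4 5 7 gap₂ table₂
    open Chains (≤ᵇ⇒≤ _ _ _) (≤ᵇ⇒≤ _ _ _) (≤ᵇ⇒≤ _ _ _) ≤-check (refl ∷ []) ≤-check refl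
    P : ℕ → Set
    P t = Specs.refutesRegion gap₂ H 2 3 t [] (everyInterval t) false ≡ true

  bounded₃ : ∀ m → Bounded 3 gap₃ m
  bounded₃ = Result.result everyInterval (λ _ → false) (λ _ → []) (s≤s z≤n) (≤ᵇ⇒≤ _ _ _) super₃ (λ _ ())
    (λ _ _ _ _ _ _ _ _ → []) ≤-check (λ t 4≤t t≤10 → up {P} (refl ∷ refl ∷ refl ∷ refl ∷ refl ∷ refl ∷ refl ∷ []) t 4≤t (s≤s t≤10))
    4 9 (s≤s z≤n) (λ _ → refl) (≤ᵇ⇒≤ _ _ _) ≤-check
    where
    open Scheme 3 4 7 4 10 5 6 10 gap₃ table₃
    open Chains (≤ᵇ⇒≤ _ _ _) (≤ᵇ⇒≤ _ _ _) (≤ᵇ⇒≤ _ _ _) ≤-check (refl ∷ []) ≤-check refl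
    P : ℕ → Set
    P t = Specs.refutesRegion gap₃ H 3 4 t [] (everyInterval t) false ≡ true

  -- The summand 2 is `gap₄ 1`, so superadditivity suffices. With the true size 1 for one inner
  -- vertex the inequality would already fail at `t = x = y = 0`.
  split₄ : ∀ t x y → gap₄ t + 2 + gap₄ x + gap₄ y ≤ gap₄ (suc (t + x + y))
  split₄ t x y = begin
    gap₄ t + 2 + gap₄ x + gap₄ y     ≡⟨ cong (λ z → z + gap₄ x + gap₄ y) (+-comm (gap₄ t) 2) ⟩
    2 + (gap₄ t + gap₄ x + gap₄ y)   ≤⟨ +-monoʳ-≤ 2 (+-monoˡ-≤ (gap₄ y) (super₄ t x)) ⟩
    2 + (gap₄ (t + x) + gap₄ y)      ≤⟨ +-monoʳ-≤ 2 (super₄ (t + x) y) ⟩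
    2 + gap₄ (t + x + y)             ≤⟨ super₄ 1 (t + x + y) ⟩
    gap₄ (suc (t + x + y))           ∎
    where open ≤-Reasoning

  -- A chord of a smallest counterexample cutting off four vertices occurs together
  -- with the four chords below it that cut off one vertex.
  hexagon : ∀ t → ℕ → ℕ → Model.Spec 4 5 t
  hexagon t i a = implies (a , a + 5) (a + i , a + (i + 2))
    where open Model 4 5 t

  hexagons : ∀ t → List (Model.Spec 4 5 t)
  hexagons t = cartesianProductWith (hexagon t) (upTo 4) (upTo (t ∸ 3))

  -- A choice of intervals that suffices for a contradiction and keeps the search short.
  intervals : ℕ → List (ℕ × ℕ)
  intervals 5 = (0 , 4) ∷ (1 , 4) ∷ (0 , 1) ∷ (1 , 1) ∷ (2 , 1) ∷ (3 , 1) ∷ (4 , 1) ∷ (0 , 2) ∷ (1 , 2) ∷ (0 , 3) ∷ []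
  intervals 6 = (0 , 4) ∷ (1 , 4) ∷ (2 , 4) ∷ (0 , 5) ∷ (1 , 5) ∷ (0 , 1) ∷ (1 , 1) ∷ (2 , 1) ∷ (3 , 1) ∷ (4 , 1) ∷ (5 , 1) ∷
                (0 , 2) ∷ (1 , 2) ∷ (0 , 3) ∷ []
  intervals 7 = (0 , 4) ∷ (3 , 4) ∷ (0 , 5) ∷ (1 , 5) ∷ (2 , 5) ∷ (0 , 6) ∷ (1 , 6) ∷ (0 , 1) ∷ (1 , 1) ∷ (5 , 1) ∷ (6 , 1) ∷
                (0 , 2) ∷ (0 , 3) ∷ (4 , 3) ∷ []
  intervals 8 = (0 , 4) ∷ (4 , 4) ∷ (0 , 3) ∷ (1 , 7) ∷ []
  intervals 9 = (0 , 4) ∷ (0 , 1) ∷ (5 , 4) ∷ (1 , 8) ∷ []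
  intervals 10 = (0 , 4) ∷ (1 , 4) ∷ (0 , 5) ∷ (0 , 1) ∷ (1 , 1) ∷ []
  intervals 11 = (0 , 4) ∷ (0 , 5) ∷ (0 , 1) ∷ []
  intervals 14 = (0 , 4) ∷ []
  intervals _ = []

  -- Below a chord of five sides all other chords span at most four, so its interval can be treated
  -- with `T = 4` and `t = 4`, and the number of all pairs serves as the bound for short chords.
  hexagon-refuted : All (λ i → Specs.refutesRegion gap₄ pair-count 4 4 4
    (Model.absent (i , i + 2) ∷ []) (everyInterval 4) true ≡ true) (upTo 4)
  hexagon-refuted = refl ∷ refl ∷ refl ∷ refl ∷ []

  module _ {m : ℕ} {G : List Chord} (cl : Closed 4 m G)
    (IH : ∀ {m′} → m′ < m → Bounded 4 gap₄ m′) (big : gap₄ (m ∸ 2) < length G)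
    (A t : ℕ) (1≤t : 1 ≤ t) (d∈ : (A , suc (A + t)) ∈ G)
    (short : ∀ {x y} → (x , y) ∈ G → A ≤ x → y ≤ suc (A + t) → (x , y) ≢ (A , suc (A + t)) → y ≤ 5 + x) where

    present : ∀ i → i ∈ upTo 4 → ∀ a → (A + a , A + (a + 5)) ∈ G → (A + (a + i) , A + (a + (i + 2))) ∈ G
    present i i∈ a c∈ = subst₂ (λ u v → (u , v) ∈ G) (+-assoc A a i) (+-assoc A a (i + 2))
      (Interval.forced {g = gap₄} cl IH super₄ big (A + a) 4 4 (s≤s z≤n) d′∈ short′
        (λ p G′ cl′ _ → closed⇒length≤pairs cl′) (i , i + 2) (everyInterval 4) true (λ _ → s≤s (s≤s z≤n) , split₄)
        (All.lookup hexagon-refuted i∈))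
      where
      d′∈ : (A + a , suc (A + a + 4)) ∈ G
      d′∈ = subst (λ z → (A + a , z) ∈ G) (trans (sym (+-assoc A a 5)) (+-suc (A + a) 4)) c∈
      short′ : ∀ {x y} → (x , y) ∈ G → A + a ≤ x → y ≤ suc (A + a + 4) → (x , y) ≢ (A + a , suc (A + a + 4)) → y ≤ 4 + x
      short′ {x} {y} _ a≤x y≤ ne with y ≤? 4 + x
      ... | yes p = p
      ... | no ¬p = contradiction (cong₂ _,_ x≡ (≤-antisym y≤ (≤-trans (≤-reflexive (trans (sym (+-suc (A + a) 4)) (trans (+-comm (A + a) 5) (cong (5 +_) (sym x≡))))) (≰⇒> ¬p)))) ne
        where
        x≡ : x ≡ A + a
        x≡ = ≤-antisym (+-cancelˡ-≤ 5 _ _ (≤-trans (≰⇒> ¬p) (≤-trans y≤ (≤-reflexive (trans (sym (+-suc (A + a) 4)) (+-comm (A + a) 5)))))) a≤x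

    hexagons-hold : All (Interval.⟦_⟧ {g = gap₄} cl IH super₄ big A t 5 1≤t d∈ short) (hexagons t)
    hexagons-hold = All.tabulate λ s∈ → case ∈-cartesianProductWith⁻ (hexagon t) (upTo 4) (upTo (t ∸ 3)) s∈ of λ where
      (i , a , i∈ , a∈ , refl) → Interval.implies-∈ {g = gap₄} cl IH super₄ big A t 5 1≤t d∈ short
        (a , a + 5) (a + i , a + (i + 2)) (present i i∈ a)

  bounded₄ : ∀ m → Bounded 4 gap₄ m
  bounded₄ = Result.result intervals (_≤ᵇ 7) hexagons (s≤s z≤n) (≤ᵇ⇒≤ _ _ _) super₄ (λ _ _ → s≤s (s≤s z≤n) , split₄)
    hexagons-hold ≤-check
    (λ t 5≤t t≤15 → up {P} (refl ∷ refl ∷ refl ∷ refl ∷ refl ∷ refl ∷ refl ∷ refl ∷ refl ∷ refl ∷ refl ∷ []) t 5≤t (s≤s t≤15))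
    4 10 (s≤s z≤n) (λ _ → refl) (≤ᵇ⇒≤ _ _ _) ≤-check
    where
    open Scheme 4 5 2 1 2 6 10 15 gap₄ table₄
    open Chains (≤ᵇ⇒≤ _ _ _) (≤ᵇ⇒≤ _ _ _) (≤ᵇ⇒≤ _ _ _) ≤-check (refl ∷ refl ∷ refl ∷ refl ∷ []) ≤-check refl
    P : ℕ → Set
    P t = Specs.refutesRegion gap₄ H 4 5 t (hexagons t) (intervals t) (t ≤ᵇ 7) ≡ true

  -- Extremal sets

  IsClosed : ℕ → ℕ → List Chord → Set
  IsClosed ℓ m G = All (λ (a , b) → 2 + a ≤ b × b < m) G × Unique G × All (λ e → crossings G e ≤ ℓ) G

  isClosed? : ∀ ℓ m G → Dec (IsClosed ℓ m G)
  isClosed? ℓ m G = all? (λ (a , b) → (2 + a ≤? b) ×-dec (b <? m)) G ×-dec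
    allPairs? (λ e f → ¬? (e ≟ᶜ f)) G ×-dec all? (λ e → crossings G e ≤? ℓ) G

  closed : ∀ {ℓ m G} → {True (isClosed? ℓ m G)} → Closed ℓ m G
  closed {G = G} {p} = let s , u , c = toWitness p in record
    { spans = λ e∈ → All.lookup s e∈ ; unique = u ; capped = λ e∈ → All.lookup c e∈ }

  -- Two closed sets are joined along the chord (0 , m-1) of the first, which
  -- becomes the side (0 , 1) of the second.
  module Glue {ℓ m p : ℕ} {G F : List Chord} (1≤m : 1 ≤ m)
              (clG : Closed ℓ (suc m) G) (clF : Closed ℓ (2 + p) F) where

    φ : ℕ → ℕ
    φ zero    = 0
    φ (suc i) = m + i

    φ-mono : ∀ {i j} → i < j → φ i < φ j
    φ-mono {zero}  {suc j} _         = ≤-trans 1≤m (m≤m+n m j)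
    φ-mono {suc i} {suc j} (s≤s i<j) = +-monoʳ-< m i<j

    F′ : List Chord
    F′ = map (relabel φ) (filter (λ e → 0 ≤? 0) F)

    glued : List Chord
    glued = G ++ F′

    fits : ∀ {a b} → (a , b) ∈ F → 0 ≤ 0 → 2 + φ a ≤ φ b × φ b < suc m + p
    fits {zero}  {suc b} ab∈ _ = let sp , b< = Closed.spans clF ab∈ in
      ≤-trans (s≤s 1≤m) (≤-trans (≤-reflexive (+-comm 1 m)) (+-monoʳ-≤ m (≤-pred sp))) , s≤s (+-monoʳ-≤ m (≤-pred (≤-pred b<)))
    fits {zero}  {zero}  ab∈ _ = contradiction (proj₁ (Closed.spans clF ab∈)) λ ()
    fits {suc a} {zero}  ab∈ _ = contradiction (proj₁ (Closed.spans clF ab∈)) λ ()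
    fits {suc a} {suc b} ab∈ _ = let sp , b< = Closed.spans clF ab∈ in
      ≤-trans (≤-reflexive (trans (cong suc (sym (+-suc m a))) (sym (+-suc m (suc a))))) (+-monoʳ-≤ m (≤-pred sp)) , s≤s (+-monoʳ-≤ m (≤-pred (≤-pred b<)))

    clF′ : Closed ℓ (suc m + p) F′
    clF′ = closed-relabel φ {V = λ _ → 0 ≤ 0} (λ _ _ → φ-mono) clF (λ _ → 0 ≤? 0) (λ _ _ → z≤n , z≤n) fits

    new : ∀ {a b} → (a , b) ∈ F′ → (a ≡ 0 ⊎ m ≤ a) × m < b
    new e∈ with ∈-map⁻ (relabel φ) e∈
    ... | (i , suc j) , ij∈ , refl with ij∈F , _ ← ∈-filter⁻ (λ _ → 0 ≤? 0) {xs = F} ij∈ =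
      start i , m<m+n m (≤-trans (s≤s z≤n) (≤-pred (proj₁ (Closed.spans clF ij∈F))))
      where
      start : ∀ i → φ i ≡ 0 ⊎ m ≤ φ i
      start zero    = inj₁ refl
      start (suc i) = inj₂ (m≤m+n m i)
    ... | (i , zero) , ij∈ , refl with ij∈F , _ ← ∈-filter⁻ (λ _ → 0 ≤? 0) {xs = F} ij∈ = contradiction (proj₁ (Closed.spans clF ij∈F)) λ ()

    old : ∀ {a b} → (a , b) ∈ G → b ≤ m
    old e∈ = ≤-pred (proj₂ (Closed.spans clG e∈))

    -- Old chords end at `m` or earlier, while new ones start at 0 or at `m` and beyond and end
    -- after `m`. A crossing would need a start strictly below an old chord.
    apart : ∀ {e f} → e ∈ G → f ∈ F′ → ¬ Cross e f
    apart e∈ f∈ (inj₁ (a<x , x<b , _)) with new f∈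
    ... | inj₁ refl , _ = contradiction a<x λ ()
    ... | inj₂ m≤x  , _ = <⇒≱ x<b (≤-trans (old e∈) m≤x)
    apart e∈ f∈ (inj₂ (_ , _ , y<b)) = <⇒≱ (<-trans (proj₂ (new f∈)) y<b) (old e∈)

    apart′ : ∀ {e f} → e ∈ F′ → f ∈ G → ¬ Cross e f
    apart′ e∈ f∈ (inj₁ p) = apart f∈ e∈ (inj₂ p)
    apart′ e∈ f∈ (inj₂ p) = apart f∈ e∈ (inj₁ p)

    closed-glued : Closed ℓ (suc m + p) glued
    closed-glued = record
      { spans  = λ e∈ → case ∈-++⁻ G e∈ of λ where
          (inj₁ e∈G) → let s , b< = Closed.spans clG e∈G in s , <-≤-trans b< (m≤m+n _ p)
          (inj₂ e∈F) → Closed.spans clF′ e∈F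
      ; unique = Unique.++⁺ (Closed.unique clG) (Closed.unique clF′) λ (e∈G , e∈F) → <⇒≱ (proj₂ (new e∈F)) (old e∈G)
      ; capped = λ {e} e∈ → ≤-trans (≤-reflexive (∑-++ _ G F′)) (case ∈-++⁻ G e∈ of λ where
          (inj₁ e∈G) → ≤-trans (≤-reflexive (trans (cong (crossings G e +_) (∑-0 F′ λ {f} f∈ → ind-0 (cross? e f) (apart e∈G f∈))) (+-identityʳ _))) (Closed.capped clG e∈G)
          (inj₂ e∈F) → ≤-trans (≤-reflexive (cong (_+ crossings F′ e) (∑-0 G λ {f} f∈ → ind-0 (cross? e f) (apart′ e∈F f∈)))) (Closed.capped clF′ e∈F))
      }

    length-glued : length glued ≡ length F + length G
    length-glued = trans (length-++ G) (trans (+-comm (length G) _) (cong (_+ length G)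
      (trans (length-map (relabel φ) (filter (λ _ → 0 ≤? 0) F)) (trans (length-filter≡count (λ _ → 0 ≤? 0) F) (trans (∑-const 1 F) (*-identityʳ _))))))

  Attained : ℕ → (ℕ → ℕ) → ℕ → Set
  Attained ℓ g t = ∃ λ G → Closed ℓ (2 + t) G × length G ≡ g t

  glue : ∀ {ℓ} g p {F} → {True (isClosed? ℓ (2 + p) F)} → ∀ {t} → Attained ℓ g t → g (p + t) ≡ length F + g t → Attained ℓ g (p + t)
  glue {ℓ} g p {F} {ok} {t} (G , cl , len) eq = glued , subst (λ n → Closed ℓ n glued) (cong (2 +_) (+-comm t p)) closed-glued ,
    trans length-glued (trans (cong (length F +_) len) (sym eq))
    where open Glue (s≤s z≤n) cl (closed {G = F} {ok})

  attained₀ : ∀ t → Attained 0 gap₀ t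
  attained₀ zero    = [] , closed , refl
  attained₀ (suc t) = glue gap₀ 1 {pairs 3} (attained₀ t) refl

  attained₁ : ∀ t → Attained 1 gap₁ t
  attained₁ 0             = [] , closed , refl
  attained₁ 1             = pairs 3 , closed , refl
  attained₁ (suc (suc t)) = glue gap₁ 2 {pairs 4} (attained₁ t) refl

  attained₂ : ∀ t → Attained 2 gap₂ t
  attained₂ 0                   = [] , closed , refl
  attained₂ 1                   = pairs 3 , closed , refl
  attained₂ 2                   = pairs 4 , closed , refl
  attained₂ (suc (suc (suc t))) = glue gap₂ 3 {pairs 5} (attained₂ t) refl

  -- In the full hexagon each of the three long diagonals is crossed four times, twice by the other
  -- long ones. Removing `(2 , 5)` leaves the other two with three crossings each.
  attained₃ : ∀ t → Attained 3 gap₃ t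
  attained₃ 0                         = [] , closed , refl
  attained₃ 1                         = pairs 3 , closed , refl
  attained₃ 2                         = pairs 4 , closed , refl
  attained₃ 3                         = pairs 5 , closed , refl
  attained₃ (suc (suc (suc (suc t)))) = glue gap₃ 4 {filter (λ e → ¬? (e ≟ᶜ (2 , 5))) (pairs 6)} (attained₃ t) refl

  -- The values `gap₄ 1` and `gap₄ 2` are not attained, so the residues 1 and 2 modulo 4 have to
  -- start at five and six inner vertices, with 12 and 14 chords.
  heptagon octagon : List Chord
  heptagon = (0 , 2) ∷ (0 , 3) ∷ (0 , 4) ∷ (0 , 5) ∷ (0 , 6) ∷ (1 , 3) ∷ (1 , 4) ∷ (1 , 5) ∷ (1 , 6) ∷ (2 , 4) ∷ (3 , 5) ∷ (4 , 6) ∷ []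
  octagon  = (0 , 2) ∷ (0 , 3) ∷ (0 , 5) ∷ (0 , 6) ∷ (0 , 7) ∷ (1 , 3) ∷ (1 , 4) ∷ (1 , 5) ∷ (1 , 7) ∷ (2 , 4) ∷ (3 , 5) ∷ (4 , 6) ∷ (4 , 7) ∷ (5 , 7) ∷ []

  attained₄ : ∀ t → Attained 4 gap₄ (3 + t)
  attained₄ 0 = pairs 5 , closed , refl
  attained₄ 1 = pairs 6 , closed , refl
  attained₄ 2 = heptagon , closed , refl
  attained₄ 3 = octagon , closed , refl
  attained₄ (suc (suc (suc (suc t)))) = glue gap₄ 4 {pairs 6} (attained₄ t) refl

  -- Edges of the complete graph

  open DecMembership _≟ᶜ_ using (_∈?_)

  chord : ∀ {n} → Edge n → Chord
  chord (i , j) = toℕ i , toℕ j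

  chord-injective : ∀ {n} {d d′ : Edge n} → chord d ≡ chord d′ → d ≡ d′
  chord-injective eq = cong₂ _,_ (Fin.toℕ-injective (cong proj₁ eq)) (Fin.toℕ-injective (cong proj₂ eq))

  module _ {a} {A : Set a} where

    sublists-⊆ : ∀ (xs : List A) {ys} → ys ∈ sublists xs → ∀ {y} → y ∈ ys → y ∈ xs
    sublists-⊆ []       (here refl) ()
    sublists-⊆ (x ∷ xs) ys∈ y∈ with ∈-++⁻ (sublists xs) ys∈
    ... | inj₁ p = there (sublists-⊆ xs p y∈)
    ... | inj₂ p with zs , zs∈ , refl ← ∈-map⁻ (x ∷_) p with y∈
    ...   | here refl = here refl
    ...   | there y∈′ = there (sublists-⊆ xs zs∈ y∈′)

    sublists-unique : ∀ (xs : List A) {ys} → Unique xs → ys ∈ sublists xs → Unique ys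
    sublists-unique []       _         (here refl) = []
    sublists-unique (x ∷ xs) (x∉ ∷ u) ys∈ with ∈-++⁻ (sublists xs) ys∈
    ... | inj₁ p = sublists-unique xs u p
    ... | inj₂ p with zs , zs∈ , refl ← ∈-map⁻ (x ∷_) p =
      All.tabulate (λ z∈ → All.lookup x∉ (sublists-⊆ xs zs∈ z∈)) ∷ sublists-unique xs u zs∈

    filter-∈-sublists : ∀ {p} {P : A → Set p} (P? : ∀ x → Dec (P x)) xs → filter P? xs ∈ sublists xs
    filter-∈-sublists P? []       = here refl
    filter-∈-sublists P? (x ∷ xs) with P? x
    ... | yes _ = ∈-++⁺ʳ (sublists xs) (∈-map⁺ (x ∷_) (filter-∈-sublists P? xs))
    ... | no  _ = ∈-++⁺ˡ (filter-∈-sublists P? xs)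

  diagonals-unique : ∀ n → Unique (diagonals n)
  diagonals-unique n = Unique.filter⁺ _ (Unique.filter⁺ _ (Unique.cartesianProduct⁺ (Unique.allFin⁺ n) (Unique.allFin⁺ n)))

  ∈-diagonals⁺ : ∀ {n} {i j : Fin n} → 2 + toℕ i ≤ toℕ j → chord (i , j) ≢ (0 , n ∸ 1) → (i , j) ∈ diagonals n
  ∈-diagonals⁺ {suc n} {i} {j} sp ne = ∈-filter⁺ (λ d → ¬? (side? d))
    (∈-filter⁺ (λ (i , j) → i Fin.<? j) (∈-cartesianProduct⁺ (∈-allFin i) (∈-allFin j)) (≤-trans (n≤1+n _) sp)) λ where
      (inj₁ eq)       → <⇒≢ sp eq
      (inj₂ (p , q)) → ne (cong₂ _,_ p (suc-injective q))

  ∈-diagonals⁻ : ∀ {n} {d : Edge n} → d ∈ diagonals n → 2 + toℕ (proj₁ d) ≤ toℕ (proj₂ d) × chord d ≢ (0 , n ∸ 1)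
  ∈-diagonals⁻ {n} {i , j} d∈ with e∈ , ¬side ← ∈-filter⁻ (λ d → ¬? (side? d)) {xs = edges n} d∈
    with _ , i<j ← ∈-filter⁻ (λ (i , j) → i Fin.<? j) {xs = cartesianProduct (allFin n) (allFin n)} e∈ =
    ≤∧≢⇒< i<j (¬side ∘ inj₁) , λ eq → ¬side (inj₂ (cong proj₁ eq , trans (cong suc (cong proj₂ eq)) (positive j)))
    where
    positive : ∀ {n} → Fin n → suc (n ∸ 1) ≡ n
    positive {suc n} _ = refl

  length-filter-chords : ∀ {n} (H : List (Edge n)) (d : Edge n) → crossingsOn H d ≡ crossings (map chord H) (chord d)
  length-filter-chords H d = trans (length-filter≡count (crosses? d) H) (trans (∑-cong H λ {f} _ → same f) (sym (∑-map _ chord H)))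
    where
    same : ∀ f → ind (crosses? d f) ≡ ind (cross? (chord d) (chord f))
    same f = ≤-antisym (ind-mono (crosses? d f) (cross? (chord d) (chord f)) λ where (inj₁ p) → inj₁ p; (inj₂ p) → inj₂ p)
                       (ind-mono (cross? (chord d) (chord f)) (crosses? d f) λ where (inj₁ p) → inj₁ p; (inj₂ p) → inj₂ p)

  chords-closed : ∀ {ℓ n} {H : List (Edge n)} → H ∈ sublists (diagonals n) → CrossedAtMost ℓ H → Closed ℓ n (map chord H)
  chords-closed {ℓ} {n} {H} H∈ capped = record
    { spans  = λ e∈ → case ∈-map⁻ chord e∈ of λ where
        ((i , j) , d∈ , refl) → proj₁ (∈-diagonals⁻ (sublists-⊆ (diagonals n) H∈ d∈)) , Fin.toℕ<n j
    ; unique = Unique.map⁺ chord-injective (sublists-unique (diagonals n) (diagonals-unique n) H∈)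
    ; capped = λ e∈ → case ∈-map⁻ chord e∈ of λ where
        (d , d∈ , refl) → subst (_≤ ℓ) (length-filter-chords H d) (All.lookup capped d∈)
    }

  chord-of-diagonal : ∀ {n x y} → 2 + x ≤ y → y < 2 + n → (x , y) ≢ (0 , suc n) →
                      ∃ λ d → d ∈ diagonals (2 + n) × chord d ≡ (x , y)
  chord-of-diagonal {n} {x} {y} sp y< ne = (fromℕ< x< , fromℕ< y<) , ∈-diagonals⁺ sp′ (ne ∘ trans (sym d≡)) , d≡
    where
    x< : x < 2 + n
    x< = ≤-<-trans (≤-trans (m≤n+m x 2) sp) y<
    d≡ : (toℕ (fromℕ< x<) , toℕ (fromℕ< y<)) ≡ (x , y)
    d≡ = cong₂ _,_ (Fin.toℕ-fromℕ< x<) (Fin.toℕ-fromℕ< y<)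
    sp′ : 2 + toℕ (fromℕ< x<) ≤ toℕ (fromℕ< y<)
    sp′ = subst₂ (λ u v → 2 + u ≤ v) (sym (Fin.toℕ-fromℕ< x<)) (sym (Fin.toℕ-fromℕ< y<)) sp

  -- The numbers `e` in terms of closed sets

  e-upper : ∀ {ℓ g} n → 1 ≤ n → Bounded ℓ g (2 + n) → suc (e ℓ (2 + n)) ≤ g n
  e-upper {ℓ} {g} n 1≤n bound = below (g n) (bound ((0 , suc n) ∷ []) (closed-side 1≤n (record { spans = λ (); unique = []; capped = λ () }) λ ())) λ {H} H∈ capped →
    subst (λ k → suc k ≤ g n) (length-map chord H) (bound _ (closed-side 1≤n (chords-closed H∈ capped) λ side∈ →
      case ∈-map⁻ chord side∈ of λ where (d , d∈ , eq) → proj₂ (∈-diagonals⁻ (sublists-⊆ (diagonals (2 + n)) H∈ d∈)) (sym eq)))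
    where
    -- Positivity of `k`, obtained from the set consisting of the side alone, takes care of the
    -- default value 0 of the maximum.
    below : ∀ k → 1 ≤ k → (∀ {H} → H ∈ sublists (diagonals (2 + n)) → CrossedAtMost ℓ H → suc (length H) ≤ k) → suc (e ℓ (2 + n)) ≤ k
    below (suc k) _ h = s≤s (max≤v⁺ z≤n (All.map⁺ (All.tabulate λ {H} H∈ →
      let H∈′ , c = ∈-filter⁻ (crossedAtMost? ℓ) {xs = sublists (diagonals (2 + n))} H∈ in ≤-pred (h H∈′ c))))

  -- The diagonals that occur in `G` form an admissible subgraph, and the side is the only chord
  -- that can be lost on the way.
  e-lower : ∀ {ℓ n G} → Closed ℓ (2 + n) G → length G ≤ suc (e ℓ (2 + n))
  e-lower {ℓ} {n} {G} cl = ≤-trans covered (s≤s (v≤max⁺ 0 _ (inj₂ (lose (∈-map⁺ length (∈-filter⁺ (crossedAtMost? ℓ)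
      (filter-∈-sublists chosen? (diagonals (2 + n))) capped)) ≤-refl))))
    where
    open Closed cl using (spans; unique)
    chosen? : ∀ (d : Edge (2 + n)) → Dec (chord d ∈ G)
    chosen? d = chord d ∈? G
    H : List (Edge (2 + n))
    H = filter chosen? (diagonals (2 + n))
    covered : length G ≤ suc (length H)
    covered = subst (λ k → length G ≤ suc k) (length-map chord H) (unique-⊆⇒length≤ ((0 , suc n) ∷ map chord H) unique within)
      where
      within : ∀ {f} → f ∈ G → f ∈ (0 , suc n) ∷ map chord H
      within {x , y} f∈ with (x , y) ≟ᶜ (0 , suc n)
      ... | yes refl = here refl
      ... | no ne with d , d∈ , refl ← chord-of-diagonal (proj₁ (spans f∈)) (proj₂ (spans f∈)) ne =
        there (∈-map⁺ chord (∈-filter⁺ chosen? d∈ f∈))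
    capped′ : ∀ {d} → d ∈ H → crossingsOn H d ≤ ℓ
    capped′ {d} d∈ = begin
      crossingsOn H d                         ≡⟨ length-filter-chords H d ⟩
      crossings (map chord H) (chord d)       ≡⟨ length-filter≡count (cross? (chord d)) (map chord H) ⟨
      length (filter (cross? (chord d)) (map chord H))
        ≤⟨ unique-⊆⇒length≤ (filter (cross? (chord d)) G) (Unique.filter⁺ _ (Unique.map⁺ chord-injective (Unique.filter⁺ chosen? (diagonals-unique (2 + n))))) into ⟩
      length (filter (cross? (chord d)) G)    ≡⟨ length-filter≡count (cross? (chord d)) G ⟩
      crossings G (chord d)                   ≤⟨ Closed.capped cl (proj₂ (∈-filter⁻ chosen? {xs = diagonals (2 + n)} d∈)) ⟩
      ℓ                                       ∎
      where
      open ≤-Reasoning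
      into : ∀ {f} → f ∈ filter (cross? (chord d)) (map chord H) → f ∈ filter (cross? (chord d)) G
      into f∈ with f∈′ , c ← ∈-filter⁻ (cross? (chord d)) {xs = map chord H} f∈ with d′ , d′∈ , refl ← ∈-map⁻ chord f∈′ =
        ∈-filter⁺ (cross? (chord d)) (proj₂ (∈-filter⁻ chosen? {xs = diagonals (2 + n)} d′∈)) c
    capped : CrossedAtMost ℓ H
    capped = All.tabulate capped′

  e-exact : ∀ {ℓ} {g : ℕ → ℕ} n → 1 ≤ n → Bounded ℓ g (2 + n) → (∃ λ G → Closed ℓ (2 + n) G × length G ≡ g n) → suc (e ℓ (2 + n)) ≡ g n
  e-exact {g = g} n 1≤n bound (G , cl , len) = ≤-antisym (e-upper {g = g} n 1≤n bound) (≤-trans (≤-reflexive (sym len)) (e-lower cl))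

  -- Removing the most crossed chord

  -- Pairs are counted in list order, so crossings of `d` with earlier entries are recorded at those
  -- entries. Symmetry of the relation credits them to `d`.
  countPairs-remove : ∀ {A : Set} {R : A → A → Set} (R? : ∀ x y → Dec (R x y)) → (∀ {x y} → R x y → R y x) →
                      ∀ xs {d ys} → ¬ R d d →
                      length (filter (R? d) (xs ++ d ∷ ys)) + countPairs R? (xs ++ ys) ≤ countPairs R? (xs ++ d ∷ ys)
  countPairs-remove {A} {R} R? R-sym xs {d} {ys} irr = ≤-trans (≤-reflexive (cong (_+ countPairs R? (xs ++ ys)) (trans (length-filter≡count (R? d) (xs ++ d ∷ ys)) (skip xs)))) (go xs)
    where
    skip : ∀ xs → count (R? d) (xs ++ d ∷ ys) ≡ count (R? d) (xs ++ ys)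
    skip []       = cong (_+ count (R? d) ys) (ind-0 (R? d d) irr)
    skip (x ∷ xs) = cong (ind (R? d x) +_) (skip xs)
    more : ∀ x xs → ind (R? x d) + count (R? x) (xs ++ ys) ≤ count (R? x) (xs ++ d ∷ ys)
    more x []       = ≤-refl
    more x (y ∷ xs) = begin
      ind (R? x d) + (ind (R? x y) + count (R? x) (xs ++ ys)) ≡⟨ +-assoc (ind (R? x d)) _ _ ⟨
      ind (R? x d) + ind (R? x y) + count (R? x) (xs ++ ys)   ≡⟨ cong (_+ count (R? x) (xs ++ ys)) (+-comm (ind (R? x d)) _) ⟩
      ind (R? x y) + ind (R? x d) + count (R? x) (xs ++ ys)   ≡⟨ +-assoc (ind (R? x y)) _ _ ⟩
      ind (R? x y) + (ind (R? x d) + count (R? x) (xs ++ ys)) ≤⟨ +-monoʳ-≤ _ (more x xs) ⟩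
      ind (R? x y) + count (R? x) (xs ++ d ∷ ys)              ∎
      where open ≤-Reasoning
    go : ∀ xs → count (R? d) (xs ++ ys) + countPairs R? (xs ++ ys) ≤ countPairs R? (xs ++ d ∷ ys)
    go []       = ≤-reflexive (cong (_+ countPairs R? ys) (sym (length-filter≡count (R? d) ys)))
    go (x ∷ xs) = begin
      ind (R? d x) + c + (length (filter (R? x) (xs ++ ys)) + p) ≡⟨ cong (λ z → ind (R? d x) + c + (z + p)) (length-filter≡count (R? x) (xs ++ ys)) ⟩
      ind (R? d x) + c + (q + p)     ≡⟨ +-assoc (ind (R? d x)) c _ ⟩
      ind (R? d x) + (c + (q + p))   ≡⟨ cong (ind (R? d x) +_) (trans (sym (+-assoc c q p)) (trans (cong (_+ p) (+-comm c q)) (+-assoc q c p))) ⟩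
      ind (R? d x) + (q + (c + p))   ≡⟨ +-assoc (ind (R? d x)) q _ ⟨
      ind (R? d x) + q + (c + p)     ≤⟨ +-mono-≤ (≤-trans (+-monoˡ-≤ q (ind-mono (R? d x) (R? x d) R-sym)) (more x xs)) (go xs) ⟩
      count (R? x) (xs ++ d ∷ ys) + countPairs R? (xs ++ d ∷ ys) ≡⟨ cong (_+ countPairs R? (xs ++ d ∷ ys)) (length-filter≡count (R? x) (xs ++ d ∷ ys)) ⟨
      countPairs R? (x ∷ xs ++ d ∷ ys) ∎
      where
      open ≤-Reasoning
      c = count (R? d) (xs ++ ys)
      p = countPairs R? (xs ++ ys)
      q = count (R? x) (xs ++ ys)

  sublists-remove : ∀ {A : Set} (zs : List A) xs {d ys} → xs ++ d ∷ ys ∈ sublists zs → xs ++ ys ∈ sublists zs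
  sublists-remove []       []       (here ())
  sublists-remove []       (_ ∷ _)  (here ())
  sublists-remove (z ∷ zs) xs p with ∈-++⁻ (sublists zs) p
  ... | inj₁ q = ∈-++⁺ˡ (sublists-remove zs xs q)
  ... | inj₂ q = drop xs (∈-map⁻ (z ∷_) q)
    where
    drop : ∀ xs {d ys} → ∃ (λ ws → ws ∈ sublists zs × xs ++ d ∷ ys ≡ z ∷ ws) → xs ++ ys ∈ sublists (z ∷ zs)
    drop []       (_ , ws∈ , refl) = ∈-++⁺ˡ ws∈
    drop (x ∷ xs) (_ , ws∈ , refl) = ∈-++⁺ʳ (sublists zs) (∈-map⁺ (z ∷_) (sublists-remove zs xs ws∈))

  crosses-sym : ∀ {n} {d f : Edge n} → Crosses d f → Crosses f d
  crosses-sym (inj₁ p) = inj₂ p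
  crosses-sym (inj₂ p) = inj₁ p

  crosses-irrefl : ∀ {n} {d : Edge n} → ¬ Crosses d d
  crosses-irrefl (inj₁ (p , _)) = <-irrefl refl p
  crosses-irrefl (inj₂ (p , _)) = <-irrefl refl p

  module _ (n : ℕ) where

    e-sum : ℕ → ℕ
    e-sum m = sum (map (λ ℓ → e ℓ n) (upTo m))

    e-sum-suc : ∀ m → e-sum (suc m) ≡ e-sum m + e m n
    e-sum-suc m = begin
      sum (map (λ ℓ → e ℓ n) (upTo (suc m)))                   ≡⟨ cong (sum ∘ map (λ ℓ → e ℓ n)) (upTo-∷ʳ m) ⟨
      sum (map (λ ℓ → e ℓ n) (upTo m ++ m ∷ []))               ≡⟨ cong sum (map-++ (λ ℓ → e ℓ n) (upTo m) (m ∷ [])) ⟩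
      sum (map (λ ℓ → e ℓ n) (upTo m) ++ e m n ∷ [])           ≡⟨ sum-++ (map (λ ℓ → e ℓ n) (upTo m)) (e m n ∷ []) ⟩
      e-sum m + (e m n + 0)                                    ≡⟨ cong (e-sum m +_) (+-identityʳ _) ⟩
      e-sum m + e m n                                          ∎
      where open ≡-Reasoning

    -- While H has more than e m n chords, some chord of H is crossed more than m times; remove it.
    crossings-bound : ∀ m k H → length H ≤ k → H ∈ sublists (diagonals n) → m * length H ≤ countPairs crosses? H + e-sum m
    crossings-bound zero    _ _ _ _ = z≤n
    crossings-bound (suc m) k H H≤k H∈ with crossedAtMost? m H
    -- Such a set has at most `e m n` chords, which pays for one of the `suc m` copies of its size;
    -- the other `m` copies are the previous case.
    ... | yes c = begin
      length H + m * length H                       ≤⟨ +-mono-≤ few (crossings-bound m k H H≤k H∈) ⟩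
      e m n + (countPairs crosses? H + e-sum m)     ≡⟨ +-comm (e m n) _ ⟩
      countPairs crosses? H + e-sum m + e m n       ≡⟨ +-assoc (countPairs crosses? H) _ _ ⟩
      countPairs crosses? H + (e-sum m + e m n)     ≡⟨ cong (countPairs crosses? H +_) (e-sum-suc m) ⟨
      countPairs crosses? H + e-sum (suc m)         ∎
      where
      open ≤-Reasoning
      few : length H ≤ e m n
      few = All.lookup (xs≤max 0 _) (∈-map⁺ length (∈-filter⁺ (crossedAtMost? m) H∈ c))
    ... | no ¬c with d , d∈ , m< ← find (All.¬All⇒Any¬ (λ d → crossingsOn H d ≤? m) H ¬c) with xs , ys , refl ← ∈-∃++ d∈ = removed k H≤k
      where
      removed : ∀ k → length (xs ++ d ∷ ys) ≤ k → suc m * length (xs ++ d ∷ ys) ≤ countPairs crosses? (xs ++ d ∷ ys) + e-sum (suc m)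
      removed zero    H≤ = contradiction (≤-trans (≤-reflexive (sym (trans (length-++ xs) (+-suc (length xs) (length ys))))) H≤) λ ()
      removed (suc k) H≤ = begin
        suc m * length (xs ++ d ∷ ys)                  ≡⟨ cong (suc m *_) len ⟩
        suc m * suc (length (xs ++ ys))                ≡⟨ *-suc (suc m) _ ⟩
        suc m + suc m * length (xs ++ ys)              ≤⟨ +-mono-≤ (≰⇒> m<) (crossings-bound (suc m) k (xs ++ ys) (≤-pred (≤-trans (≤-reflexive (sym len)) H≤)) (sublists-remove (diagonals n) xs H∈)) ⟩
        crossingsOn (xs ++ d ∷ ys) d + (countPairs crosses? (xs ++ ys) + e-sum (suc m)) ≡⟨ +-assoc (crossingsOn (xs ++ d ∷ ys) d) _ _ ⟨
        crossingsOn (xs ++ d ∷ ys) d + countPairs crosses? (xs ++ ys) + e-sum (suc m)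
          ≤⟨ +-monoˡ-≤ (e-sum (suc m)) (countPairs-remove crosses? (λ {x} {y} → crosses-sym {d = x} {y}) xs (crosses-irrefl {d = d})) ⟩
        countPairs crosses? (xs ++ d ∷ ys) + e-sum (suc m) ∎
        where
        open ≤-Reasoning
        len : length (xs ++ d ∷ ys) ≡ suc (length (xs ++ ys))
        len = trans (length-++ xs) (trans (+-suc (length xs) (length ys)) (cong suc (sym (length-++ xs))))

  -- Colour classes

  module _ {k n : ℕ} where

    -- Sides are discarded because they cross nothing and the numbers `e` refer to diagonals only.
    Class : Fin k → ColouredEdge k n → Set
    Class c (d , c′) = ¬ Side d × c′ ≡ c

    class? : ∀ c x → Dec (Class c x)
    class? c (d , c′) = ¬? (side? d) ×-dec (c′ Fin.≟ c)

    class : Fin k → List (ColouredEdge k n) → List (Edge n)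
    class c C = map proj₁ (filter (class? c) C)

    nonSides : List (ColouredEdge k n) → List (Edge n)
    nonSides C = filter (λ d → ¬? (side? d)) (map proj₁ C)

    class-accept : ∀ c {x} C → Class c x → class c (x ∷ C) ≡ proj₁ x ∷ class c C
    class-accept c C q = cong (map proj₁) (filter-accept (class? c) q)

    class-reject : ∀ c {x} C → ¬ Class c x → class c (x ∷ C) ≡ class c C
    class-reject c C ¬q = cong (map proj₁) (filter-reject (class? c) ¬q)

    class-∈ : ∀ c C → class c C ∈ sublists (nonSides C)
    class-∈ c [] = here refl
    class-∈ c (x@(d , c′) ∷ C) = go (side? d) (c′ Fin.≟ c)
      where
      go : Dec (Side d) → Dec (c′ ≡ c) → class c (x ∷ C) ∈ sublists (nonSides (x ∷ C))
      go (yes s) _ = subst₂ (λ H E → H ∈ sublists E) (sym (class-reject c {x} C (λ (¬s , _) → ¬s s))) (sym (filter-reject (λ d → ¬? (side? d)) (λ ¬s → ¬s s)))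
        (class-∈ c C)
      go (no ¬s) (yes eq) = subst₂ (λ H E → H ∈ sublists E) (sym (class-accept c {x} C (¬s , eq))) (sym (filter-accept (λ d → ¬? (side? d)) ¬s))
        (∈-++⁺ʳ (sublists (nonSides C)) (∈-map⁺ (d ∷_) (class-∈ c C)))
      go (no ¬s) (no ne) = subst₂ (λ H E → H ∈ sublists E) (sym (class-reject c {x} C (ne ∘ proj₂))) (sym (filter-accept (λ d → ¬? (side? d)) ¬s))
        (∈-++⁺ˡ (class-∈ c C))

    classes-cover : ∀ C → length (nonSides C) ≤ ∑ (λ c → length (class c C)) (allFin k)
    classes-cover C = begin
      length (nonSides C)                                      ≡⟨ length-filter≡count _ (map proj₁ C) ⟩
      count (λ d → ¬? (side? d)) (map proj₁ C)                 ≡⟨ ∑-map _ proj₁ C ⟩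
      ∑ (λ x → ind (¬? (side? (proj₁ x)))) C                   ≤⟨ ∑-mono C (λ {x} _ → ≤-trans (ind-mono (¬? (side? (proj₁ x))) (class? (proj₂ x) x) (_, refl)) (∈⇒≤∑ (λ c → ind (class? c x)) (∈-allFin (proj₂ x)))) ⟩
      ∑ (λ x → ∑ (λ c → ind (class? c x)) (allFin k)) C        ≡⟨ ∑-swap _ C (allFin k) ⟩
      ∑ (λ c → count (class? c) C) (allFin k)                  ≡⟨ ∑-cong (allFin k) (λ {c} _ → sym (trans (length-map proj₁ (filter (class? c) C)) (length-filter≡count (class? c) C))) ⟩
      ∑ (λ c → length (class c C)) (allFin k)                  ∎
      where open ≤-Reasoning

    count-class : ∀ x C → count (crosses? (proj₁ x)) (class (proj₂ x) C) ≤ count (monoCrosses? x) C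
    count-class x []      = z≤n
    count-class x (y ∷ C) = go (class? (proj₂ x) y)
      where
      go : Dec (Class (proj₂ x) y) → count (crosses? (proj₁ x)) (class (proj₂ x) (y ∷ C)) ≤ count (monoCrosses? x) (y ∷ C)
      go (no ¬q) = ≤-trans (≤-reflexive (cong (count (crosses? (proj₁ x))) (class-reject (proj₂ x) C ¬q)))
        (≤-trans (count-class x C) (m≤n+m _ (ind (monoCrosses? x y))))
      go (yes q) = ≤-trans (≤-reflexive (cong (count (crosses? (proj₁ x))) (class-accept (proj₂ x) C q)))
        (+-mono-≤ (ind-mono (crosses? (proj₁ x) (proj₁ y)) (monoCrosses? x y) (_, sym (proj₂ q))) (count-class x C))

    -- An edge placed in front of the list changes only the class of its own colour, and its
    -- crossings there are monochromatic.
    classes-crossings : ∀ C → ∑ (λ c → countPairs crosses? (class c C)) (allFin k) ≤ countPairs monoCrosses? C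
    classes-crossings []      = ≤-reflexive (∑-0 (allFin k) λ _ → refl)
    classes-crossings (x ∷ C) = begin
      ∑ (λ c → countPairs crosses? (class c (x ∷ C))) (allFin k)
        ≤⟨ ∑-mono (allFin k) (λ {c} _ → each c) ⟩
      ∑ (λ c → ind (proj₂ x Fin.≟ c) * count (crosses? (proj₁ x)) (class c C) + countPairs crosses? (class c C)) (allFin k)
        ≡⟨ ∑-+ _ _ (allFin k) ⟩
      ∑ (λ c → ind (proj₂ x Fin.≟ c) * count (crosses? (proj₁ x)) (class c C)) (allFin k) + ∑ (λ c → countPairs crosses? (class c C)) (allFin k)
        ≤⟨ +-mono-≤ own (classes-crossings C) ⟩
      count (monoCrosses? x) C + countPairs monoCrosses? C
        ≡⟨ cong (_+ countPairs monoCrosses? C) (length-filter≡count (monoCrosses? x) C) ⟨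
      countPairs monoCrosses? (x ∷ C) ∎
      where
      open ≤-Reasoning
      each : ∀ c → countPairs crosses? (class c (x ∷ C)) ≤ ind (proj₂ x Fin.≟ c) * count (crosses? (proj₁ x)) (class c C) + countPairs crosses? (class c C)
      each c = go (class? c x)
        where
        go : Dec (Class c x) → countPairs crosses? (class c (x ∷ C)) ≤ ind (proj₂ x Fin.≟ c) * count (crosses? (proj₁ x)) (class c C) + countPairs crosses? (class c C)
        go (no ¬q) = ≤-trans (≤-reflexive (cong (countPairs crosses?) (class-reject c C ¬q))) (m≤n+m _ _)
        go (yes q) = ≤-reflexive (trans (cong (countPairs crosses?) (class-accept c C q)) (cong (_+ countPairs crosses? (class c C))
          (trans (length-filter≡count (crosses? (proj₁ x)) (class c C)) (sym (trans (cong (_* count (crosses? (proj₁ x)) (class c C)) (ind-1 (proj₂ x Fin.≟ c) (proj₂ q))) (+-identityʳ _))))))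
      own : ∑ (λ c → ind (proj₂ x Fin.≟ c) * count (crosses? (proj₁ x)) (class c C)) (allFin k) ≤ count (monoCrosses? x) C
      own = ≤-trans (∑-single (allFin k) (Fin._≟ proj₂ x) (Unique.allFin⁺ k) λ {c} c≢ → cong (_* count (crosses? (proj₁ x)) (class c C)) (ind-0 (proj₂ x Fin.≟ c) (c≢ ∘ sym)))
        (≤-trans (*-monoˡ-≤ (count (crosses? (proj₁ x)) (class (proj₂ x) C)) (ind≤1 (proj₂ x Fin.≟ proj₂ x))) (≤-trans (≤-reflexive (*-identityˡ _)) (count-class x C)))

    coloured-bound : ∀ m C → map proj₁ C ≡ edges n → m * length (diagonals n) ≤ countPairs monoCrosses? C + k * e-sum n m
    coloured-bound m C eq = begin
      m * length (diagonals n)                                  ≡⟨ cong (λ E → m * length (filter (λ d → ¬? (side? d)) E)) eq ⟨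
      m * length (nonSides C)                                   ≤⟨ *-monoʳ-≤ m (classes-cover C) ⟩
      m * ∑ (λ c → length (class c C)) (allFin k)               ≡⟨ ∑-*ˡ m _ (allFin k) ⟨
      ∑ (λ c → m * length (class c C)) (allFin k)
        ≤⟨ ∑-mono (allFin k) (λ {c} _ → crossings-bound n m _ (class c C) ≤-refl (subst (λ E → class c C ∈ sublists (filter (λ d → ¬? (side? d)) E)) eq (class-∈ c C))) ⟩
      ∑ (λ c → countPairs crosses? (class c C) + e-sum n m) (allFin k) ≡⟨ ∑-+ _ _ (allFin k) ⟩
      ∑ (λ c → countPairs crosses? (class c C)) (allFin k) + ∑ (λ _ → e-sum n m) (allFin k)
        ≤⟨ +-mono-≤ (classes-crossings C) (≤-reflexive (trans (∑-const (e-sum n m) (allFin k)) (cong (_* e-sum n m) (length-tabulate {n = k} (λ i → i))))) ⟩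
      countPairs monoCrosses? C + k * e-sum n m                 ∎
      where open ≤-Reasoning

    colourings-edges : ∀ (es : List (Edge n)) {C} → C ∈ colourings k es → map proj₁ C ≡ es
    colourings-edges []       (here refl) = refl
    colourings-edges (d ∷ es) C∈ with c , χ , _ , χ∈ , refl ← ∈-cartesianProductWith⁻ (λ c χ → (d , c) ∷ χ) (allFin k) (colourings k es) C∈ =
      cong (d ∷_) (colourings-edges es χ∈)

    -- This handles the default value in the definition of `ν`: the total number of crossings is no
    -- smaller than the count for the colouring that uses one colour only.
    monochromatic : ∀ (c : Fin k) (es : List (Edge n)) → countPairs monoCrosses? (map (_, c) es) ≤ countPairs crosses? es
    monochromatic c []       = z≤n
    monochromatic c (d ∷ es) = +-mono-≤ (begin
      length (filter (monoCrosses? (d , c)) (map (_, c) es)) ≡⟨ length-filter≡count (monoCrosses? (d , c)) (map (_, c) es) ⟩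
      count (monoCrosses? (d , c)) (map (_, c) es)           ≡⟨ ∑-map _ (_, c) es ⟩
      ∑ (λ f → ind (monoCrosses? (d , c) (f , c))) es        ≤⟨ ∑-mono es (λ {f} _ → ind-mono (monoCrosses? (d , c) (f , c)) (crosses? d f) proj₁) ⟩
      count (crosses? d) es                                  ≡⟨ length-filter≡count (crosses? d) es ⟨
      length (filter (crosses? d) es)                        ∎) (monochromatic c es)
      where open ≤-Reasoning

  ν-bound : ∀ k n m → m * length (diagonals n) ≤ ν (suc k) n + suc k * e-sum n m
  ν-bound k n m = ≤-trans (m≤n+m∸n _ (suc k * e-sum n m)) (≤-trans (≤-reflexive (+-comm (suc k * e-sum n m) _)) (+-monoˡ-≤ _ (v≤min⁺ all-crossings (All.map⁺ (All.tabulate each)))))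
    where
    -- Subtracting the constant term first turns the claim into a lower bound for the minimum, to be
    -- checked on each colouring and on the default value.
    v : ℕ
    v = m * length (diagonals n) ∸ suc k * e-sum n m
    bound : ∀ (C : List (ColouredEdge (suc k) n)) → map proj₁ C ≡ edges n → v ≤ countPairs (monoCrosses? {suc k}) C
    bound C eq = m≤n+o⇒m∸n≤o _ (suc k * e-sum n m) (≤-trans (coloured-bound {n = n} m C eq) (≤-reflexive (+-comm (countPairs monoCrosses? C) _)))
    all-crossings : v ≤ countPairs crosses? (edges n)
    all-crossings = ≤-trans (bound (map (_, Fin.zero) (edges n)) (plain (edges n))) (monochromatic {n = n} Fin.zero (edges n))
      where
      plain : ∀ (es : List (Edge n)) → map proj₁ (map (_, Fin.zero {k}) es) ≡ es
      plain []       = refl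
      plain (d ∷ es) = cong (d ∷_) (plain es)
    each : ∀ {C} → C ∈ colourings (suc k) (edges n) → v ≤ countPairs monoCrosses? C
    each C∈ = bound _ (colourings-edges {n = n} (edges n) C∈)

  -- The number of diagonals

  allPairs : ℕ → List Chord
  allPairs zero    = []
  allPairs (suc t) = allPairs t ++ map (_, 2 + t) (upTo (suc t))

  allPairs-< : ∀ t {a b} → (a , b) ∈ allPairs t → 2 + a ≤ b × b < 2 + t
  allPairs-< (suc t) p with ∈-++⁻ (allPairs t) p
  ... | inj₁ q = let sp , b< = allPairs-< t q in sp , ≤-trans b< (n≤1+n _)
  ... | inj₂ q = case ∈-map⁻ (_, 2 + t) q of λ where (i , i∈ , refl) → s≤s (∈-upTo⁻ i∈) , ≤-refl

  allPairs-unique : ∀ t → Unique (allPairs t)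
  allPairs-unique zero    = []
  allPairs-unique (suc t) = Unique.++⁺ (allPairs-unique t) (Unique.map⁺ (cong proj₁) (Unique.upTo⁺ (suc t)))
    λ (p , q) → case ∈-map⁻ (_, 2 + t) q of λ where (_ , _ , refl) → <-irrefl refl (proj₂ (allPairs-< t p))

  allPairs-length : ∀ t → 2 * length (allPairs t) ≡ t * suc t
  allPairs-length zero    = refl
  allPairs-length (suc t) = begin
    2 * length (allPairs t ++ map (_, 2 + t) (upTo (suc t)))  ≡⟨ cong (2 *_) (trans (length-++ (allPairs t)) (cong (length (allPairs t) +_) (trans (length-map (_, 2 + t) (upTo (suc t))) (length-upTo (suc t))))) ⟩
    2 * (length (allPairs t) + suc t)                         ≡⟨ *-distribˡ-+ 2 (length (allPairs t)) (suc t) ⟩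
    2 * length (allPairs t) + 2 * suc t                       ≡⟨ cong (_+ 2 * suc t) (allPairs-length t) ⟩
    t * suc t + 2 * suc t                                     ≡⟨ *-distribʳ-+ (suc t) t 2 ⟨
    (t + 2) * suc t                                           ≡⟨ cong (_* suc t) (+-comm t 2) ⟩
    (2 + t) * suc t                                           ≡⟨ *-comm (2 + t) (suc t) ⟩
    suc t * suc (suc t)                                       ∎
    where open ≡-Reasoning

  diagonals-length : ∀ t → t * suc t ≤ 2 * suc (length (diagonals (2 + t)))
  diagonals-length t = ≤-trans (≤-reflexive (sym (allPairs-length t))) (*-monoʳ-≤ 2
    (subst (λ k → length (allPairs t) ≤ suc k) (length-map chord (diagonals (2 + t))) (unique-⊆⇒length≤ ((0 , suc t) ∷ map chord (diagonals (2 + t))) (allPairs-unique t) within)))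
    where
    within : ∀ {f} → f ∈ allPairs t → f ∈ (0 , suc t) ∷ map chord (diagonals (2 + t))
    within {f} f∈ with f ≟ᶜ (0 , suc t)
    ... | yes refl = here refl
    ... | no ne with d , d∈ , refl ← chord-of-diagonal (proj₁ (allPairs-< t f∈)) (proj₂ (allPairs-< t f∈)) ne = there (∈-map⁺ chord d∈)

open import Defs
open import Data.Integer.Base as ℤ using (+_)
open import Data.Nat.Base as ℕ using (ℕ)
open import Data.Product.Base using (_×_)
open import Data.Rational.Base using (ℚ; _/_; _+_; _*_; _-_; _≥_)
open import Relation.Binary.PropositionalEquality using (_≡_)
open import Relation.Nullary.Negation.Core using (¬_)
import Data.Integer.Properties as ℤ
open import Data.List.Base using (length)
open import Data.Nat.Base using (suc)
open import Data.Nat.Coprimality using (1-coprimeTo) renaming (sym to coprime-sym)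
open import Data.Nat.DivMod using ([m+n]%n≡m%n)
import Data.Nat.Properties as ℕ
open import Data.Product.Base using (_,_)
open import Data.Rational.Base using (-_; _≤_; ½; 1ℚ; 0ℚ; toℚᵘ)
open import Data.Rational.Properties
open import Data.Rational.Solver
open import Data.Rational.Unnormalised.Base as ℚᵘ using (mkℚᵘ; *≡*; *≤*)
import Data.Rational.Unnormalised.Properties as ℚᵘ
open import Relation.Binary.PropositionalEquality
open +-*-Solver
open Counting

-- Arithmetic in ℚ

toℚᵘ-fromℕ : ∀ n → toℚᵘ (fromℕ n) ≡ mkℚᵘ (+ n) 0
toℚᵘ-fromℕ n = cong toℚᵘ (normalize-coprime {n} {0} (coprime-sym (1-coprimeTo n)))

fromℕ-+ : ∀ a b → fromℕ (a ℕ.+ b) ≡ fromℕ a + fromℕ b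
fromℕ-+ a b = toℚᵘ-injective (ℚᵘ.≃-trans (ℚᵘ.≃-reflexive (toℚᵘ-fromℕ (a ℕ.+ b)))
  (ℚᵘ.≃-trans (*≡* (cong (ℤ._* + 1) (sym (cong₂ ℤ._+_ (ℤ.*-identityʳ (+ a)) (ℤ.*-identityʳ (+ b))))))
  (ℚᵘ.≃-sym (ℚᵘ.≃-trans (toℚᵘ-homo-+ (fromℕ a) (fromℕ b)) (ℚᵘ.≃-reflexive (cong₂ ℚᵘ._+_ (toℚᵘ-fromℕ a) (toℚᵘ-fromℕ b)))))))

fromℕ-* : ∀ a b → fromℕ (a ℕ.* b) ≡ fromℕ a * fromℕ b
fromℕ-* a b = toℚᵘ-injective (ℚᵘ.≃-trans (ℚᵘ.≃-reflexive (toℚᵘ-fromℕ (a ℕ.* b)))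
  (ℚᵘ.≃-trans (*≡* (cong (ℤ._* + 1) (ℤ.pos-* a b)))
  (ℚᵘ.≃-sym (ℚᵘ.≃-trans (toℚᵘ-homo-* (fromℕ a) (fromℕ b)) (ℚᵘ.≃-reflexive (cong₂ ℚᵘ._*_ (toℚᵘ-fromℕ a) (toℚᵘ-fromℕ b)))))))

fromℕ-mono : ∀ {a b} → a ℕ.≤ b → fromℕ a ≤ fromℕ b
fromℕ-mono {a} {b} a≤b = toℚᵘ-cancel-≤ (subst₂ ℚᵘ._≤_ (sym (toℚᵘ-fromℕ a)) (sym (toℚᵘ-fromℕ b))
  (*≤* (ℤ.*-monoʳ-≤-nonNeg (+ 1) (ℤ.+≤+ a≤b))))

collect : ∀ a b x d d′ → a * x + d + (b * x + d′) ≡ (a + b) * x + (d + d′)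
collect = solve 5 (λ a b x d d′ → a :* x :+ d :+ (b :* x :+ d′) := (a :+ b) :* x :+ (d :+ d′)) refl

factor : ∀ h r N x K d → h * N * x - K * (h * r * x + d) ≡ h * x * (N - r * K) - K * d
factor = solve 6 (λ h r N x K d → h :* N :* x :- K :* (h :* r :* x :+ d) := h :* x :* (N :- r :* K) :- K :* d) refl

minus-zero : ∀ p K → p - K * 0ℚ ≡ p
minus-zero = solve 2 (λ p K → p :- K :* con 0ℚ := p) refl

-- Closed formulas for `e`

δ₁-period : ∀ n → δ₁ (n ℕ.+ 2) ≡ δ₁ n
δ₁-period n rewrite [m+n]%n≡m%n n 2 ⦃ _ ⦄ = refl

δ₂-period : ∀ n → δ₂ (n ℕ.+ 3) ≡ δ₂ n
δ₂-period n rewrite [m+n]%n≡m%n n 3 ⦃ _ ⦄ = refl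

δ₃-period : ∀ n → δ₃ (n ℕ.+ 4) ≡ δ₃ n
δ₃-period n rewrite [m+n]%n≡m%n n 4 ⦃ _ ⦄ = refl

δ₄-period : ∀ n → δ₄ (n ℕ.+ 4) ≡ δ₄ n
δ₄-period n rewrite [m+n]%n≡m%n n 4 ⦃ _ ⦄ = refl

-- For `n = 2 + t` the expression `a * (t - 1) + δ n` is `a * (n - 3) + δ n`, the desired value of
-- `e`; the final 1 is the closing side.
Affine : ℚ → (ℕ → ℚ) → (ℕ → ℕ) → ℕ → Set
Affine a δ g t = fromℕ (g t) ≡ a * (fromℕ t - 1ℚ) + δ (2 ℕ.+ t) + 1ℚ

affine-step : ∀ {a δ g} p c t → a * fromℕ p ≡ fromℕ c → δ (2 ℕ.+ t ℕ.+ p) ≡ δ (2 ℕ.+ t) →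
              g (p ℕ.+ t) ≡ c ℕ.+ g t → Affine a δ g t → Affine a δ g (p ℕ.+ t)
affine-step {a} {δ} {g} p c t slope period step ih = begin
  fromℕ (g (p ℕ.+ t))                                        ≡⟨ cong fromℕ step ⟩
  fromℕ (c ℕ.+ g t)                                          ≡⟨ fromℕ-+ c (g t) ⟩
  fromℕ c + fromℕ (g t)                                      ≡⟨ cong₂ _+_ (sym slope) ih ⟩
  a * fromℕ p + (a * (fromℕ t - 1ℚ) + δ (2 ℕ.+ t) + 1ℚ)
    ≡⟨ solve 4 (λ a p t d → a :* p :+ (a :* (t :- con 1ℚ) :+ d :+ con 1ℚ) := a :* (p :+ t :- con 1ℚ) :+ d :+ con 1ℚ) refl a (fromℕ p) (fromℕ t) (δ (2 ℕ.+ t)) ⟩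
  a * (fromℕ p + fromℕ t - 1ℚ) + δ (2 ℕ.+ t) + 1ℚ
    ≡⟨ cong₂ (λ x d → a * (x - 1ℚ) + d + 1ℚ) (sym (fromℕ-+ p t)) (sym (trans (cong δ (ℕ.+-comm p (2 ℕ.+ t))) period)) ⟩
  a * (fromℕ (p ℕ.+ t) - 1ℚ) + δ (p ℕ.+ (2 ℕ.+ t)) + 1ℚ
    ≡⟨ cong (λ n → a * (fromℕ (p ℕ.+ t) - 1ℚ) + δ n + 1ℚ) (trans (ℕ.+-comm p (2 ℕ.+ t)) (cong (2 ℕ.+_) (ℕ.+-comm t p))) ⟩
  a * (fromℕ (p ℕ.+ t) - 1ℚ) + δ (2 ℕ.+ (p ℕ.+ t)) + 1ℚ      ∎
  where open ≡-Reasoning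

affine₀ : ∀ t → Affine 1ℚ (λ _ → 0ℚ) gap₀ t
affine₀ t = solve 1 (λ t → t := con 1ℚ :* (t :- con 1ℚ) :+ con 0ℚ :+ con 1ℚ) refl (fromℕ t)

affine₁ : ∀ t → Affine (+ 3 / 2) δ₁ gap₁ t
affine₁ 0             = refl
affine₁ 1             = refl
affine₁ (suc (suc t)) = affine-step {+ 3 / 2} {δ₁} {gap₁} 2 3 t refl (δ₁-period (2 ℕ.+ t)) refl (affine₁ t)

affine₂ : ∀ t → Affine (fromℕ 2) δ₂ gap₂ t
affine₂ 0                   = refl
affine₂ 1                   = refl
affine₂ 2                   = refl
affine₂ (suc (suc (suc t))) = affine-step {fromℕ 2} {δ₂} {gap₂} 3 6 t refl (δ₂-period (2 ℕ.+ t)) refl (affine₂ t)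

affine₃ : ∀ t → Affine (+ 9 / 4) δ₃ gap₃ t
affine₃ 0                         = refl
affine₃ 1                         = refl
affine₃ 2                         = refl
affine₃ 3                         = refl
affine₃ (suc (suc (suc (suc t)))) = affine-step {+ 9 / 4} {δ₃} {gap₃} 4 9 t refl (δ₃-period (2 ℕ.+ t)) refl (affine₃ t)

affine₄ : ∀ t → Affine (+ 5 / 2) δ₄ gap₄ t
affine₄ 0                         = refl
affine₄ 1                         = refl
affine₄ 2                         = refl
affine₄ 3                         = refl
affine₄ (suc (suc (suc (suc t)))) = affine-step {+ 5 / 2} {δ₄} {gap₄} 4 10 t refl (δ₄-period (2 ℕ.+ t)) refl (affine₄ t)

module _ ℓ a (δ : ℕ → ℚ) (g : ℕ → ℕ) (bound : ∀ n → Bounded ℓ g n) (attained : ∀ u → Attained ℓ g (3 ℕ.+ u))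
  (affine : ∀ t → Affine a δ g t) where

  e-affine-2+ : ∀ t → 1 ℕ.≤ t → Attained ℓ g t → fromℕ (e ℓ (2 ℕ.+ t)) ≡ a * (fromℕ (2 ℕ.+ t) - fromℕ 3) + δ (2 ℕ.+ t)
  e-affine-2+ t 1≤t att = begin
    fromℕ (e ℓ n)                             ≡⟨ solve 1 (λ x → x := con (fromℕ 1) :+ x :- con 1ℚ) refl (fromℕ (e ℓ n)) ⟩
    fromℕ 1 + fromℕ (e ℓ n) - 1ℚ              ≡⟨ cong (_- 1ℚ) (fromℕ-+ 1 (e ℓ n)) ⟨
    fromℕ (suc (e ℓ n)) - 1ℚ                  ≡⟨ cong (λ k → fromℕ k - 1ℚ) (e-exact {g = g} t 1≤t (bound n) att) ⟩
    fromℕ (g t) - 1ℚ                          ≡⟨ cong (_- 1ℚ) (affine t) ⟩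
    a * (fromℕ t - 1ℚ) + δ n + 1ℚ - 1ℚ
      ≡⟨ solve 3 (λ a t d → a :* (t :- con 1ℚ) :+ d :+ con 1ℚ :- con 1ℚ := a :* (con (fromℕ 2) :+ t :- con (fromℕ 3)) :+ d) refl a (fromℕ t) (δ n) ⟩
    a * (fromℕ 2 + fromℕ t - fromℕ 3) + δ n   ≡⟨ cong (λ x → a * (x - fromℕ 3) + δ n) (fromℕ-+ 2 t) ⟨
    a * (fromℕ n - fromℕ 3) + δ n             ∎
    where
    open ≡-Reasoning
    n = 2 ℕ.+ t

  e-affine : ∀ {n} → 5 ℕ.≤ n → fromℕ (e ℓ n) ≡ a * (fromℕ n - fromℕ 3) + δ n
  e-affine 5≤n = let u , 5+u≡n = ℕ.m≤n⇒∃[o]m+o≡n 5≤n in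
    subst (λ n → fromℕ (e ℓ n) ≡ a * (fromℕ n - fromℕ 3) + δ n) {x = 2 ℕ.+ (3 ℕ.+ u)} 5+u≡n
      (e-affine-2+ (3 ℕ.+ u) (ℕ.s≤s ℕ.z≤n) (attained u))

-- On `2 + t` vertices there are `t (t + 1) / 2` chords including the closing side. The inequality
-- `counts` is kept doubled to stay in natural numbers; halving it and subtracting `m` for the side
-- together with the `e`-sums gives `L`.
ν≥L-2+ : ∀ k m t → + m / 2 ≡ ½ * fromℕ m → fromℕ (ν (suc k) (2 ℕ.+ t)) ≥ L (suc k) (2 ℕ.+ t) m
ν≥L-2+ k m t half = subst₂ _≤_ left right (+-monoˡ-≤ (- M - K′ * S) (*-monoʳ-≤-nonNeg ½ (fromℕ-mono counts)))
  where
  M = fromℕ m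
  K′ = fromℕ (suc k)
  n = 2 ℕ.+ t
  s = e-sum n m
  S = fromℕ s
  V = fromℕ (ν (suc k) n)
  T = fromℕ t
  counts : m ℕ.* (t ℕ.* suc t) ℕ.≤ 2 ℕ.* (m ℕ.+ (ν (suc k) n ℕ.+ suc k ℕ.* s))
  counts = begin
    m ℕ.* (t ℕ.* suc t)                         ≤⟨ ℕ.*-monoʳ-≤ m (diagonals-length t) ⟩
    m ℕ.* (2 ℕ.* suc d)                         ≡⟨ trans (sym (ℕ.*-assoc m 2 (suc d))) (trans (cong (ℕ._* suc d) (ℕ.*-comm m 2)) (ℕ.*-assoc 2 m (suc d))) ⟩
    2 ℕ.* (m ℕ.* suc d)                         ≡⟨ cong (2 ℕ.*_) (ℕ.*-suc m d) ⟩
    2 ℕ.* (m ℕ.+ m ℕ.* d)                       ≤⟨ ℕ.*-monoʳ-≤ 2 (ℕ.+-monoʳ-≤ m (ν-bound k n m)) ⟩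
    2 ℕ.* (m ℕ.+ (ν (suc k) n ℕ.+ suc k ℕ.* s)) ∎
    where
    open ℕ.≤-Reasoning
    d = length (diagonals n)
  left : fromℕ (m ℕ.* (t ℕ.* suc t)) * ½ + (- M - K′ * S) ≡ L (suc k) n m
  left = begin
    fromℕ (m ℕ.* (t ℕ.* suc t)) * ½ + (- M - K′ * S)
      ≡⟨ cong (λ x → x * ½ + (- M - K′ * S)) (trans (fromℕ-* m (t ℕ.* suc t)) (cong (λ x → M * x) (trans (fromℕ-* t (suc t)) (cong (λ x → T * x) (fromℕ-+ 1 t))))) ⟩
    M * (T * (fromℕ 1 + T)) * ½ + (- M - K′ * S)
      ≡⟨ solve 4 (λ m t k s → m :* (t :* (con (fromℕ 1) :+ t)) :* con ½ :+ (:- m :- k :* s) :=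
           (con ½ :* m) :* (con (fromℕ 2) :+ t) :* (con (fromℕ 2) :+ t :- con (fromℕ 3)) :- k :* s) refl M T K′ S ⟩
    (½ * M) * (fromℕ 2 + T) * (fromℕ 2 + T - fromℕ 3) - K′ * S
      ≡⟨ cong₂ (λ c x → c * x * (x - fromℕ 3) - K′ * S) (sym half) (sym (fromℕ-+ 2 t)) ⟩
    L (suc k) n m ∎
    where open ≡-Reasoning
  right : fromℕ (2 ℕ.* (m ℕ.+ (ν (suc k) n ℕ.+ suc k ℕ.* s))) * ½ + (- M - K′ * S) ≡ V
  right = trans (cong (λ x → x * ½ + (- M - K′ * S)) (trans (fromℕ-* 2 (m ℕ.+ (ν (suc k) n ℕ.+ suc k ℕ.* s)))
      (cong (λ x → fromℕ 2 * x) (trans (fromℕ-+ m (ν (suc k) n ℕ.+ suc k ℕ.* s))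
      (cong (λ x → M + x) (trans (fromℕ-+ (ν (suc k) n) (suc k ℕ.* s)) (cong (λ x → V + x) (fromℕ-* (suc k) s))))))))
    (solve 4 (λ m v k s → con (fromℕ 2) :* (m :+ (v :+ k :* s)) :* con ½ :+ (:- m :- k :* s) := v) refl M V K′ S)

ν≥L : ∀ k n m → 2 ℕ.≤ n → + m / 2 ≡ ½ * fromℕ m → fromℕ (ν (suc k) n) ≥ L (suc k) n m
ν≥L k n m 2≤n half = let t , 2+t≡n = ℕ.m≤n⇒∃[o]m+o≡n 2≤n in
  subst (λ n → fromℕ (ν (suc k) n) ≥ L (suc k) n m) {x = 2 ℕ.+ t} 2+t≡n (ν≥L-2+ k m t half)

-- Sums of `e` and factored forms of `L`

module _ {n : ℕ} (5≤n : 5 ℕ.≤ n) where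

  e-sum-step : ∀ m a b c d d′ → fromℕ (e-sum n m) ≡ a * (fromℕ n - fromℕ 3) + d → fromℕ (e m n) ≡ b * (fromℕ n - fromℕ 3) + d′ →
               a + b ≡ c → fromℕ (e-sum n (suc m)) ≡ c * (fromℕ n - fromℕ 3) + (d + d′)
  e-sum-step m a b c d d′ s≡ e≡ c≡ = begin
    fromℕ (e-sum n (suc m))             ≡⟨ cong fromℕ (e-sum-suc n m) ⟩
    fromℕ (e-sum n m ℕ.+ e m n)         ≡⟨ fromℕ-+ (e-sum n m) (e m n) ⟩
    fromℕ (e-sum n m) + fromℕ (e m n)   ≡⟨ cong₂ _+_ s≡ e≡ ⟩
    a * x + d + (b * x + d′)            ≡⟨ collect a b x d d′ ⟩
    (a + b) * x + (d + d′)              ≡⟨ cong (λ c → c * x + (d + d′)) c≡ ⟩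
    c * x + (d + d′)                    ∎
    where
    open ≡-Reasoning
    x = fromℕ n - fromℕ 3

  e-sum₁ : fromℕ (e-sum n 1) ≡ 1ℚ * (fromℕ n - fromℕ 3) + 0ℚ
  e-sum₁ = trans (cong fromℕ (ℕ.+-identityʳ (e 0 n)))
    (e-affine 0 1ℚ (λ _ → 0ℚ) gap₀ bounded₀ (λ u → attained₀ (3 ℕ.+ u)) affine₀ 5≤n)

  e-sum₂ : fromℕ (e-sum n 2) ≡ (+ 5 / 2) * (fromℕ n - fromℕ 3) + δ₁ n
  e-sum₂ = trans (e-sum-step 1 1ℚ (+ 3 / 2) (+ 5 / 2) 0ℚ (δ₁ n) e-sum₁
      (e-affine 1 (+ 3 / 2) δ₁ gap₁ bounded₁ (λ u → attained₁ (3 ℕ.+ u)) affine₁ 5≤n) refl)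
    (cong (λ d → (+ 5 / 2) * (fromℕ n - fromℕ 3) + d) (+-identityˡ (δ₁ n)))

  e-sum₃ : fromℕ (e-sum n 3) ≡ (+ 9 / 2) * (fromℕ n - fromℕ 3) + (δ₁ n + δ₂ n)
  e-sum₃ = e-sum-step 2 (+ 5 / 2) (fromℕ 2) (+ 9 / 2) (δ₁ n) (δ₂ n) e-sum₂
    (e-affine 2 (fromℕ 2) δ₂ gap₂ bounded₂ (λ u → attained₂ (3 ℕ.+ u)) affine₂ 5≤n) refl

  e-sum₄ : fromℕ (e-sum n 4) ≡ (+ 27 / 4) * (fromℕ n - fromℕ 3) + (δ₁ n + δ₂ n + δ₃ n)
  e-sum₄ = e-sum-step 3 (+ 9 / 2) (+ 9 / 4) (+ 27 / 4) (δ₁ n + δ₂ n) (δ₃ n) e-sum₃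
    (e-affine 3 (+ 9 / 4) δ₃ gap₃ bounded₃ (λ u → attained₃ (3 ℕ.+ u)) affine₃ 5≤n) refl

  e-sum₅ : fromℕ (e-sum n 5) ≡ (+ 37 / 4) * (fromℕ n - fromℕ 3) + (δ₁ n + δ₂ n + δ₃ n + δ₄ n)
  e-sum₅ = e-sum-step 4 (+ 27 / 4) (+ 5 / 2) (+ 37 / 4) (δ₁ n + δ₂ n + δ₃ n) (δ₄ n) e-sum₄
    (e-affine 4 (+ 5 / 2) δ₄ gap₄ bounded₄ attained₄ affine₄ 5≤n) refl

  -- With `c` the sum of the first `m` slopes and `h = m / 2`, the factor `n - 3` splits off. The
  -- ratio `r = c / h` is the origin of the constants 2, 5/2, 3, 27/8 and 37/10.
  L-factored : ∀ k m h r c d → + m / 2 ≡ h → h * r ≡ c → fromℕ (e-sum n m) ≡ c * (fromℕ n - fromℕ 3) + d →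
               L k n m ≡ h * (fromℕ n - fromℕ 3) * (fromℕ n - r * fromℕ k) - fromℕ k * d
  L-factored k m h r c d h≡ c≡ s≡ = begin
    (+ m / 2) * N * x - K * fromℕ (e-sum n m)   ≡⟨ cong₂ (λ a s → a * N * x - K * s) h≡ s≡ ⟩
    h * N * x - K * (c * x + d)                 ≡⟨ cong (λ c → h * N * x - K * (c * x + d)) c≡ ⟨
    h * N * x - K * (h * r * x + d)             ≡⟨ factor h r N x K d ⟩
    h * x * (N - r * K) - K * d                 ∎
    where
    open ≡-Reasoning
    N = fromℕ n
    K = fromℕ k
    x = N - fromℕ 3

  L₁ : ∀ k → L k n 1 ≡ (+ 1 / 2) * (fromℕ n - fromℕ 3) * (fromℕ n - fromℕ 2 * fromℕ k)
  L₁ k = trans (L-factored k 1 (+ 1 / 2) (fromℕ 2) 1ℚ 0ℚ refl refl e-sum₁)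
    (minus-zero ((+ 1 / 2) * (fromℕ n - fromℕ 3) * (fromℕ n - fromℕ 2 * fromℕ k)) (fromℕ k))

  L₂ : ∀ k → L k n 2 ≡ (fromℕ n - fromℕ 3) * (fromℕ n - (+ 5 / 2) * fromℕ k) - fromℕ k * δ₁ n
  L₂ k = trans (L-factored k 2 1ℚ (+ 5 / 2) (+ 5 / 2) (δ₁ n) refl refl e-sum₂)
    (cong (λ y → y * (fromℕ n - (+ 5 / 2) * fromℕ k) - fromℕ k * δ₁ n) (*-identityˡ (fromℕ n - fromℕ 3)))

  L₃ : ∀ k → L k n 3 ≡ (+ 3 / 2) * (fromℕ n - fromℕ 3) * (fromℕ n - fromℕ 3 * fromℕ k) - fromℕ k * (δ₁ n + δ₂ n)
  L₃ k = L-factored k 3 (+ 3 / 2) (fromℕ 3) (+ 9 / 2) (δ₁ n + δ₂ n) refl refl e-sum₃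

  L₄ : ∀ k → L k n 4 ≡ fromℕ 2 * (fromℕ n - fromℕ 3) * (fromℕ n - (+ 27 / 8) * fromℕ k) - fromℕ k * (δ₁ n + δ₂ n + δ₃ n)
  L₄ k = L-factored k 4 (fromℕ 2) (+ 27 / 8) (+ 27 / 4) (δ₁ n + δ₂ n + δ₃ n) refl refl e-sum₄

  L₅ : ∀ k → L k n 5 ≡ (+ 5 / 2) * (fromℕ n - fromℕ 3) * (fromℕ n - (+ 37 / 10) * fromℕ k) - fromℕ k * (δ₁ n + δ₂ n + δ₃ n + δ₄ n)
  L₅ k = L-factored k 5 (+ 5 / 2) (+ 37 / 10) (+ 37 / 4) (δ₁ n + δ₂ n + δ₃ n + δ₄ n) refl refl e-sum₅

theorem8 :
  ∀ (k n : ℕ) → 3 ℕ.≤ k → 2 ℕ.* k ℕ.< n →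
  let
    K = fromℕ k
    N = fromℕ n
    case₁ = 2 ℕ.* k ℕ.< n × n ℕ.≤ 3 ℕ.* k
    case₂ = 3 ℕ.* k ℕ.< n × n ℕ.≤ 4 ℕ.* k
    case₃ = 4 ℕ.* k ℕ.< n × + n ℤ.≤ threshold k n
    case₄ = threshold k n ℤ.< + n × n ℕ.≤ 5 ℕ.* k
  in
    (case₁ →
      fromℕ (ν k n) ≥ L k n 1 ×
      L k n 1 ≡ (+ 1 / 2) * (N - fromℕ 3) * (N - fromℕ 2 * K))
  × (case₂ →
      fromℕ (ν k n) ≥ L k n 2 ×
      L k n 2 ≡ (N - fromℕ 3) * (N - (+ 5 / 2) * K) - K * δ₁ n)
  × (case₃ →
      fromℕ (ν k n) ≥ L k n 3 ×
      L k n 3 ≡ (+ 3 / 2) * (N - fromℕ 3) * (N - fromℕ 3 * K)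
                - K * (δ₁ n + δ₂ n))
  × (case₄ →
      fromℕ (ν k n) ≥ L k n 4 ×
      L k n 4 ≡ fromℕ 2 * (N - fromℕ 3) * (N - (+ 27 / 8) * K)
                - K * (δ₁ n + δ₂ n + δ₃ n))
  × (¬ case₁ → ¬ case₂ → ¬ case₃ → ¬ case₄ →
      fromℕ (ν k n) ≥ L k n 5 ×
      L k n 5 ≡ (+ 5 / 2) * (N - fromℕ 3) * (N - (+ 37 / 10) * K)
                - K * (δ₁ n + δ₂ n + δ₃ n + δ₄ n))
theorem8 (suc k) n 3≤k 2k<n =
    (λ _ → ν≥L k n 1 2≤n refl , L₁ 5≤n (suc k))
  , (λ _ → ν≥L k n 2 2≤n refl , L₂ 5≤n (suc k))
  , (λ _ → ν≥L k n 3 2≤n refl , L₃ 5≤n (suc k))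
  , (λ _ → ν≥L k n 4 2≤n refl , L₄ 5≤n (suc k))
  , (λ _ _ _ _ → ν≥L k n 5 2≤n refl , L₅ 5≤n (suc k))
  where
  -- Five vertices mean three inner ones, from where on all five extremal sizes are attained; here
  -- `n > 2k ≥ 6`.
  5≤n = ℕ.≤-trans (ℕ.m≤n+m 5 2) (ℕ.≤-trans (ℕ.s≤s (ℕ.*-monoʳ-≤ 2 3≤k)) 2k<n)
  2≤n = ℕ.≤-trans (ℕ.m≤n+m 2 3) 5≤n
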